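{- Let $\pi$ be a quasigraph in a $3$-hypergraph $H$ (with a fixed linear order $\leq_E$ on $E(H)$). If $\mathcal P^\pi_{\infty,\infty}$ is not $\pi$-skeletal or $\pi$ is not acyclic, then there is a quasigraph $\rho$ in $H$ such that either $\rho\sqsupset\pi$, or $\rho\equiv\pi$ and $\|\rho\|<\|\pi\|$.
   Context: A $3$-hypergraph $H$ is a finite hypergraph (multiple hyperedges allowed) all of whose hyperedges have size $2$ or $3$. A quasigraph $\pi$ in $H$ assigns to each hyperedge $e$ either a $2$-subset of $e$ or $\emptyset$; $e$ is used if $\pi(e)\ne\emptyset$; $\|\pi\|$ is the number of used hyperedges. $\pi^*$ is the multigraph on $V(H)$ with an edge $\pi(e)$ for each used $e$. $\pi$ is acyclic if $\pi^*$ is a forest; a quasicycle if $\pi^*$ is one cycle plus isolated vertices; a $3$-hypergraph is acyclic if it admits no quasicycle. $\pi-e$ has value $\emptyset$ on $e$ and equals $\pi$ elsewhere. For a partition $\mathcal P$ of $V(H)$, a hyperedge (or pair) is $\mathcal P$-crossing if it meets at least two classes; $e/\mathcal P$ is the set of classes met by $e$. $H/\mathcal P$ is the $3$-hypergraph on vertex set $\mathcal P$ with one hyperedge $e/\mathcal P$ for each $\mathcal P$-crossing hyperedge $e$ of $H$; $\pi/\mathcal P$ is the quasigraph in it with $(\pi/\mathcal P)(e/\mathcal P)=\pi(e)/\mathcal P$ if $\pi(e)$ is $\mathcal P$-crossing and $\emptyset$ otherwise. $\overline{\pi/\mathcal P}$ is the subhypergraph of $H/\mathcal P$ consisting of hyperedges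 not used by $\pi/\mathcal P$. For $X\subseteq V(H)$: $\pi$ is connected on $X$ if $\pi^*[X]$ is connected; components of $\pi$ on $X$ are vertex sets of components of $\pi^*[X]$. $\pi$ is anticonnected on $X$ (in $H$) if for every partition $\mathcal R$ of $X$ with $\ge2$ classes some hyperedge $f$ of $H$ meets $\ge2$ classes of $\mathcal R$ while $\pi(f)$ lies in one class (possibly $\pi(f)=\emptyset$); the maximal subsets of $X$ on which $\pi$ is anticonnected partition $X$ and are the anticomponents of $\pi$ on $X$. A partition is $\pi$-solid if $\pi$ is connected and anticonnected on each class; it is $\pi$-skeletal if it is $\pi$-solid and $\overline{\pi/\mathcal P}$ is acyclic. If $\pi$ is connected and anticonnected on $X$ and $|e\cap X|=2$: $e$ is an $X$-bridge if $e$ is used, $\pi(e)\subseteq X$ and $\pi-e$ is not connected on $X$; $e$ is an $X$-antibridge if $e$ is unused and $\pi$ is not anticonnected on $X$ in $H-e$. For a $\pi$-solid $\mathcal R$, $e$ is an $\mathcal R$-(anti)bridge if it is an $X$-(anti)bridge for some $X\in\mathcal R$. A $\mathcal R$-crossing hyperedge is redundant if it is unused and not an $\mathcal R$-antibridge; weakly redundant if it is redundant, or used and not an $\mathcal R$-bridge. Plane sequence: $\mathbb T=\{(i,j):0\le i<\infty,0\le j\le\infty\}\cup\{(\infty,\infty)\}$, ordered lexicographically. Set $\mathcal P_{0,0}=\{V(H)\}$. For $1\le j<\infty$, $\mathcal P_{i,j}$ consists of the components (if $j$ odd) or anticomponents (if $j$ even, $j>0$) of $\pi$ on the classes of $\mathcal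 P_{i,j-1}$; $\mathcal P_{i,\infty}$ is the eventual constant value of $\mathcal P_{i,j}$. For $i\ge1$ let $\mathcal P=\mathcal P_{i-1,\infty}$. The exposure step of two distinct classes $A,B$ of $\mathcal P$ is the least $(s,t)\in\mathbb T$ with $A,B$ in different classes of $\mathcal P_{s,t}$; the exposure step of a quasicycle $\gamma$ in $\overline{\pi/\mathcal P}$ is the least exposure step of $\gamma(e/\mathcal P)$ over hyperedges $e$ with $e/\mathcal P$ used by $\gamma$; such $e$ is a leading hyperedge of $\gamma$ if the exposure step of $\gamma(e/\mathcal P)$ equals that of $\gamma$. If $\overline{\pi/\mathcal P}$ has no quasicycle: $\mathcal P_{i,0}=\mathcal P$, $d_{i-1}=\mathrm{TERMINATE}$. Otherwise let $L$ be the set of hyperedges of $H$ that are leading hyperedges of some quasicycle in $\overline{\pi/\mathcal P}$; if $L$ contains a hyperedge weakly redundant w.r.t. $\pi,\mathcal P$: $\mathcal P_{i,0}=\mathcal P$, $d_{i-1}=\mathrm{STOP}$. Otherwise let $e$ be the $\leq_E$-maximum of $L$, $d_{i-1}=e$; if $e$ is a $\mathcal P$-antibridge, $\mathcal P_{i,0}$ consists of the anticomponents of $\pi$ in $H-e$ on the classes of $\mathcal P$; if $e$ is a $\mathcal P$-bridge, of the components of $\pi-e$ on the classes of $\mathcal P$. $\mathcal P_{\infty,\infty}$ is the eventual constant value of $\mathcal P_{i,\infty}$. We write $\mathcal P^\pi_{i,j}$, $d^\pi_i$. Signature: $\mathrm{sig}(\pi)=(\mathcal P_{0,0},\mathcal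 P_{0,1},\dots,\mathcal P_{0,\infty},d_0,\mathcal P_{1,0},\dots,\mathcal P_{1,\infty},d_1,\dots,\mathcal P_{\ell,\infty},d_\ell)$ with $\ell$ least such that $d_\ell\in\{\mathrm{TERMINATE},\mathrm{STOP}\}$. Partitions are compared by refinement ($\mathcal P\le\mathcal P'$ iff every class of $\mathcal P$ lies in a class of $\mathcal P'$); the values $d$ are compared by a fixed linear order on $E(H)\cup\{\mathrm{STOP},\mathrm{TERMINATE}\}$ extending $\leq_E$ in which STOP exceeds every hyperedge. $\mathrm{sig}(\pi)\le\mathrm{sig}(\rho)$ lexicographically if they are equal or at the first differing position the entry for $\pi$ is strictly smaller. $\pi\sqsubseteq\rho$ iff $\mathrm{sig}(\pi)\le\mathrm{sig}(\rho)$; $\pi\equiv\rho$ iff $\pi\sqsubseteq\rho$ and $\rho\sqsubseteq\pi$; $\rho\sqsupset\pi$ iff $\pi\sqsubseteq\rho$ and $\pi\not\equiv\rho$. -}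

module Defs where

open import Data.Nat using (ℕ; zero; suc; _+_; _*_; _<_; _≤_)
open import Data.Fin using (Fin; zero; suc; _≟_)
open import Data.Fin.Subset using (Subset; _∈_; ⁅_⁆; _∪_; ∣_∣)
open import Data.List using (List; map; allFin)
open import Data.Nat.ListAction using (sum)
open import Data.Maybe using (Maybe; just; nothing)
open import Data.Product using (Σ; ∃; ∃-syntax; _×_; _,_)
open import Data.Sum using (_⊎_)
open import Data.Unit using (⊤)
open import Data.Empty using (⊥)
open import Relation.Nullary using (¬_; yes; no)
open import Relation.Binary.PropositionalEquality using (_≡_; _≢_)
open import Relation.Binary.Structures using (IsStrictTotalOrder)

record Hyp : Set where
  field
    n    : ℕ
    m    : ℕ
    edge : Fin m → Subset n
    size : ∀ e → ∣ edge e ∣ ≡ 2 ⊎ ∣ edge e ∣ ≡ 3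
open Hyp public

data D (m : ℕ) : Set where
  edgeD     : Fin m → D m
  STOP      : D m
  TERMINATE : D m

record DOrder (m : ℕ) : Set₁ where
  field
    _<D_     : D m → D m → Set
    isSTO    : IsStrictTotalOrder _≡_ _<D_
    stopTop  : ∀ e → edgeD e <D STOP
open DOrder public

_≤E_ : ∀ {m} → DOrder m → Fin m → Fin m → Set
_≤E_ O e f = e ≡ f ⊎ _<D_ O (edgeD e) (edgeD f)

-- raw assignment: each hyperedge gets a set (nothing = ∅)
Asg : Hyp → Set
Asg H = Fin (m H) → Maybe (Subset (n H))

record Quasigraph (H : Hyp) : Set where
  field
    asg   : Asg H
    valid : ∀ e s → asg e ≡ just s →
            (∀ v → v ∈ s → v ∈ edge H e) × ∣ s ∣ ≡ 2
open Quasigraph public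

usedCount : {H : Hyp} → Quasigraph H → ℕ
usedCount {H} π = sum (map f (allFin (m H)))
  where
  f : Fin (m H) → ℕ
  f e with asg π e
  ... | just _  = 1
  ... | nothing = 0

remove : {H : Hyp} → Asg H → Fin (m H) → Asg H
remove π e f with f ≟ e
... | yes _ = nothing
... | no  _ = π f

cyc : ∀ {k} → Fin (suc k) → Fin (suc k)
cyc {zero}  zero    = zero
cyc {suc k} zero    = suc zero
cyc {suc k} (suc i) with cyc {k} i
... | zero  = zero
... | suc j = suc (suc j)

pair : ∀ {n} → Fin n → Fin n → Subset n
pair a b = ⁅ a ⁆ ∪ ⁅ b ⁆

record GCycle (H : Hyp) (π : Asg H) : Set where
  field
    k     : ℕ
    es    : Fin (suc (suc k)) → Fin (m H)
    esInj : ∀ i j → es i ≡ es j → i ≡ j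
    vs    : Fin (suc (suc k)) → Fin (n H)
    vsInj : ∀ i j → vs i ≡ vs j → i ≡ j
    on    : ∀ i → π (es i) ≡ just (pair (vs i) (vs (cyc i)))

Acyclic : (H : Hyp) → Asg H → Set
Acyclic H π = ¬ GCycle H π

-- Partitions of V(H), represented by their "same class" relation.

Part : Hyp → Set₁
Part H = Fin (n H) → Fin (n H) → Set

EqP : (H : Hyp) → Part H → Part H → Set
EqP H P Q = ∀ (x y : Fin (n H)) → (P x y → Q x y) × (Q x y → P x y)

RefP : (H : Hyp) → Part H → Part H → Set
RefP H P Q = ∀ (x y : Fin (n H)) → P x y → Q x y

data Conn (H : Hyp) (π : Asg H) (X : Fin (n H) → Set) (x : Fin (n H)) :
     Fin (n H) → Set where
  here : X x → Conn H π X x x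
  step : ∀ {y z} (e : Fin (m H)) (s : Subset (n H)) →
         Conn H π X x y → π e ≡ just s → y ∈ s → z ∈ s → X z →
         Conn H π X x z

ConnectedOn : (H : Hyp) → Asg H → (Fin (n H) → Set) → Set
ConnectedOn H π X = ∀ y z → X y → X z → Conn H π X y z

OneClass : (H : Hyp) → (Fin (n H) → Set) → (Fin (n H) → ℕ) →
           Maybe (Subset (n H)) → Set
OneClass H X c nothing  = ⊤
OneClass H X c (just s) = ∀ u v → u ∈ s → v ∈ s → X u × X v × c u ≡ c v

-- π anticonnected on X in the hypergraph with hyperedge set {f | ok f}.
-- Partitions R of X are given as the fibres (on X) of colourings c.
AntiConn : (H : Hyp) → (Fin (m H) → Set) → Asg H → (Fin (n H) → Set) → Set
AntiConn H ok π X =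
  ∀ (c : Fin (n H) → ℕ) →
  (∃[ x ] ∃[ y ] (X x × X y × c x ≢ c y)) →
  ∃[ f ] (ok f ×
          (∃[ u ] ∃[ v ] (u ∈ edge H f × v ∈ edge H f × X u × X v × c u ≢ c v)) ×
          OneClass H X c (π f))

allE : {H : Hyp} → Fin (m H) → Set
allE _ = ⊤

CompPart : (H : Hyp) → Asg H → Part H → Part H
CompPart H π Q x y = Conn H π (Q x) x y

AntiCompPart : (H : Hyp) → (Fin (m H) → Set) → Asg H → Part H → Part H
AntiCompPart H ok π Q x y =
  ∃[ S ] ((∀ z → z ∈ S → Q x z) ×
          AntiConn H ok π (_∈ S) ×
          (∀ T → (∀ z → z ∈ T → Q x z) → AntiConn H ok π (_∈ T) →
                 (∀ z → z ∈ S → z ∈ T) → ∀ z → z ∈ T → z ∈ S) ×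
          x ∈ S × y ∈ S)

Crossing : (H : Hyp) → Part H → Subset (n H) → Set
Crossing H P s = ∃[ u ] ∃[ v ] (u ∈ s × v ∈ s × ¬ P u v)

UnusedQ : (H : Hyp) → Asg H → Part H → Fin (m H) → Set
UnusedQ H π P e = π e ≡ nothing ⊎ ∃[ s ] (π e ≡ just s × ¬ Crossing H P s)

-- a quasicycle in the subhypergraph of H/P of hyperedges unused by π/P.
-- Vertices of H/P (classes of P) are given by representatives vs i; the
-- hyperedge e = es i is assigned the pair {class(vs i), class(vs (cyc i))}.
record QCycle (H : Hyp) (π : Asg H) (P : Part H) : Set where
  field
    k      : ℕ
    es     : Fin (suc (suc k)) → Fin (m H)
    esInj  : ∀ i j → es i ≡ es j → i ≡ j
    vs     : Fin (suc (suc k)) → Fin (n H)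
    vsDist : ∀ i j → P (vs i) (vs j) → i ≡ j
    meets  : ∀ i → ∃[ u ] ∃[ v ] (u ∈ edge H (es i) × v ∈ edge H (es i) ×
                                  P u (vs i) × P v (vs (cyc i)))
    unused : ∀ i → UnusedQ H π P (es i)

Two : (H : Hyp) → Fin (m H) → (Fin (n H) → Set) → Set
Two H e X = ∃[ u ] ∃[ v ] (u ≢ v × u ∈ edge H e × v ∈ edge H e × X u × X v ×
                         (∀ w → w ∈ edge H e → X w → w ≡ u ⊎ w ≡ v))

SolidOn : (H : Hyp) → Asg H → (Fin (n H) → Set) → Set
SolidOn H π X = ConnectedOn H π X × AntiConn H (allE {H}) π X

Bridge : (H : Hyp) → Asg H → Part H → Fin (m H) → Set
Bridge H π P e = ∃[ x ] (SolidOn H π (P x) × Two H e (P x) ×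
  (∃[ s ] (π e ≡ just s × (∀ z → z ∈ s → P x z))) ×
  ¬ ConnectedOn H (remove {H} π e) (P x))

Antibridge : (H : Hyp) → Asg H → Part H → Fin (m H) → Set
Antibridge H π P e = ∃[ x ] (SolidOn H π (P x) × Two H e (P x) ×
  π e ≡ nothing × ¬ AntiConn H (λ f → f ≢ e) π (P x))

Redundant : (H : Hyp) → Asg H → Part H → Fin (m H) → Set
Redundant H π P e =
  Crossing H P (edge H e) × π e ≡ nothing × ¬ Antibridge H π P e

WeaklyRedundant : (H : Hyp) → Asg H → Part H → Fin (m H) → Set
WeaklyRedundant H π P e = Redundant H π P e ⊎
  (Crossing H P (edge H e) × (∃[ s ] π e ≡ just s) × ¬ Bridge H π P e)

Skeletal : (H : Hyp) → Asg H → Part H → Set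
Skeletal H π P = (∀ x → SolidOn H π (P x)) × ¬ QCycle H π P

data Col : Set where
  fin : ℕ → Col
  inf : Col

data Pos : Set where
  pos : ℕ → Col → Pos
  top : Pos

_<C_ : Col → Col → Set
fin i <C fin j = i < j
fin i <C inf   = ⊤
inf   <C _     = ⊥

_<T_ : Pos → Pos → Set
pos i c <T pos i' c' = i < i' ⊎ (i ≡ i' × c <C c')
pos _ _ <T top       = ⊤
top     <T _         = ⊥

_≤T_ : Pos → Pos → Set
τ ≤T τ' = τ ≡ τ' ⊎ τ <T τ'

module _ (H : Hyp) (O : DOrder (m H)) (π : Asg H)
         (P : Pos → Part H) (d : ℕ → D (m H)) where

  ExpIs : Fin (n H) → Fin (n H) → Pos → Set
  ExpIs a b τ = ¬ P τ a b × (∀ τ' → ¬ P τ' a b → τ ≤T τ')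

  InL : Part H → Fin (m H) → Set
  InL Q e = Σ (QCycle H π Q) λ γ →
    let open QCycle γ in
    ∃[ i ] (es i ≡ e × ∃[ τ ] (ExpIs (vs i) (vs (cyc i)) τ ×
             (∀ j τ' → ExpIs (vs j) (vs (cyc j)) τ' → τ ≤T τ')))

  StepRule : ℕ → Set
  StepRule i =
      (¬ QCycle H π Q × EqP H Qn Q × d i ≡ TERMINATE)
    ⊎ (QCycle H π Q × (Σ (Fin (m H)) λ e → InL Q e × WeaklyRedundant H π Q e) ×
       EqP H Qn Q × d i ≡ STOP)
    ⊎ (Σ (Fin (m H)) λ e → InL Q e ×
        (∀ f → InL Q f → ¬ WeaklyRedundant H π Q f) ×
        (∀ f → InL Q f → _≤E_ O f e) ×
        d i ≡ edgeD e ×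
        ((Antibridge H π Q e × EqP H Qn (AntiCompPart H (λ f → f ≢ e) π Q))
         ⊎ (Bridge H π Q e × EqP H Qn (CompPart H (remove {H} π e) Q))))
    where
    Q  = P (pos i inf)
    Qn = P (pos (suc i) (fin 0))

record PlaneSeq (H : Hyp) (O : DOrder (m H)) (π : Asg H) : Set₁ where
  field
    P      : Pos → Part H
    d      : ℕ → D (m H)
    init   : EqP H (P (pos 0 (fin 0))) (λ _ _ → ⊤)
    odd    : ∀ i k → EqP H (P (pos i (fin (suc (2 * k)))))
                     (CompPart H π (P (pos i (fin (2 * k)))))
    even   : ∀ i k → EqP H (P (pos i (fin (suc (suc (2 * k))))))
                     (AntiCompPart H (allE {H}) π (P (pos i (fin (suc (2 * k))))))
    limRow : ∀ i → ∃[ J ] (∀ j → J ≤ j → EqP H (P (pos i (fin j))) (P (pos i inf)))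
    steps  : ∀ i → StepRule H O π P d i
    limAll : ∃[ I ] (∀ i → I ≤ i → EqP H (P (pos i inf)) (P top))
open PlaneSeq public

data SPos : Set where
  sP : ℕ → Col → SPos
  sD : ℕ → SPos

row : SPos → ℕ
row (sP i _) = i
row (sD i)   = i

_<S_ : SPos → SPos → Set
sP i c <S sP i' c' = i < i' ⊎ (i ≡ i' × c <C c')
sP i c <S sD i'    = i ≤ i'
sD i   <S sP i' c  = i < i'
sD i   <S sD i'    = i < i'

Terminal : ∀ {m} → D m → Set
Terminal d = d ≡ STOP ⊎ d ≡ TERMINATE

module _ {H : Hyp} {O : DOrder (m H)} {π ρ : Asg H} where

  -- the entry at p belongs to the signature (p lies before d_ℓ inclusive)
  InRange : ∀ {σ} → PlaneSeq H O σ → SPos → Set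
  InRange S p = ∀ i → i < row p → ¬ Terminal (d S i)

  EntryEq : PlaneSeq H O π → PlaneSeq H O ρ → SPos → Set
  EntryEq S T (sP i c) = EqP H (P S (pos i c)) (P T (pos i c))
  EntryEq S T (sD i)   = d S i ≡ d T i

  EntryLt : PlaneSeq H O π → PlaneSeq H O ρ → SPos → Set
  EntryLt S T (sP i c) = RefP H (P S (pos i c)) (P T (pos i c)) ×
                         ¬ EqP H (P S (pos i c)) (P T (pos i c))
  EntryLt S T (sD i)   = _<D_ O (d S i) (d T i)

  SigEqual : PlaneSeq H O π → PlaneSeq H O ρ → Set
  SigEqual S T = (∀ p → InRange S p → InRange T p × EntryEq S T p) ×
                 (∀ p → InRange T p → InRange S p)

  SigLe : PlaneSeq H O π → PlaneSeq H O ρ → Set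
  SigLe S T = SigEqual S T ⊎
    ∃[ p ] (InRange S p × InRange T p ×
            (∀ q → q <S p → EntryEq S T q) × EntryLt S T p)

SigGt : {H : Hyp} {O : DOrder (m H)} {π ρ : Asg H} →
        PlaneSeq H O ρ → PlaneSeq H O π → Set
SigGt T S = SigLe S T × ¬ SigLe T S

SigEquiv : {H : Hyp} {O : DOrder (m H)} {π ρ : Asg H} →
           PlaneSeq H O ρ → PlaneSeq H O π → Set
SigEquiv T S = SigLe S T × SigLe T S

{-# OPTIONS --safe #-}
module Submission where

-- Let ℓ be the first row with d_ℓ ∈ {STOP, TERMINATE} and P₀ = P_{ℓ,∞}.
-- If d_ℓ = STOP, let F be a weakly redundant leading hyperedge of a quasicycle γ in H/P₀. Then on each class
-- of P₀, π stays connected after removing F from π and anticonnected without F in H. The ends u, v of F chosen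
-- by γ are separated at the exposure step of γ; γ lies in one class before that. If components are formed at
-- this step, put ρ(F) = {u, v}; if anticomponents are formed, put ρ(F) = ∅. Either way the classes of u and v
-- merge there, while before that step no class of ρ is smaller than that of π: a path through F is rerouted
-- inside a class of P₀, and F as a hyperedge crossing a partition is replaced by another hyperedge of γ.
-- If d_ℓ = TERMINATE, then P_{∞,∞} is skeletal, so π* has a cycle. Only an anticomponent step can split
-- it; unusing a hyperedge of the cycle at the first such split makes the signature larger there, and
-- if there is no split, unusing any hyperedge of the cycle keeps or increases the signature.

open import Defs
open import Data.Bool using (true; false)
import Data.Bool.Properties as Boolₚ
open import Data.Empty using (⊥; ⊥-elim)
open import Data.Fin using (Fin; zero; suc; _≟_; toℕ; fromℕ; inject₁; fromℕ<; combine)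
open import Data.Fin.Properties
  using (any?; all?; injective⇒≤; toℕ-fromℕ<; toℕ-injective; suc-injective; inject₁-injective; combine-injective; ¬∀⟶∃¬; fromℕ≢inject₁)
import Data.Fin.Properties as Finₚ
open import Data.Fin.Relation.Unary.Top using (view; ‵fromℕ; ‵inject₁)
open import Data.Fin.Subset using (Subset; _∈_; _∉_; _⊂_; ⁅_⁆; _∪_; _-_; ∣_∣)
open import Data.Fin.Subset.Induction using (⊂-wellFounded; ⊃-wellFounded)
open import Data.Fin.Subset.Properties
open import Data.List using ([]; map; allFin)
import Data.List as List
open import Data.List.Membership.Propositional using () renaming (_∈_ to _∈L_)
open import Data.List.Membership.Propositional.Properties using (∈-allFin)
open import Data.List.Properties using (map-cong)
import Data.List.Relation.Unary.Any as Any
open import Data.Maybe using (Maybe; just; nothing)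
import Data.Maybe.Properties as Maybeₚ
open import Data.Nat using (ℕ; zero; suc; _+_; _*_; _<_; _≤_; _∸_; _⊔_; z≤n; s≤s)
open import Data.Nat.ListAction using (sum)
import Data.Nat.Properties as ℕₚ
open import Data.Product using (Σ; ∃; ∃-syntax; _×_; _,_; proj₁; proj₂)
open import Data.Sum using (_⊎_; inj₁; inj₂; [_,_]′)
open import Data.Unit using (⊤; tt)
import Data.Vec as Vec
open import Data.Vec using (tabulate)
open import Data.Vec.Functional using (_∷_)
import Data.Vec.Properties as Vecₚ
open import Data.Vec.Properties using (lookup∘tabulate; []=⇒lookup; lookup⇒[]=)
open import Function using (_∘_; id; case_of_)
open import Induction.WellFounded using (Acc; acc)
open import Relation.Binary.Definitions using (tri<; tri≈; tri>)
open import Relation.Binary.PropositionalEquality hiding (resp; J)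
open import Relation.Binary.Structures using (IsEquivalence; IsStrictTotalOrder)
open import Relation.Nullary using (¬_; Dec; yes; no; does)
open import Relation.Nullary.Decidable
  using (map′; _×-dec_; _⊎-dec_; _→-dec_; ¬?; decidable-stable; dec-true; dec-false)

-- Finite search

-- A new value of `F` may change the sequence long before the position aimed at, so the two
-- signatures cannot be computed side by side. It suffices to compare single steps: while all
-- earlier entries agree, the same operation on the same partition must give a coarser result for
-- the new quasigraph. If it is strictly coarser, the new signature is already larger; otherwise the
-- entries agree and the comparison goes on. The new quasigraph may acquire a weakly redundant
-- leader, and there the place of STOP above all hyperedges makes its signature larger.
--
-- Plane sequences are given by conditions, so one must be constructed for the new quasigraph. Case
-- distinctions must be constructive; as everything is finite, connectivity, anticonnectivity,
-- bridges, antibridges, cycles and leading hyperedges are decided by search.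

abstract
  -- The search reaches `f` only as `f zero ∷ (f ∘ suc)`, which equals it pointwise; hence the
  -- condition that `P` respects pointwise equality.
  anyFun? : ∀ {k a} {P : (Fin k → Fin a) → Set} →
            (∀ {f g} → (∀ i → f i ≡ g i) → P f → P g) →
            (∀ f → Dec (P f)) → Dec (∃ P)
  anyFun? {zero} resp P? =
    map′ (_ ,_) (λ { (f , p) → resp (λ ()) p }) (P? λ ())
  anyFun? {suc k} {a} {P} resp P? =
    map′ (λ { (x , f , p) → (x ∷ f) , p })
         (λ { (f , p) → f zero , f ∘ suc , resp (λ { zero → refl ; (suc i) → refl }) p })
         (any? λ x → anyFun? (λ eq → resp λ { zero → refl ; (suc i) → eq i })
                             (λ f → P? (x ∷ f)))

abstract
  ∀Fun? : ∀ {k a} {P : (Fin k → Fin a) → Set} →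
          (∀ {f g} → (∀ i → f i ≡ g i) → P f → P g) →
          (∀ f → Dec (P f)) → Dec (∀ f → P f)
  ∀Fun? resp P? = map′
    (λ ¬∃ f → decidable-stable (P? f) λ ¬p → ¬∃ (f , ¬p))
    (λ h (f , ¬p) → ¬p (h f))
    (¬? (anyFun? (λ eq ¬p p → ¬p (resp (sym ∘ eq) p)) (¬? ∘ P?)))

abstract
  ∀Subset? : ∀ {n} {P : Subset n → Set} → (∀ s → Dec (P s)) → Dec (∀ s → P s)
  ∀Subset? P? = map′
    (λ ¬∃ s → decidable-stable (P? s) λ ¬p → ¬∃ (s , ¬p))
    (λ h (s , ¬p) → ¬p (h s))
    (¬? (anySubset? (¬? ∘ P?)))

abstract
  maximum : ∀ {k} {P : Fin k → Set} (_≼_ : Fin k → Fin k → Set) →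
            (∀ i → i ≼ i) → (∀ {i j l} → i ≼ j → j ≼ l → i ≼ l) →
            (∀ i j → i ≼ j ⊎ j ≼ i) → (∀ i → Dec (P i)) → ∃ P →
            ∃[ i ] (P i × (∀ j → P j → j ≼ i))
  maximum {suc k} {P} _≼_ rfl trn tot P? ex with any? (P? ∘ suc) | P? zero
  ... | no ¬s | no ¬z = ⊥-elim (go ex)
    where
    go : ¬ ∃ P
    go (zero , p) = ¬z p
    go (suc i , p) = ¬s (i , p)
  ... | no ¬s | yes z = zero , z , λ { zero _ → rfl zero ; (suc j) p → ⊥-elim (¬s (j , p)) }
  ... | yes s | z? with maximum (λ i j → suc i ≼ suc j) (rfl ∘ suc) trn (λ i j → tot (suc i) (suc j)) (P? ∘ suc) s
  ... | (i , pi , mx) with z?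
  ... | no ¬z = suc i , pi , λ { zero p → ⊥-elim (¬z p) ; (suc j) p → mx j p }
  ... | yes z with tot zero (suc i)
  ... | inj₁ z≼i = suc i , pi , λ { zero _ → z≼i ; (suc j) p → mx j p }
  ... | inj₂ i≼z = zero , z , λ { zero _ → rfl zero ; (suc j) p → trn (mx j p) i≼z }

-- Subsets

module _ {n : ℕ} {P : Fin n → Set} (P? : ∀ x → Dec (P x)) where

  comprehension : Subset n
  comprehension = tabulate (does ∘ P?)

  ∈-comprehension⁺ : ∀ {x} → P x → x ∈ comprehension
  ∈-comprehension⁺ {x} p = lookup⇒[]= x _ (trans (lookup∘tabulate _ x) (dec-true (P? x) p))

  ∈-comprehension⁻ : ∀ {x} → x ∈ comprehension → P x
  ∈-comprehension⁻ {x} x∈ = decidable-stable (P? x) λ ¬p →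
    case trans (sym (dec-false (P? x) ¬p)) (trans (sym (lookup∘tabulate _ x)) ([]=⇒lookup x∈)) of λ ()

∣s∣≥2 : ∀ {n} {s : Subset n} {a b} → a ∈ s → b ∈ s → a ≢ b → 2 ≤ ∣ s ∣
∣s∣≥2 {s = s} {a} {b} a∈ b∈ a≢b =
  ℕₚ.≤-trans (s≤s (ℕₚ.≤-trans (s≤s z≤n) (x∈p⇒∣p-x∣<∣p∣ b∈′))) (x∈p⇒∣p-x∣<∣p∣ a∈)
  where
  b∈′ : b ∈ s - a
  b∈′ = x∈p∧x≢y⇒x∈p-y b∈ (a≢b ∘ sym)

∣s∣≥3 : ∀ {n} {s : Subset n} {a b c} → a ∈ s → b ∈ s → c ∈ s → a ≢ b → a ≢ c → b ≢ c → 3 ≤ ∣ s ∣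
∣s∣≥3 a∈ b∈ c∈ a≢b a≢c b≢c = ℕₚ.≤-trans
  (s≤s (∣s∣≥2 (x∈p∧x≢y⇒x∈p-y b∈ (a≢b ∘ sym)) (x∈p∧x≢y⇒x∈p-y c∈ (a≢c ∘ sym)) b≢c))
  (x∈p⇒∣p-x∣<∣p∣ a∈)

∣s∣≥4 : ∀ {n} {s : Subset n} {a b c d} → a ∈ s → b ∈ s → c ∈ s → d ∈ s →
        a ≢ b → a ≢ c → a ≢ d → b ≢ c → b ≢ d → c ≢ d → 4 ≤ ∣ s ∣
∣s∣≥4 a∈ b∈ c∈ d∈ a≢b a≢c a≢d b≢c b≢d c≢d = ℕₚ.≤-trans
  (s≤s (∣s∣≥3 (x∈p∧x≢y⇒x∈p-y b∈ (a≢b ∘ sym)) (x∈p∧x≢y⇒x∈p-y c∈ (a≢c ∘ sym))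
              (x∈p∧x≢y⇒x∈p-y d∈ (a≢d ∘ sym)) b≢c b≢d c≢d))
  (x∈p⇒∣p-x∣<∣p∣ a∈)

∈-of-two : ∀ {n} {s : Subset n} → ∣ s ∣ ≡ 2 → ∀ {a b} → a ∈ s → b ∈ s → a ≢ b →
           ∀ {w} → w ∈ s → w ≡ a ⊎ w ≡ b
∈-of-two eq {a} {b} a∈ b∈ a≢b {w} w∈ with w ≟ a | w ≟ b
... | yes p | _ = inj₁ p
... | no _ | yes p = inj₂ p
... | no p | no q = ⊥-elim (ℕₚ.<-irrefl (sym eq) (∣s∣≥3 a∈ b∈ w∈ a≢b (p ∘ sym) (q ∘ sym)))

∣s∣≡suc⇒∃ : ∀ {n k} (s : Subset n) → ∣ s ∣ ≡ suc k → ∃[ a ] a ∈ s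
∣s∣≡suc⇒∃ (true Vec.∷ s) _ = zero , Vec.here
∣s∣≡suc⇒∃ (false Vec.∷ s) eq = let (a , a∈) = ∣s∣≡suc⇒∃ s eq in suc a , Vec.there a∈

two-elements : ∀ {n} (s : Subset n) → ∣ s ∣ ≡ 2 → ∃[ a ] ∃[ b ] (a ∈ s × b ∈ s × a ≢ b)
two-elements (true Vec.∷ s) eq = let (b , b∈) = ∣s∣≡suc⇒∃ s (ℕₚ.suc-injective eq) in
  zero , suc b , Vec.here , Vec.there b∈ , λ ()
two-elements (false Vec.∷ s) eq = let (a , b , a∈ , b∈ , ne) = two-elements s eq in
  suc a , suc b , Vec.there a∈ , Vec.there b∈ , ne ∘ suc-injective

∈pair⁻ : ∀ {n} {a b x : Fin n} → x ∈ pair a b → x ≡ a ⊎ x ≡ b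
∈pair⁻ {a = a} {b} x∈ with x∈p∪q⁻ ⁅ a ⁆ ⁅ b ⁆ x∈
... | inj₁ p = inj₁ (x∈⁅y⁆⇒x≡y a p)
... | inj₂ p = inj₂ (x∈⁅y⁆⇒x≡y b p)

a∈pair : ∀ {n} (a b : Fin n) → a ∈ pair a b
a∈pair a b = x∈p∪q⁺ (inj₁ (x∈⁅x⁆ a))

b∈pair : ∀ {n} (a b : Fin n) → b ∈ pair a b
b∈pair a b = x∈p∪q⁺ (inj₂ (x∈⁅x⁆ b))

∣p∪q∣≤∣p∣+∣q∣ : ∀ {n} (p q : Subset n) → ∣ p ∪ q ∣ ≤ ∣ p ∣ + ∣ q ∣
∣p∪q∣≤∣p∣+∣q∣ Vec.[] Vec.[] = z≤n
∣p∪q∣≤∣p∣+∣q∣ (true Vec.∷ p) (true Vec.∷ q) =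
  s≤s (ℕₚ.≤-trans (∣p∪q∣≤∣p∣+∣q∣ p q) (ℕₚ.+-monoʳ-≤ ∣ p ∣ (ℕₚ.n≤1+n _)))
∣p∪q∣≤∣p∣+∣q∣ (true Vec.∷ p) (false Vec.∷ q) = s≤s (∣p∪q∣≤∣p∣+∣q∣ p q)
∣p∪q∣≤∣p∣+∣q∣ (false Vec.∷ p) (true Vec.∷ q) =
  ℕₚ.≤-trans (s≤s (∣p∪q∣≤∣p∣+∣q∣ p q)) (ℕₚ.≤-reflexive (sym (ℕₚ.+-suc ∣ p ∣ ∣ q ∣)))
∣p∪q∣≤∣p∣+∣q∣ (false Vec.∷ p) (false Vec.∷ q) = ∣p∪q∣≤∣p∣+∣q∣ p q

∣pair∣≡2 : ∀ {n} {a b : Fin n} → a ≢ b → ∣ pair a b ∣ ≡ 2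
∣pair∣≡2 {a = a} {b} a≢b = ℕₚ.≤-antisym
  (ℕₚ.≤-trans (∣p∪q∣≤∣p∣+∣q∣ ⁅ a ⁆ ⁅ b ⁆)
              (ℕₚ.≤-reflexive (cong₂ _+_ (∣⁅x⁆∣≡1 a) (∣⁅x⁆∣≡1 b))))
  (∣s∣≥2 (a∈pair a b) (b∈pair a b) a≢b)

_≟M_ : ∀ {n} (s t : Maybe (Subset n)) → Dec (s ≡ t)
_≟M_ = Maybeₚ.≡-dec (Vecₚ.≡-dec Boolₚ._≟_)

module _ {n : ℕ} where

  private
    Code : (Fin n → Fin n → Set) → Fin (n * n) → Set
    Code R i = ∃[ x ] ∃[ y ] (R x y × combine x y ≡ i)

    code? : {R : Fin n → Fin n → Set} → (∀ x y → Dec (R x y)) → ∀ i → Dec (Code R i)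
    code? R? i = any? λ x → any? λ y → R? x y ×-dec (combine x y ≟ i)

  abstract
    -- Coding a relation as a subset of `Fin (n * n)` turns strict refinement of partitions into
    -- `_⊂_`, whose well-foundedness bounds the number of refinements.
    graph : {R : Fin n → Fin n → Set} → (∀ x y → Dec (R x y)) → Subset (n * n)
    graph R? = comprehension (code? R?)

    graph-⊂ : {R R′ : Fin n → Fin n → Set}
              (R? : ∀ x y → Dec (R x y)) (R′? : ∀ x y → Dec (R′ x y)) →
              (∀ x y → R′ x y → R x y) → ∀ {x y} → R x y → ¬ R′ x y → graph R′? ⊂ graph R?
    graph-⊂ {R} {R′} R? R′? R′⊆R {x} {y} r ¬r′ =
      (λ i∈ → let (a , b , r′ , eq) = ∈-comprehension⁻ (code? R′?) i∈ in
              ∈-comprehension⁺ (code? R?) (a , b , R′⊆R a b r′ , eq)) ,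
      combine x y , ∈-comprehension⁺ (code? R?) (x , y , r , refl) ,
      λ i∈ → let (a , b , r′ , eq) = ∈-comprehension⁻ (code? R′?) i∈
                 (a≡x , b≡y) = combine-injective a b x y eq in
             ¬r′ (subst₂ R′ a≡x b≡y r′)

-- Cyclic successor

cyc-inject₁ : ∀ {k} (i : Fin k) → cyc (inject₁ i) ≡ suc i
cyc-inject₁ {suc k} zero = refl
cyc-inject₁ {suc k} (suc i) rewrite cyc-inject₁ i = refl

cyc-fromℕ : ∀ k → cyc (fromℕ k) ≡ zero
cyc-fromℕ zero = refl
cyc-fromℕ (suc k) rewrite cyc-fromℕ k = refl

cyc≢ : ∀ {k} (i : Fin (suc (suc k))) → cyc i ≢ i
cyc≢ {k} i eq with view i
... | ‵fromℕ with () ← trans (sym (cyc-fromℕ (suc k))) eq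
... | ‵inject₁ j = go j (trans (sym (cyc-inject₁ j)) eq)
  where
  go : ∀ {l} (j : Fin l) → suc j ≢ inject₁ j
  go (suc j) eq = go j (suc-injective eq)

module _ {V : Set} {_~_ : V → V → Set} (E : IsEquivalence _~_) where
  private
    module E = IsEquivalence E

  chain : ∀ {k} (v : Fin (suc k) → V) → (∀ j → v (inject₁ j) ~ v (suc j)) → ∀ i → v zero ~ v i
  chain v h zero = E.refl
  chain {suc k} v h (suc i) = E.trans (h zero) (chain (v ∘ suc) (h ∘ suc) i)

  private
    prefix : ∀ {k} (v : Fin (suc k) → V) i → (∀ j → inject₁ j ≢ i → v (inject₁ j) ~ v (suc j)) → v zero ~ v i
    prefix v zero h = E.refl
    prefix {suc k} v (suc i) h =
      E.trans (h zero λ ()) (prefix (v ∘ suc) i λ j ne → h (suc j) (ne ∘ suc-injective))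

    suffix : ∀ {k} (v : Fin (suc k) → V) i → (∀ j → j ≢ i → v (inject₁ j) ~ v (suc j)) → v (suc i) ~ v (fromℕ k)
    suffix {suc k} v zero h = chain (v ∘ suc) (λ j → h (suc j) λ ()) (fromℕ k)
    suffix {suc k} v (suc i) h = suffix (v ∘ suc) i λ j ne → h (suc j) (ne ∘ suc-injective)

  -- The other links form a path the other way round, through the closing link from the last vertex
  -- to `v zero` unless that is the omitted one. It serves both to bypass an edge of a cycle and to
  -- show that a colouring cannot change along exactly one edge.
  around : ∀ {k} (v : Fin (suc k) → V) i → (∀ j → j ≢ i → v j ~ v (cyc j)) → v i ~ v (cyc i)
  around {k} v i h with view i
  ... | ‵fromℕ = subst (λ z → v i ~ v z) (sym (cyc-fromℕ k))
    (E.sym (prefix v i λ j ne → subst (λ z → v (inject₁ j) ~ v z) (cyc-inject₁ j) (h (inject₁ j) ne)))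
  ... | ‵inject₁ j₀ = subst (λ z → v i ~ v z) (sym (cyc-inject₁ j₀))
    (E.sym (E.trans (suffix v j₀ λ j ne → step′ j (ne ∘ inj))
           (E.trans (subst (λ z → v (fromℕ k) ~ v z) (cyc-fromℕ k) (h (fromℕ k) fromℕ≢inject₁))
                    (prefix v i step′))))
    where
    inj : ∀ {j} → inject₁ j ≡ inject₁ j₀ → j ≡ j₀
    inj = inject₁-injective
    step′ : ∀ j → inject₁ j ≢ inject₁ j₀ → v (inject₁ j) ~ v (suc j)
    step′ j ne = subst (λ z → v (inject₁ j) ~ v z) (cyc-inject₁ j) (h (inject₁ j) ne)

  all-related : ∀ {k} (v : Fin (suc k) → V) → (∀ j → v j ~ v (cyc j)) → ∀ i j → v i ~ v j
  all-related v h i j = E.trans (E.sym (ch i)) (ch j)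
    where
    ch : ∀ i → v zero ~ v i
    ch = chain v λ j → subst (λ z → v (inject₁ j) ~ v z) (cyc-inject₁ j) (h (inject₁ j))

-- Deciding the existence of cycles

module _ {a b : ℕ} (_~_ : Fin b → Fin b → Set) (~? : ∀ x y → Dec (x ~ y))
         (Θ : Fin a → Fin b → Fin b → Fin a → Fin b → Fin b → Set) where

  -- One form for all cycles to be searched. `Θ` compares a distinguished place `i` with every place
  -- `j`: for leading hyperedges `i` is the place of the leader, while cycles and quasicycles ignore
  -- the first triple.
  CycleAt : ∀ {k} → (Fin (suc (suc k)) → Fin a) → (Fin (suc (suc k)) → Fin b) → Set
  CycleAt es vs = (∀ i j → es i ≡ es j → i ≡ j) × (∀ i j → vs i ~ vs j → i ≡ j) ×
    ∃[ i ] (∀ j → Θ (es i) (vs i) (vs (cyc i)) (es j) (vs j) (vs (cyc j)))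

  private
    transport : ∀ {x x′ y y′ z z′ u u′ v v′ w w′} → x ≡ x′ → y ≡ y′ → z ≡ z′ → u ≡ u′ → v ≡ v′ → w ≡ w′ →
                Θ x y z u v w → Θ x′ y′ z′ u′ v′ w′
    transport refl refl refl refl refl refl θ = θ

    cresp : ∀ {k} {es es′ : Fin (suc (suc k)) → Fin a} {vs vs′ : Fin (suc (suc k)) → Fin b} →
           (∀ i → es i ≡ es′ i) → (∀ i → vs i ≡ vs′ i) → CycleAt es vs → CycleAt es′ vs′
    cresp p q (ei , vi , i , θ) =
      (λ i j eq → ei i j (trans (p i) (trans eq (sym (p j))))) ,
      (λ i j r → vi i j (subst₂ _~_ (sym (q i)) (sym (q j)) r)) ,
      i , λ j → transport (p i) (q i) (q (cyc i)) (p j) (q j) (q (cyc j)) (θ j)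

  abstract
    -- Injectivity of `es` bounds the length by `a`. `Θ` has to be decided only for unrelated
    -- neighbours, because an exposure step exists only for distinct classes.
    cycle? : (∀ x y z u v w → ¬ y ~ z → ¬ v ~ w → Dec (Θ x y z u v w)) →
             Dec (∃[ k ] ∃[ es ] ∃[ vs ] CycleAt {k} es vs)
    cycle? Θ? = map′
      (λ { (k , p) → toℕ k , p })
      (λ { (k , es , vs , c) → let k<a = ℕₚ.≤-trans (ℕₚ.n≤1+n _) (injective⇒≤ {f = es} (λ {i} {j} → proj₁ c i j)) in
           fromℕ< k<a , subst (λ k → ∃[ es ] ∃[ vs ] CycleAt {k} es vs) (sym (toℕ-fromℕ< k<a)) (es , vs , c) })
      (any? λ k → anyFun? (λ { eq (vs , c) → vs , cresp eq (λ _ → refl) c }) λ es →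
                  anyFun? (cresp (λ _ → refl)) (at? es))
      where
      at? : ∀ {k} es vs → Dec (CycleAt {k} es vs)
      at? es vs with all? (λ i → all? λ j → (es i ≟ es j) →-dec (i ≟ j))
                   | all? (λ i → all? λ j → ~? (vs i) (vs j) →-dec (i ≟ j))
      ... | no ¬p | _ = no (¬p ∘ proj₁)
      ... | yes p | no ¬q = no (¬q ∘ proj₁ ∘ proj₂)
      ... | yes p | yes q = map′ (λ r → p , q , r) (proj₂ ∘ proj₂)
        (any? λ i → all? λ j → Θ? _ _ _ _ _ _ (cyc≢ i ∘ sym ∘ q i (cyc i)) (cyc≢ j ∘ sym ∘ q j (cyc j)))

-- Every colouring by ℕ has the same fibres as one by Fin n.
canonical : ∀ {n} (c : Fin n → ℕ) →
            ∃[ c′ ] (∀ x y → toℕ {n} (c′ x) ≡ toℕ (c′ y) → c x ≡ c y) ×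
                    (∀ x y → c x ≡ c y → toℕ (c′ x) ≡ toℕ (c′ y))
canonical {n} c = c′ , (λ x y eq → trans (sym (ok x)) (trans (cong c (toℕ-injective eq)) (ok y))) , λ x y eq → cong toℕ (same x y eq)
  where
  -- The new colour of a vertex is the least vertex of its fibre.
  least : ∀ x → ∃[ u ] (c u ≡ c x × (∀ v → c v ≡ c x → u Data.Fin.≤ v))
  least x = maximum (λ i j → j Data.Fin.≤ i) (λ i → Finₚ.≤-refl {x = i})
                    (λ {i} {j} {l} p q → Finₚ.≤-trans {i = l} {j} {i} q p) (λ i j → Finₚ.≤-total j i)
                    (λ v → c v ℕₚ.≟ c x) (x , refl)
  c′ : Fin n → Fin n
  c′ x = proj₁ (least x)
  ok : ∀ x → c (c′ x) ≡ c x
  ok x = proj₁ (proj₂ (least x))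
  same : ∀ x y → c x ≡ c y → c′ x ≡ c′ y
  same x y eq = Finₚ.≤-antisym (proj₂ (proj₂ (least x)) _ (trans (ok y) (sym eq)))
                          (proj₂ (proj₂ (least y)) _ (trans (ok x) eq))

-- Connectivity, anticonnectivity and the partitions they define

module Ops (H : Hyp) where

  V = Fin (n H)
  E = Fin (m H)

  Joined : Asg H → E → V → V → Set
  Joined σ e y z = ∃[ s ] (σ e ≡ just s × y ∈ s × z ∈ s)

  joined? : ∀ σ e y z → Dec (Joined σ e y z)
  joined? σ e y z with σ e
  ... | nothing = no λ ()
  ... | just s = map′ (λ { (p , q) → s , refl , p , q }) (λ { (_ , refl , p , q) → p , q })
                      (y ∈? s ×-dec z ∈? s)

  module _ {σ : Asg H} {X : V → Set} where

    Conn-∈ʳ : ∀ {x y} → Conn H σ X x y → X y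
    Conn-∈ʳ (here p) = p
    Conn-∈ʳ (step _ _ _ _ _ _ p) = p

    Conn-∈ˡ : ∀ {x y} → Conn H σ X x y → X x
    Conn-∈ˡ (here p) = p
    Conn-∈ˡ (step _ _ c _ _ _ _) = Conn-∈ˡ c

    Conn-trans : ∀ {x y z} → Conn H σ X x y → Conn H σ X y z → Conn H σ X x z
    Conn-trans c (here _) = c
    Conn-trans c (step e s d p q r t) = step e s (Conn-trans c d) p q r t

    Conn-edge : ∀ {x y} e → X x → X y → Joined σ e x y → Conn H σ X x y
    Conn-edge e p q (s , eq , x∈ , y∈) = step e s (here p) eq x∈ y∈ q

    Conn-sym : ∀ {x y} → Conn H σ X x y → Conn H σ X y x
    Conn-sym (here p) = here p
    Conn-sym (step e s c eq y∈ z∈ p) =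
      Conn-trans (Conn-edge e p (Conn-∈ʳ c) (s , eq , z∈ , y∈)) (Conn-sym c)

  Conn-bind : ∀ {σ σ′ : Asg H} {X X′ : V → Set} → (∀ {x} → X x → X′ x) →
              (∀ e y z → Joined σ e y z → X y → X z → Conn H σ′ X′ y z) →
              ∀ {x y} → Conn H σ X x y → Conn H σ′ X′ x y
  Conn-bind X⊆ f (here p) = here (X⊆ p)
  Conn-bind X⊆ f (step e s c eq y∈ z∈ p) =
    Conn-trans (Conn-bind X⊆ f c) (f e _ _ (s , eq , y∈ , z∈) (Conn-∈ʳ c) p)

  module _ {σ : Asg H} {X : V → Set} (X? : ∀ x → Dec (X x)) where
    private
      Exit : Subset (n H) → Set
      Exit S = ∃[ e ] ∃[ y ] ∃[ z ] (Joined σ e y z × y ∈ S × z ∉ S × X z)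

      exit? : ∀ S → Dec (Exit S)
      exit? S = any? λ e → any? λ y → any? λ z →
        joined? σ e y z ×-dec y ∈? S ×-dec ¬? (z ∈? S) ×-dec X? z

      -- Reachable vertices are added one at a time; a set that contains `x` and has no exit
      -- contains everything reachable from `x`.
      closure : ∀ {x} S → Acc (λ p q → q ⊂ p) S → x ∈ S → (∀ {y} → y ∈ S → Conn H σ X x y) →
                ∃[ T ] (x ∈ T × (∀ {y} → y ∈ T → Conn H σ X x y) × ¬ Exit T)
      closure S (acc rs) x∈ sound with exit? S
      ... | no ¬ex = S , x∈ , sound , ¬ex
      ... | yes (e , y , z , j , y∈ , z∉ , Xz) = closure (S ∪ ⁅ z ⁆)
        (rs (p⊆p∪q _ , z , q⊆p∪q _ _ (x∈⁅x⁆ z) , z∉)) (p⊆p∪q _ x∈) sound′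
        where
        sound′ : ∀ {w} → w ∈ S ∪ ⁅ z ⁆ → Conn H σ X _ w
        sound′ w∈ with x∈p∪q⁻ S ⁅ z ⁆ w∈
        ... | inj₁ w∈S = sound w∈S
        ... | inj₂ w∈z with refl ← x∈⁅y⁆⇒x≡y z w∈z =
          Conn-trans (sound y∈) (Conn-edge e (Conn-∈ʳ (sound y∈)) Xz j)

    abstract
      conn? : ∀ x y → Dec (Conn H σ X x y)
      conn? x y with X? x
      ... | no ¬Xx = no (¬Xx ∘ Conn-∈ˡ)
      ... | yes Xx with closure ⁅ x ⁆ (⊃-wellFounded _) (x∈⁅x⁆ x)
                          (λ y∈ → subst (Conn H σ X x) (sym (x∈⁅y⁆⇒x≡y x y∈)) (here Xx))
      ... | T , x∈ , sound , ¬ex = map′ sound complete (y ∈? T)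
        where
        complete : ∀ {y} → Conn H σ X x y → y ∈ T
        complete (here _) = x∈
        complete {z} (step e s c eq y∈ z∈ Xz) = decidable-stable (z ∈? T) λ z∉ →
          ¬ex (e , _ , z , (s , eq , y∈ , z∈) , complete c , z∉ , Xz)

  NonConstant : (V → Set) → (V → ℕ) → Set
  NonConstant X c = ∃[ x ] ∃[ y ] (X x × X y × c x ≢ c y)

  Split : (V → Set) → (V → ℕ) → E → Set
  Split X c f = ∃[ u ] ∃[ v ] (u ∈ edge H f × v ∈ edge H f × X u × X v × c u ≢ c v)

  OneClass-⊆ : ∀ {X X′ c} s → (∀ {x} → X x → X′ x) → OneClass H X c s → OneClass H X′ c s
  OneClass-⊆ nothing _ _ = tt
  OneClass-⊆ (just s) X⊆ h u v u∈ v∈ = let (p , q , eq) = h u v u∈ v∈ in X⊆ p , X⊆ q , eq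

  Witness : (E → Set) → Asg H → (V → Set) → (V → ℕ) → E → Set
  Witness ok σ X c f = ok f × Split X c f × OneClass H X c (σ f)

  Witness-⊆ : ∀ ok σ {X X′ c f} → (∀ {x} → X x → X′ x) → Witness ok σ X c f → Witness ok σ X′ c f
  Witness-⊆ ok σ {f = f} X⊆ (o , (u , v , u∈ , v∈ , p , q , ne) , oc) =
    o , (u , v , u∈ , v∈ , X⊆ p , X⊆ q , ne) , OneClass-⊆ (σ f) X⊆ oc

  module _ {ok : E → Set} {σ : Asg H} where

    AntiConn-resp : ∀ {X X′} → (∀ {x} → X x → X′ x) → (∀ {x} → X′ x → X x) →
                    AntiConn H ok σ X → AntiConn H ok σ X′
    AntiConn-resp ⊆ ⊇ ac c (x , y , p , q , ne) with ac c (x , y , ⊇ p , ⊇ q , ne)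
    ... | f , w = f , Witness-⊆ ok σ ⊆ w

    AntiConn-⁅⁆ : ∀ x → AntiConn H ok σ (_∈ ⁅ x ⁆)
    AntiConn-⁅⁆ x c (a , b , a∈ , b∈ , ne) =
      ⊥-elim (ne (cong c (trans (x∈⁅y⁆⇒x≡y x a∈) (sym (x∈⁅y⁆⇒x≡y x b∈)))))

    AntiConn-pair : ∀ {f u v} → ok f → u ∈ edge H f → v ∈ edge H f → σ f ≡ nothing →
                    AntiConn H ok σ (_∈ pair u v)
    AntiConn-pair {f} {u} {v} o u∈ v∈ eq c (a , b , a∈ , b∈ , ne) =
      f , o , (u , v , u∈ , v∈ , a∈pair u v , b∈pair u v , cu≢cv) , subst (OneClass H _ c) (sym eq) tt
      where
      cu≢cv : c u ≢ c v
      cu≢cv e with ∈pair⁻ a∈ | ∈pair⁻ b∈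
      ... | inj₁ refl | inj₁ refl = ne refl
      ... | inj₁ refl | inj₂ refl = ne e
      ... | inj₂ refl | inj₁ refl = ne (sym e)
      ... | inj₂ refl | inj₂ refl = ne refl

    -- A colouring that is not constant on the union differs from `c w` somewhere, and the part in
    -- which this happens supplies the witness. So lying in a common anticonnected set is
    -- transitive.
    AntiConn-∪ : ∀ {S T w} → w ∈ S → w ∈ T → AntiConn H ok σ (_∈ S) → AntiConn H ok σ (_∈ T) →
                 AntiConn H ok σ (_∈ S ∪ T)
    AntiConn-∪ {S} {T} {w} wS wT acS acT c (x , y , x∈ , y∈ , ne) =
      [ side x∈ , side y∈ ]′ split
      where
      split : c x ≢ c w ⊎ c y ≢ c w
      split with c x ℕₚ.≟ c w
      ... | no p = inj₁ p
      ... | yes p = inj₂ λ q → ne (trans p (sym q))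
      side : ∀ {z} → z ∈ S ∪ T → c z ≢ c w → ∃[ f ] Witness ok σ (_∈ S ∪ T) c f
      side {z} z∈ ne with x∈p∪q⁻ S T z∈
      ... | inj₁ zS = let (f , wit) = acS c (z , w , zS , wS , ne) in f , Witness-⊆ ok σ (p⊆p∪q T) wit
      ... | inj₂ zT = let (f , wit) = acT c (z , w , zT , wT , ne) in f , Witness-⊆ ok σ (q⊆p∪q S T) wit

    module _ (ok? : ∀ f → Dec (ok f)) {X : V → Set} (X? : ∀ x → Dec (X x)) where
      private
        _↝_ : (V → ℕ) → (V → ℕ) → Set
        c ↝ c′ = ∀ x y → c x ≡ c y → c′ x ≡ c′ y

        oneClass-↝ : ∀ {c c′} → c ↝ c′ → ∀ s → OneClass H X c s → OneClass H X c′ s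
        oneClass-↝ _ nothing _ = tt
        oneClass-↝ to (just s) h u v u∈ v∈ = let (p , q , eq) = h u v u∈ v∈ in p , q , to u v eq

        Test : (V → ℕ) → Set
        Test c = NonConstant X c → ∃[ f ] Witness ok σ X c f

        test-↝ : ∀ {c c′} → c ↝ c′ → c′ ↝ c → Test c → Test c′
        test-↝ to from t (x , y , p , q , ne) with t (x , y , p , q , ne ∘ to x y)
        ... | f , o , (u , v , u∈ , v∈ , p , q , ne) , oc =
          f , o , (u , v , u∈ , v∈ , p , q , ne ∘ from u v) , oneClass-↝ to (σ f) oc

        oneClass? : ∀ c s → Dec (OneClass H X c s)
        oneClass? c nothing = yes tt
        oneClass? c (just s) = all? λ u → all? λ v → (u ∈? s) →-dec (v ∈? s) →-dec
                               (X? u ×-dec X? v ×-dec (c u ℕₚ.≟ c v))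

        test? : ∀ c → Dec (Test c)
        test? c = (any? λ x → any? λ y → X? x ×-dec X? y ×-dec ¬? (c x ℕₚ.≟ c y))
          →-dec any? λ f → ok? f ×-dec
            (any? λ u → any? λ v → u ∈? edge H f ×-dec v ∈? edge H f ×-dec X? u ×-dec X? v ×-dec ¬? (c u ℕₚ.≟ c v))
            ×-dec oneClass? c (σ f)

      abstract
        -- Whether a colouring has a witness depends on its fibres only, so by `canonical` the
        -- finitely many colourings with values in `V` suffice.
        antiConn? : Dec (AntiConn H ok σ X)
        antiConn? = map′
          (λ h c → let (c′ , to , from) = canonical c in test-↝ to from (h c′))
          (λ ac c → ac (toℕ ∘ c))
          (∀Fun? {P = λ c → Test (λ x → toℕ {n H} (c x))}
                 (λ eq → test-↝ (λ x y p → trans (cong toℕ (sym (eq x))) (trans p (cong toℕ (eq y))))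
                                (λ x y p → trans (cong toℕ (eq x)) (trans p (cong toℕ (sym (eq y))))))
                 (λ c → test? (toℕ ∘ c)))

  -- Refinement into components or anticomponents, with the given hyperedge (if any) left out.
  data Kind : Set where
    cmp ant : Maybe E → Kind

  -- There are two ways of leaving a hyperedge out: for components its value is emptied, for
  -- anticomponents (`allowed`) the hyperedge itself is forbidden as a witness.
  drop : Maybe E → Asg H → Asg H
  drop nothing σ = σ
  drop (just e) σ = remove {H} σ e

  allowed : Maybe E → E → Set
  allowed nothing = allE {H}
  allowed (just e) f = f ≢ e

  allowed? : ∀ M f → Dec (allowed M f)
  allowed? nothing f = yes tt
  allowed? (just e) f = ¬? (f ≟ e)

  op : Kind → Asg H → Part H → Part H
  op (cmp M) σ Q = CompPart H (drop M σ) Q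
  op (ant M) σ Q = AntiCompPart H (allowed M) σ Q

  EqP-refl : ∀ {P : Part H} → EqP H P P
  EqP-refl x y = id , id

  EqP-sym : ∀ {P Q : Part H} → EqP H P Q → EqP H Q P
  EqP-sym h x y = proj₂ (h x y) , proj₁ (h x y)

  EqP-trans : ∀ {P Q R : Part H} → EqP H P Q → EqP H Q R → EqP H P R
  EqP-trans h k x y = proj₁ (k x y) ∘ proj₁ (h x y) , proj₂ (h x y) ∘ proj₂ (k x y)

  EqP-⊆ : ∀ {P Q : Part H} → EqP H P Q → RefP H P Q
  EqP-⊆ h x y = proj₁ (h x y)

  EqP-⊇ : ∀ {P Q : Part H} → EqP H P Q → RefP H Q P
  EqP-⊇ h x y = proj₂ (h x y)

  -- A `Part` is an arbitrary relation. That it is an equivalence has to be derived along the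
  -- sequence, and decidability is what permits arguments by contradiction.
  record Good (Q : Part H) : Set where
    field
      isEq : IsEquivalence Q
      dec  : ∀ x y → Dec (Q x y)
    open IsEquivalence isEq public renaming (refl to rfl; sym to sy; trans to tra)

  Good-resp : ∀ {P Q} → EqP H P Q → Good P → Good Q
  Good-resp h g = record
    { isEq = record { refl = λ {x} → EqP-⊆ h x x g.rfl
                    ; sym = λ {x} {y} p → EqP-⊆ h y x (g.sy (EqP-⊇ h x y p))
                    ; trans = λ {x} {y} {z} p q → EqP-⊆ h x z (g.tra (EqP-⊇ h x y p) (EqP-⊇ h y z q)) }
    ; dec = λ x y → map′ (EqP-⊆ h x y) (EqP-⊇ h x y) (g.dec x y) }
    where module g = Good g

  op-⊆ : ∀ κ σ Q → RefP H (op κ σ Q) Q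
  op-⊆ (cmp M) σ Q x y c = Conn-∈ʳ c
  op-⊆ (ant M) σ Q x y (S , S⊆ , _ , _ , _ , y∈) = S⊆ y y∈

  op-cong⊆ : ∀ κ σ {Q Q′} → EqP H Q Q′ → RefP H (op κ σ Q) (op κ σ Q′)
  op-cong⊆ (cmp M) σ h x y = Conn-bind (EqP-⊆ h x _) λ e y z j p q →
    Conn-edge e (EqP-⊆ h x _ p) (EqP-⊆ h x _ q) j
  op-cong⊆ (ant M) σ h x y (S , S⊆ , ac , mx , x∈ , y∈) =
    S , (λ z z∈ → EqP-⊆ h x z (S⊆ z z∈)) , ac ,
    (λ T T⊆ → mx T λ z z∈ → EqP-⊇ h x z (T⊆ z z∈)) , x∈ , y∈

  op-cong : ∀ κ σ {Q Q′} → EqP H Q Q′ → EqP H (op κ σ Q) (op κ σ Q′)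
  op-cong κ σ h x y = op-cong⊆ κ σ h x y , op-cong⊆ κ σ (EqP-sym h) x y

  module _ {ok : E → Set} (ok? : ∀ f → Dec (ok f)) (σ : Asg H) {Q : Part H} (G : Good Q) where
    open Good G
    private
      within? : ∀ x S → Dec (∀ z → z ∈ S → Q x z)
      within? x S = all? λ z → (z ∈? S) →-dec dec x z

      anti? : ∀ S → Dec (AntiConn H ok σ (_∈ S))
      anti? S = antiConn? ok? (_∈? S)

      extend : ∀ {x y} S → Acc (λ p q → q ⊂ p) S → (∀ z → z ∈ S → Q x z) → AntiConn H ok σ (_∈ S) →
               x ∈ S → y ∈ S → AntiCompPart H ok σ Q x y
      extend {x} S (acc rs) S⊆ ac x∈ y∈ with anySubset? (λ T →
        within? x T ×-dec anti? T ×-dec (all? λ z → (z ∈? S) →-dec (z ∈? T)) ×-dec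
        (any? λ z → z ∈? T ×-dec ¬? (z ∈? S)))
      ... | yes (T , T⊆ , acT , S⊆T , z , z∈ , z∉) =
        extend T (rs ((λ {z} → S⊆T z) , z , z∈ , z∉)) T⊆ acT (S⊆T _ x∈) (S⊆T _ y∈)
      ... | no ¬T = S , S⊆ , ac , mx , x∈ , y∈
        where
        mx : ∀ T → (∀ z → z ∈ T → Q x z) → AntiConn H ok σ (_∈ T) →
             (∀ z → z ∈ S → z ∈ T) → ∀ z → z ∈ T → z ∈ S
        mx T T⊆ acT S⊆T z z∈ = decidable-stable (z ∈? S) λ z∉ → ¬T (T , T⊆ , acT , S⊆T , z , z∈ , z∉)

    abstract
      -- `AntiCompPart` asks for a maximal set. By finiteness every anticonnected set inside the
      -- class extends to a maximal one, so later proofs need only exhibit some anticonnected set.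
      anti-intro : ∀ {X : V → Set} → (∀ x → Dec (X x)) → ∀ {x y} → (∀ {z} → X z → Q x z) →
                   AntiConn H ok σ X → X x → X y → AntiCompPart H ok σ Q x y
      anti-intro X? X⊆ ac Xx Xy = extend (comprehension X?) (⊃-wellFounded _)
        (λ z → X⊆ ∘ ∈-comprehension⁻ X?)
        (AntiConn-resp (∈-comprehension⁺ X?) (∈-comprehension⁻ X?) ac)
        (∈-comprehension⁺ X? Xx) (∈-comprehension⁺ X? Xy)

    abstract
      anti-good : Good (AntiCompPart H ok σ Q)
      anti-good = record
        { isEq = record
          { refl = λ {x} → anti-intro (_∈? ⁅ x ⁆) (λ z∈ → subst (Q x) (sym (x∈⁅y⁆⇒x≡y x z∈)) rfl)
                             (AntiConn-⁅⁆ x) (x∈⁅x⁆ x) (x∈⁅x⁆ x)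
          ; sym = λ { {x} {y} (S , S⊆ , ac , _ , x∈ , y∈) →
              anti-intro (_∈? S) (λ {z} z∈ → tra (sy (S⊆ y y∈)) (S⊆ z z∈)) ac y∈ x∈ }
          ; trans = λ { {x} {y} {z} (S , S⊆ , ac , _ , x∈ , y∈) (T , T⊆ , ac′ , _ , y∈′ , z∈) →
              anti-intro (_∈? (S ∪ T))
                (λ {w} w∈ → [ S⊆ w , (λ w∈T → tra (S⊆ y y∈) (T⊆ w w∈T)) ]′ (x∈p∪q⁻ S T w∈))
                (AntiConn-∪ y∈ y∈′ ac ac′) (p⊆p∪q T x∈) (q⊆p∪q S T z∈) } }
        ; dec = λ x y → anySubset? λ S → within? x S ×-dec anti? S ×-dec
            ∀Subset? (λ T → within? x T →-dec anti? T →-dec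
                            (all? λ z → (z ∈? S) →-dec (z ∈? T)) →-dec
                            (all? λ z → (z ∈? T) →-dec (z ∈? S)))
            ×-dec x ∈? S ×-dec y ∈? S }

    -- Two vertices of the class with different colours share an anticonnected set. The class
    -- contains this set, so its witness serves the class as well.
    anti-class : ∀ x → AntiConn H ok σ (AntiCompPart H ok σ Q x)
    anti-class x c (y , z , Ry , Rz , ne) with R.tra (R.sy Ry) Rz
      where module R = Good anti-good
    ... | S , S⊆ , ac , mx , y∈ , z∈ with ac c (y , z , y∈ , z∈ , ne)
    ... | f , w = f , Witness-⊆ ok σ (λ {w} w∈ → Good.tra anti-good Ry (S , S⊆ , ac , mx , y∈ , w∈)) w

  abstract
    op-good : ∀ κ σ {Q} → Good Q → Good (op κ σ Q)
    op-good (ant M) σ G = anti-good (allowed? M) σ G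
    op-good (cmp M) σ {Q} G = record
      { isEq = record
        { refl = here rfl
        ; sym = λ c → move (sy (Conn-∈ʳ c)) (Conn-sym c)
        ; trans = λ c d → Conn-trans c (move (Conn-∈ʳ c) d) }
      ; dec = λ x y → conn? (dec x) x y }
      where
      open Good G
      move : ∀ {x y u v} → Q x y → Conn H (drop M σ) (Q y) u v → Conn H (drop M σ) (Q x) u v
      move r = Conn-bind (tra r) λ e y z j p q → Conn-edge e (tra r p) (tra r q) j

  Conn-class : ∀ {σ Q} → Good Q → ∀ {x y u v} → Q x y → Conn H σ (Q y) u v → Conn H σ (Q x) u v
  Conn-class G r = Conn-bind (tra r) λ e y z j p q → Conn-edge e (tra r p) (tra r q) j
    where open Good G

  fixed⇒connected : ∀ M σ {Q} → Good Q → RefP H Q (op (cmp M) σ Q) → ∀ x → ConnectedOn H (drop M σ) (Q x)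
  fixed⇒connected M σ G h x y z xy xz = Conn-class G xy (h y z (tra (sy xy) xz))
    where open Good G

  fixed⇒anticonnected : ∀ M σ {Q} → Good Q → RefP H Q (op (ant M) σ Q) → ∀ x → AntiConn H (allowed M) σ (Q x)
  fixed⇒anticonnected M σ {Q} G h x =
    AntiConn-resp (op-⊆ (ant M) σ Q x _) (h x _) (anti-class (allowed? M) σ G x)

  bridge-refines : ∀ {σ Q e} → Good Q → Bridge H σ Q e → ¬ RefP H Q (op (cmp (just e)) σ Q)
  bridge-refines {σ} {e = e} G (x , _ , _ , _ , ¬c) h = ¬c (fixed⇒connected (just e) σ G h x)

  antibridge-refines : ∀ {σ Q e} → Good Q → Antibridge H σ Q e → ¬ RefP H Q (op (ant (just e)) σ Q)
  antibridge-refines {σ} {e = e} G (x , _ , _ , _ , ¬c) h = ¬c (fixed⇒anticonnected (just e) σ G h x)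

-- Positions

cmpC : ∀ c c′ → c <C c′ ⊎ c ≡ c′ ⊎ c′ <C c
cmpC (fin i) (fin j) with ℕₚ.<-cmp i j
... | tri< p _ _ = inj₁ p
... | tri≈ _ refl _ = inj₂ (inj₁ refl)
... | tri> _ _ p = inj₂ (inj₂ p)
cmpC (fin i) inf = inj₁ tt
cmpC inf (fin i) = inj₂ (inj₂ tt)
cmpC inf inf = inj₂ (inj₁ refl)

<C-trans : ∀ {a b c} → a <C b → b <C c → a <C c
<C-trans {fin _} {fin _} {fin _} p q = ℕₚ.<-trans p q
<C-trans {fin _} {fin _} {inf} p q = tt

<C-irrefl : ∀ {a} → ¬ a <C a
<C-irrefl {fin _} p = ℕₚ.<-irrefl refl p

cmpT : ∀ τ τ′ → τ <T τ′ ⊎ τ ≡ τ′ ⊎ τ′ <T τ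
cmpT (pos i c) (pos j c′) with ℕₚ.<-cmp i j
... | tri< p _ _ = inj₁ (inj₁ p)
... | tri> _ _ p = inj₂ (inj₂ (inj₁ p))
... | tri≈ _ refl _ with cmpC c c′
... | inj₁ p = inj₁ (inj₂ (refl , p))
... | inj₂ (inj₁ refl) = inj₂ (inj₁ refl)
... | inj₂ (inj₂ p) = inj₂ (inj₂ (inj₂ (refl , p)))
cmpT (pos _ _) top = inj₁ tt
cmpT top (pos _ _) = inj₂ (inj₂ tt)
cmpT top top = inj₂ (inj₁ refl)

<T-trans : ∀ {a b c} → a <T b → b <T c → a <T c
<T-trans {pos _ _} {pos _ _} {pos _ _} (inj₁ p) (inj₁ q) = inj₁ (ℕₚ.<-trans p q)
<T-trans {pos _ _} {pos _ _} {pos _ _} (inj₁ p) (inj₂ (refl , _)) = inj₁ p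
<T-trans {pos _ _} {pos _ _} {pos _ _} (inj₂ (refl , _)) (inj₁ q) = inj₁ q
<T-trans {pos _ _} {pos _ _} {pos _ _} (inj₂ (refl , p)) (inj₂ (refl , q)) = inj₂ (refl , <C-trans p q)
<T-trans {pos _ _} {pos _ _} {top} _ _ = tt

<T-irrefl : ∀ {a} → ¬ a <T a
<T-irrefl {pos _ _} (inj₁ p) = ℕₚ.<-irrefl refl p
<T-irrefl {pos _ _} (inj₂ (_ , p)) = <C-irrefl p

≤T-trans : ∀ {a b c} → a ≤T b → b ≤T c → a ≤T c
≤T-trans (inj₁ refl) q = q
≤T-trans (inj₂ p) (inj₁ refl) = inj₂ p
≤T-trans (inj₂ p) (inj₂ q) = inj₂ (<T-trans p q)

≤T-<T-trans : ∀ {a b c} → a ≤T b → b <T c → a <T c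
≤T-<T-trans (inj₁ refl) q = q
≤T-<T-trans (inj₂ p) q = <T-trans p q

<T-≤T-trans : ∀ {a b c} → a <T b → b ≤T c → a <T c
<T-≤T-trans p (inj₁ refl) = p
<T-≤T-trans p (inj₂ q) = <T-trans p q

≤T-total : ∀ a b → a ≤T b ⊎ b ≤T a
≤T-total a b with cmpT a b
... | inj₁ p = inj₁ (inj₂ p)
... | inj₂ (inj₁ p) = inj₁ (inj₁ p)
... | inj₂ (inj₂ p) = inj₂ (inj₂ p)

_≤T?_ : ∀ a b → Dec (a ≤T b)
a ≤T? b with cmpT a b
... | inj₁ p = yes (inj₂ p)
... | inj₂ (inj₁ p) = yes (inj₁ p)
... | inj₂ (inj₂ p) = no λ q → <T-irrefl (<T-≤T-trans p q)

row≤⇒≤T : ∀ {r c i} → r ≤ i → pos r c ≤T pos i inf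
row≤⇒≤T {r} {c} {i} r≤i with ℕₚ.m≤n⇒m<n∨m≡n r≤i
... | inj₁ p = inj₂ (inj₁ p)
row≤⇒≤T {c = fin _} r≤i | inj₂ refl = inj₂ (inj₂ (refl , tt))
row≤⇒≤T {c = inf} r≤i | inj₂ refl = inj₁ refl

≤T⇒row≤ : ∀ {τ i} → τ ≤T pos i inf → ∃[ r ] ∃[ c ] (τ ≡ pos r c × r ≤ i)
≤T⇒row≤ (inj₁ refl) = _ , _ , refl , ℕₚ.≤-refl
≤T⇒row≤ {pos r c} (inj₂ (inj₁ p)) = r , c , refl , ℕₚ.<⇒≤ p
≤T⇒row≤ {pos r c} (inj₂ (inj₂ (refl , _))) = r , c , refl , ℕₚ.≤-refl

module _ {A : Pos → Set} where
  private
    column : ∀ r → (∀ j → Dec (A (pos r (fin j)))) → ∀ k →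
             (∃[ t ] (¬ A (pos r (fin t)) × (∀ j → j < t → A (pos r (fin j))))) ⊎
             (∀ j → j < k → A (pos r (fin j)))
    column r A? zero = inj₂ λ _ ()
    column r A? (suc k) with column r A? k
    ... | inj₁ p = inj₁ p
    ... | inj₂ h with A? k
    ... | no ¬a = inj₁ (k , ¬a , h)
    ... | yes a = inj₂ λ j j<sk → go (ℕₚ.m≤n⇒m<n∨m≡n (ℕₚ.≤-pred j<sk))
      where
      go : ∀ {j} → j < k ⊎ j ≡ k → A (pos r (fin j))
      go (inj₁ p) = h _ p
      go (inj₂ refl) = a

  FirstFailure : ℕ → Set
  FirstFailure ℓ = ∃[ s ] ∃[ t ] (s ≤ ℓ × ¬ A (pos s (fin t)) × (∀ τ → τ <T pos s (fin t) → A τ))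

  abstract
    -- A row has infinitely many columns, but from column `J` on the property agrees with its value
    -- at `inf`. So `suc J` columns settle the row, and the first failure never falls on a limit
    -- column.
    first-failure : ∀ ℓ → (∀ r j → r ≤ ℓ → Dec (A (pos r (fin j)))) →
      (∀ r → ∃[ J ] (∀ j → J ≤ j → (A (pos r inf) → A (pos r (fin j))) × (A (pos r (fin j)) → A (pos r inf)))) →
      FirstFailure ℓ ⊎ (∀ r c → r ≤ ℓ → A (pos r c))
    first-failure ℓ A? lim = rows ℓ ℕₚ.≤-refl
      where
      below : ℕ → Set
      below k = ∀ r c → r < k → A (pos r c)

      add-row : ∀ k → k ≤ ℓ → below k → FirstFailure ℓ ⊎ below (suc k)
      add-row k k≤ℓ h with lim k
      ... | J , lm with column k (λ j → A? k j k≤ℓ) (suc J)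
      ... | inj₁ (t , ¬a , before) = inj₁ (k , t , k≤ℓ , ¬a , all-before)
        where
        all-before : ∀ τ → τ <T pos k (fin t) → A τ
        all-before (pos r c) (inj₁ r<k) = h r c r<k
        all-before (pos r (fin j)) (inj₂ (refl , j<t)) = before j j<t
      ... | inj₂ all = inj₂ λ r c r<sk → go c (ℕₚ.m≤n⇒m<n∨m≡n (ℕₚ.≤-pred r<sk))
        where
        A∞ : A (pos k inf)
        A∞ = proj₂ (lm J ℕₚ.≤-refl) (all J ℕₚ.≤-refl)
        go : ∀ {r} c → r < k ⊎ r ≡ k → A (pos r c)
        go c (inj₁ p) = h _ c p
        go inf (inj₂ refl) = A∞
        go (fin j) (inj₂ refl) with ℕₚ.≤-total J j
        ... | inj₁ J≤j = proj₁ (lm j J≤j) A∞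
        ... | inj₂ j≤J = all j (s≤s j≤J)

      upto : ∀ k → k ≤ suc ℓ → FirstFailure ℓ ⊎ below k
      upto zero _ = inj₂ λ _ _ ()
      upto (suc k) (s≤s k≤ℓ) with upto k (ℕₚ.m≤n⇒m≤1+n k≤ℓ)
      ... | inj₁ p = inj₁ p
      ... | inj₂ h = add-row k k≤ℓ h

      rows : ∀ k → k ≤ ℓ → FirstFailure ℓ ⊎ (∀ r c → r ≤ k → A (pos r c))
      rows k k≤ℓ with upto (suc k) (s≤s k≤ℓ)
      ... | inj₁ p = inj₁ p
      ... | inj₂ h = inj₂ λ r c r≤k → h r c (s≤s r≤k)

-- Plane sequences as chains of refinement steps

module Sequences (H : Hyp) (O : DOrder (m H)) where
  open Ops H public

  -- Indexed by the column that a step leaves, so even indices give components.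
  colKind : ℕ → Kind
  colKind zero = cmp nothing
  colKind (suc zero) = ant nothing
  colKind (suc (suc j)) = colKind j

  colKind-even : ∀ k → colKind (2 * k) ≡ cmp nothing
  colKind-even zero = refl
  colKind-even (suc k) rewrite ℕₚ.+-suc k (k + 0) = colKind-even k

  colKind-odd : ∀ k → colKind (suc (2 * k)) ≡ ant nothing
  colKind-odd zero = refl
  colKind-odd (suc k) rewrite ℕₚ.+-suc k (k + 0) = colKind-odd k

  parity : ∀ j → (∃[ k ] j ≡ 2 * k) ⊎ (∃[ k ] j ≡ suc (2 * k))
  parity zero = inj₁ (0 , refl)
  parity (suc zero) = inj₂ (0 , refl)
  parity (suc (suc j)) with parity j
  ... | inj₁ (k , refl) = inj₁ (suc k , cong suc (sym (ℕₚ.+-suc k (k + 0))))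
  ... | inj₂ (k , refl) = inj₂ (suc k , cong (λ i → suc (suc i)) (sym (ℕₚ.+-suc k (k + 0))))

  colKind-cases : ∀ j → colKind j ≡ cmp nothing ⊎ colKind j ≡ ant nothing
  colKind-cases j with parity j
  ... | inj₁ (k , refl) = inj₁ (colKind-even k)
  ... | inj₂ (k , refl) = inj₂ (colKind-odd k)

  -- The defining rules up to the start of row N.
  record Rows (σ : Asg H) (P : Pos → Part H) (d : ℕ → D (m H)) (N : ℕ) : Set where
    field
      init   : EqP H (P (pos 0 (fin 0))) (λ _ _ → ⊤)
      col    : ∀ r j → EqP H (P (pos r (fin (suc j)))) (op (colKind j) σ (P (pos r (fin j))))
      limRow : ∀ r → ∃[ J ] (∀ j → J ≤ j → EqP H (P (pos r (fin j))) (P (pos r inf)))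
      steps  : ∀ r → r < N → StepRule H O σ P d r

  rowsOf : ∀ {σ} (S : PlaneSeq H O σ) N → Rows σ (P S) (d S) N
  rowsOf {σ} S N = record
    { init = PlaneSeq.init S ; col = col′ ; limRow = PlaneSeq.limRow S ; steps = λ r _ → PlaneSeq.steps S r }
    where
    col′ : ∀ r j → EqP H (P S (pos r (fin (suc j)))) (op (colKind j) σ (P S (pos r (fin j))))
    col′ r j with parity j
    ... | inj₁ (k , refl) rewrite colKind-even k = PlaneSeq.odd S r k
    ... | inj₂ (k , refl) rewrite colKind-odd k = PlaneSeq.even S r k

  -- Only the steps that apply an operation: a row after STOP or TERMINATE starts with the previous
  -- limit unchanged. The kind as an index lets column steps and row starts be treated alike.
  data Step (σ : Asg H) (P : Pos → Part H) (d : ℕ → D (m H)) : Pos → Kind → Pos → Set where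
    col : ∀ r j → Step σ P d (pos r (fin j)) (colKind j) (pos r (fin (suc j)))
    bridge-step  : ∀ r e → d r ≡ edgeD e → Bridge H σ (P (pos r inf)) e →
          Step σ P d (pos r inf) (cmp (just e)) (pos (suc r) (fin 0))
    antibridge-step  : ∀ r e → d r ≡ edgeD e → Antibridge H σ (P (pos r inf)) e →
          Step σ P d (pos r inf) (ant (just e)) (pos (suc r) (fin 0))

  edgeD-injective : ∀ {k} {e f : Fin k} → edgeD e ≡ edgeD f → e ≡ f
  edgeD-injective refl = refl

  row-start : ∀ σ P d r → StepRule H O σ P d r →
    (Terminal (d r) × EqP H (P (pos (suc r) (fin 0))) (P (pos r inf))) ⊎
    (∃[ e ] d r ≡ edgeD e × ∃[ κ ] (Step σ P d (pos r inf) κ (pos (suc r) (fin 0)) ×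
           EqP H (P (pos (suc r) (fin 0))) (op κ σ (P (pos r inf)))))
  row-start σ P d r (inj₁ (_ , eq , t)) = inj₁ (inj₂ t , eq)
  row-start σ P d r (inj₂ (inj₁ (_ , _ , eq , s))) = inj₁ (inj₁ s , eq)
  row-start σ P d r (inj₂ (inj₂ (e , _ , _ , _ , de , inj₁ (a , eq)))) = inj₂ (e , de , ant (just e) , antibridge-step r e de a , eq)
  row-start σ P d r (inj₂ (inj₂ (e , _ , _ , _ , de , inj₂ (b , eq)))) = inj₂ (e , de , cmp (just e) , bridge-step r e de b , eq)

  module _ {σ : Asg H} {P : Pos → Part H} {d : ℕ → D (m H)} {N : ℕ} (R : Rows σ P d N) where
    private
      module R = Rows R

    start-⊆ : ∀ r → r < N → RefP H (P (pos (suc r) (fin 0))) (P (pos r inf))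
    start-⊆ r r<N with row-start σ P d r (R.steps r r<N)
    ... | inj₁ (_ , eq) = EqP-⊆ eq
    ... | inj₂ (_ , _ , κ , _ , eq) = λ x y → op-⊆ κ σ _ x y ∘ EqP-⊆ eq x y

    private
      good-row : ∀ r → Good (P (pos r (fin 0))) → ∀ c → Good (P (pos r c))
      good-row r G = λ { (fin j) → good-fin j
                       ; inf → let (J , lm) = R.limRow r in Good-resp (lm J ℕₚ.≤-refl) (good-fin J) }
        where
        good-fin : ∀ j → Good (P (pos r (fin j)))
        good-fin zero = G
        good-fin (suc j) = Good-resp (EqP-sym (R.col r j)) (op-good (colKind j) σ (good-fin j))

      good-start : ∀ r → r ≤ N → Good (P (pos r (fin 0)))
      good-start zero _ = Good-resp (EqP-sym R.init) record
        { isEq = record { refl = tt ; sym = λ _ → tt ; trans = λ _ _ → tt } ; dec = λ _ _ → yes tt }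
      good-start (suc r) r< with row-start σ P d r (R.steps r r<)
      ... | inj₁ (_ , eq) = Good-resp (EqP-sym eq) (good-row r (good-start r (ℕₚ.<⇒≤ r<)) inf)
      ... | inj₂ (_ , _ , κ , _ , eq) =
        Good-resp (EqP-sym eq) (op-good κ σ (good-row r (good-start r (ℕₚ.<⇒≤ r<)) inf))

    abstract
      good : ∀ r c → r ≤ N → Good (P (pos r c))
      good r c r≤ = good-row r (good-start r r≤) c

    col-mono : ∀ r j k → RefP H (P (pos r (fin (k + j)))) (P (pos r (fin j)))
    col-mono r j zero x y p = p
    col-mono r j (suc k) x y p = col-mono r j k x y (op-⊆ (colKind (k + j)) σ _ x y (EqP-⊆ (R.col r (k + j)) x y p))

    inf-mono : ∀ r j → RefP H (P (pos r inf)) (P (pos r (fin j)))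
    inf-mono r j x y p = let (J , lm) = R.limRow r in
      col-mono r j J x y (EqP-⊇ (lm (J + j) (ℕₚ.m≤m+n J j)) x y p)

    to-start : ∀ r c → RefP H (P (pos r c)) (P (pos r (fin 0)))
    to-start r inf = inf-mono r 0
    to-start r (fin j) x y p = col-mono r 0 j x y (subst (λ k → P (pos r (fin k)) x y) (sym (ℕₚ.+-identityʳ j)) p)

    row-mono : ∀ {r s} → r < s → s ≤ N → RefP H (P (pos s (fin 0))) (P (pos r inf))
    row-mono {r} {suc s} (s≤s r≤s) s≤ x y p with ℕₚ.m≤n⇒m<n∨m≡n r≤s
    ... | inj₂ refl = start-⊆ s s≤ x y p
    ... | inj₁ r<s = row-mono r<s (ℕₚ.<⇒≤ s≤) x y (to-start s inf x y (start-⊆ s s≤ x y p))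

    mono : ∀ {r c s c′} → s ≤ N → pos r c ≤T pos s c′ → RefP H (P (pos s c′)) (P (pos r c))
    mono s≤ (inj₁ refl) x y p = p
    mono {r} {c} {s} {c′} s≤ (inj₂ (inj₁ r<s)) x y p = from∞ c (row-mono r<s s≤ x y (to-start s c′ x y p))
      where
      from∞ : ∀ c → P (pos r inf) x y → P (pos r c) x y
      from∞ inf q = q
      from∞ (fin j) q = inf-mono r j x y q
    mono {r} {fin j} {c′ = fin j′} s≤ (inj₂ (inj₂ (refl , j<j′))) x y p =
      col-mono r j _ x y (subst (λ k → P (pos r (fin k)) x y) (sym (ℕₚ.m∸n+n≡m (ℕₚ.<⇒≤ j<j′))) p)
    mono {r} {fin j} {c′ = inf} s≤ (inj₂ (inj₂ (refl , _))) x y p = inf-mono r j x y p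

    -- Far enough to the right two consecutive columns both equal the limit, so the operation
    -- between them fixes it; `k` chooses the parity of the column.
    inf-fixed : ∀ r k κ → colKind (k + 2 * proj₁ (R.limRow r)) ≡ κ → EqP H (P (pos r inf)) (op κ σ (P (pos r inf)))
    inf-fixed r k κ refl = let (J , lm) = R.limRow r
                               j = k + 2 * J
                               J≤j = ℕₚ.≤-trans (ℕₚ.m≤m+n J (J + 0)) (ℕₚ.m≤n+m (2 * J) k) in
      EqP-trans (EqP-sym (lm (suc j) (ℕₚ.m≤n⇒m≤1+n J≤j))) (EqP-trans (R.col r j) (op-cong κ σ (lm j J≤j)))

    inf-fixed-cmp : ∀ r → EqP H (P (pos r inf)) (op (cmp nothing) σ (P (pos r inf)))
    inf-fixed-cmp r = inf-fixed r 0 _ (colKind-even (proj₁ (R.limRow r)))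

    inf-fixed-ant : ∀ r → EqP H (P (pos r inf)) (op (ant nothing) σ (P (pos r inf)))
    inf-fixed-ant r = inf-fixed r 1 _ (colKind-odd (proj₁ (R.limRow r)))

    inf-solid : ∀ r → r ≤ N → ∀ x → SolidOn H σ (P (pos r inf) x)
    inf-solid r r≤ x = fixed⇒connected nothing σ G (EqP-⊆ (inf-fixed-cmp r)) x ,
                       fixed⇒anticonnected nothing σ G (EqP-⊆ (inf-fixed-ant r)) x
      where
      G : Good (P (pos r inf))
      G = good r inf r≤

    -- A decision names its hyperedge, and whether this is used tells a bridge from an antibridge;
    -- so the step rule can only have been applied in the way that the `Step` says.
    Step-eq : ∀ {r c κ s t} → s ≤ N → Step σ P d (pos r c) κ (pos s t) → EqP H (P (pos s t)) (op κ σ (P (pos r c)))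
    Step-eq s≤ (col r j) = R.col r j
    Step-eq s≤ (bridge-step r e de b) with R.steps r s≤
    ... | inj₁ (_ , _ , t) with () ← trans (sym de) t
    ... | inj₂ (inj₁ (_ , _ , _ , t)) with () ← trans (sym de) t
    ... | inj₂ (inj₂ (e′ , _ , _ , _ , de′ , inj₂ (_ , eq))) with refl ← edgeD-injective (trans (sym de) de′) = eq
    ... | inj₂ (inj₂ (e′ , _ , _ , _ , de′ , inj₁ ((_ , _ , _ , u , _) , _))) with refl ← edgeD-injective (trans (sym de) de′)
        with b
    ... | _ , _ , _ , (_ , u′ , _) , _ with () ← trans (sym u) u′
    Step-eq s≤ (antibridge-step r e de a) with R.steps r s≤
    ... | inj₁ (_ , _ , t) with () ← trans (sym de) t
    ... | inj₂ (inj₁ (_ , _ , _ , t)) with () ← trans (sym de) t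
    ... | inj₂ (inj₂ (e′ , _ , _ , _ , de′ , inj₁ (_ , eq))) with refl ← edgeD-injective (trans (sym de) de′) = eq
    ... | inj₂ (inj₂ (e′ , _ , _ , _ , de′ , inj₂ ((_ , _ , _ , (_ , u′ , _) , _) , _))) with refl ← edgeD-injective (trans (sym de) de′)
        with a
    ... | _ , _ , _ , u , _ with () ← trans (sym u) u′

    step-into : ∀ s t → s ≤ N → (∀ r → r < s → ¬ Terminal (d r)) →
      pos s (fin t) ≡ pos 0 (fin 0) ⊎ ∃[ r ] ∃[ c ] ∃[ κ ] Step σ P d (pos r c) κ (pos s (fin t))
    step-into s (suc t) _ _ = inj₂ (_ , _ , _ , col s t)
    step-into zero zero _ _ = inj₁ refl
    step-into (suc r) zero s≤ nt with row-start σ P d r (R.steps r s≤)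
    ... | inj₁ (t , _) = ⊥-elim (nt r ℕₚ.≤-refl t)
    ... | inj₂ (_ , _ , κ , st , _) = inj₂ (_ , _ , κ , st)

  Step-< : ∀ {σ P d τ κ τ′} → Step σ P d τ κ τ′ → τ <T τ′
  Step-< (col r j) = inj₂ (refl , ℕₚ.≤-refl)
  Step-< (bridge-step r e _ _) = inj₁ ℕₚ.≤-refl
  Step-< (antibridge-step r e _ _) = inj₁ ℕₚ.≤-refl

  source-row : ∀ {σ P d r c κ s c′ N} → s ≤ N → Step σ P d (pos r c) κ (pos s c′) → r ≤ N
  source-row s≤ (col r j) = s≤
  source-row s≤ (bridge-step r _ _ _) = ℕₚ.<⇒≤ s≤
  source-row s≤ (antibridge-step r _ _ _) = ℕₚ.<⇒≤ s≤

  -- The index `colKind j` blocks matching on a `Step` of known kind; the information is therefore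
  -- computed from the kind.
  StepInfo : (σ : Asg H) (P : Pos → Part H) (d : ℕ → D (m H)) → ℕ → Col → ℕ → Kind → Set
  StepInfo σ P d r c s (cmp nothing) = ⊤
  StepInfo σ P d r c s (ant nothing) = ⊤
  StepInfo σ P d r c s (cmp (just e)) = c ≡ inf × r < s × d r ≡ edgeD e × Bridge H σ (P (pos r c)) e
  StepInfo σ P d r c s (ant (just e)) = c ≡ inf × r < s × d r ≡ edgeD e × Antibridge H σ (P (pos r c)) e

  abstract
    stepInfo : ∀ {σ P d r c κ s c′} → Step σ P d (pos r c) κ (pos s c′) → StepInfo σ P d r c s κ
    stepInfo {σ} {P} {d} (col r j) with colKind j | colKind-cases j
    ... | _ | inj₁ refl = tt
    ... | _ | inj₂ refl = tt
    stepInfo (bridge-step r e de b) = refl , ℕₚ.≤-refl , de , b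
    stepInfo (antibridge-step r e de a) = refl , ℕₚ.≤-refl , de , a

-- Dependence on earlier rows, and decidability of the notions

module Construction (H : Hyp) (O : DOrder (m H)) where
  open Sequences H O public

  UnusedQ-resp : ∀ σ {Q Q′ e} → EqP H Q Q′ → UnusedQ H σ Q e → UnusedQ H σ Q′ e
  UnusedQ-resp σ eq (inj₁ u) = inj₁ u
  UnusedQ-resp σ eq (inj₂ (s , e , ¬c)) =
    inj₂ (s , e , λ { (u , v , u∈ , v∈ , ¬p) → ¬c (u , v , u∈ , v∈ , ¬p ∘ EqP-⊆ eq u v) })

  UnusedQ-⊆ : ∀ σ {Q Q′ e} → RefP H Q Q′ → UnusedQ H σ Q e → UnusedQ H σ Q′ e
  UnusedQ-⊆ σ h (inj₁ u) = inj₁ u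
  UnusedQ-⊆ σ {Q} {Q′} h (inj₂ (s , e , ¬c)) =
    inj₂ (s , e , λ { (u , v , u∈ , v∈ , ¬p) → ¬c (u , v , u∈ , v∈ , λ q → ¬p (h u v q)) })

  Crossing-resp : ∀ {Q Q′ s} → EqP H Q Q′ → Crossing H Q s → Crossing H Q′ s
  Crossing-resp eq (u , v , u∈ , v∈ , ¬p) = u , v , u∈ , v∈ , ¬p ∘ EqP-⊇ eq u v

  module _ {σ ρ : Asg H} {Q Q′ : Part H} (eq : EqP H Q Q′) (un : ∀ e → UnusedQ H σ Q e → UnusedQ H ρ Q′ e) where

    QCycle-map : QCycle H σ Q → QCycle H ρ Q′
    QCycle-map γ = record
      { k = k ; es = es ; esInj = esInj ; vs = vs
      ; vsDist = λ i j → vsDist i j ∘ EqP-⊇ eq _ _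
      ; meets = λ i → let (u , v , u∈ , v∈ , p , q) = meets i in u , v , u∈ , v∈ , EqP-⊆ eq _ _ p , EqP-⊆ eq _ _ q
      ; unused = λ i → un (es i) (unused i) }
      where open QCycle γ

    InL-map : ∀ P P′ d d′ {e} →
              (∀ {a b τ} → ¬ Q a b → ExpIs H O σ P d a b τ → ExpIs H O ρ P′ d′ a b τ) →
              (∀ {a b τ} → ¬ Q a b → ExpIs H O ρ P′ d′ a b τ → ExpIs H O σ P d a b τ) →
              InL H O σ P d Q e → InL H O ρ P′ d′ Q′ e
    InL-map _ _ _ _ to from (γ , i , ei , τ , ex , mn) =
      QCycle-map γ , i , ei , τ , to (apart i) ex , λ j τ′ ex′ → mn j τ′ (from (apart j) ex′)
      where
      open QCycle γ
      apart : ∀ i → ¬ Q (vs i) (vs (cyc i))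
      apart i p = cyc≢ i (sym (vsDist i (cyc i) p))

  Agree : (P P′ : Pos → Part H) → ℕ → Set
  Agree P P′ i = ∀ r c → r ≤ i → EqP H (P (pos r c)) (P′ (pos r c))

  Agree-sym : ∀ P P′ {i} → Agree P P′ i → Agree P′ P i
  Agree-sym _ _ ag r c r≤ = EqP-sym (ag r c r≤)

  -- Vertices separated at the end of row `i` are exposed no later, so the rows up to `i` determine
  -- their exposure step.
  ExpIs-agree : ∀ σ ρ P P′ d d′ {i a b τ} → Agree P P′ i → ¬ P (pos i inf) a b →
                ExpIs H O σ P d a b τ → ExpIs H O ρ P′ d′ a b τ
  ExpIs-agree σ ρ P P′ d d′ {i} {a} {b} {τ} ag ¬q (¬p , mn) = at τ≤ ¬p , mn′
    where
    τ≤ : τ ≤T pos i inf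
    τ≤ = mn _ ¬q
    at : ∀ {τ} → τ ≤T pos i inf → ¬ P τ a b → ¬ P′ τ a b
    at t≤ ¬p p with ≤T⇒row≤ t≤
    ... | r , c , refl , r≤ = ¬p (EqP-⊇ (ag r c r≤) a b p)
    at′ : ∀ {τ} → τ ≤T pos i inf → ¬ P′ τ a b → ¬ P τ a b
    at′ t≤ ¬p p with ≤T⇒row≤ t≤
    ... | r , c , refl , r≤ = ¬p (EqP-⊆ (ag r c r≤) a b p)
    mn′ : ∀ τ′ → ¬ P′ τ′ a b → τ ≤T τ′
    mn′ τ′ ¬p′ with ≤T-total τ τ′
    ... | inj₁ p = p
    ... | inj₂ q = mn τ′ (at′ (≤T-trans q τ≤) ¬p′)

  InL-agree : ∀ {σ ρ} P P′ d d′ {i e} → Agree P P′ i →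
              (∀ e → UnusedQ H σ (P (pos i inf)) e → UnusedQ H ρ (P′ (pos i inf)) e) →
              InL H O σ P d (P (pos i inf)) e → InL H O ρ P′ d′ (P′ (pos i inf)) e
  InL-agree {σ} {ρ} P P′ d d′ {i} ag un = InL-map (ag i inf ℕₚ.≤-refl) un P P′ d d′
    (λ ¬q → ExpIs-agree σ ρ P P′ d d′ ag ¬q)
    (λ ¬q → ExpIs-agree ρ σ P′ P d′ d (Agree-sym P P′ ag) (¬q ∘ EqP-⊇ (ag i inf ℕₚ.≤-refl) _ _))

  Two-resp : ∀ {e} {X X′ : V → Set} → (∀ {x} → X x → X′ x) → (∀ {x} → X′ x → X x) → Two H e X → Two H e X′
  Two-resp f g (u , v , ne , u∈ , v∈ , p , q , h) = u , v , ne , u∈ , v∈ , f p , f q , λ w w∈ → h w w∈ ∘ g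

  ConnectedOn-resp : ∀ {σ} {X X′ : V → Set} → (∀ {x} → X x → X′ x) → (∀ {x} → X′ x → X x) →
                     ConnectedOn H σ X → ConnectedOn H σ X′
  ConnectedOn-resp f g h y z p q = Conn-bind f (λ e _ _ j a b → Conn-edge e (f a) (f b) j) (h y z (g p) (g q))

  module _ {σ : Asg H} {Q Q′ : Part H} (eq : EqP H Q Q′) where
    private
      to : ∀ x {y} → Q x y → Q′ x y
      to x = EqP-⊆ eq x _
      from : ∀ x {y} → Q′ x y → Q x y
      from x = EqP-⊇ eq x _

    Bridge-resp : ∀ {e} → Bridge H σ Q e → Bridge H σ Q′ e
    Bridge-resp (x , (c , a) , two , (s , se , s⊆) , ¬c) =
      x , (ConnectedOn-resp (to x) (from x) c , AntiConn-resp (to x) (from x) a) , Two-resp (to x) (from x) two ,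
      (s , se , λ z → to x ∘ s⊆ z) , ¬c ∘ ConnectedOn-resp (from x) (to x)

    Antibridge-resp : ∀ {e} → Antibridge H σ Q e → Antibridge H σ Q′ e
    Antibridge-resp (x , (c , a) , two , u , ¬c) =
      x , (ConnectedOn-resp (to x) (from x) c , AntiConn-resp (to x) (from x) a) , Two-resp (to x) (from x) two ,
      u , ¬c ∘ AntiConn-resp (from x) (to x)

  WeaklyRedundant-resp : ∀ {σ Q Q′ e} → EqP H Q Q′ → WeaklyRedundant H σ Q e → WeaklyRedundant H σ Q′ e
  WeaklyRedundant-resp eq (inj₁ (c , u , ¬a)) = inj₁ (Crossing-resp eq c , u , ¬a ∘ Antibridge-resp (EqP-sym eq))
  WeaklyRedundant-resp eq (inj₂ (c , u , ¬b)) = inj₂ (Crossing-resp eq c , u , ¬b ∘ Bridge-resp (EqP-sym eq))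

  StepRule-agree : ∀ {σ} P P′ d d′ {i} → Agree P P′ i → EqP H (P (pos (suc i) (fin 0))) (P′ (pos (suc i) (fin 0))) →
                   d i ≡ d′ i → StepRule H O σ P d i → StepRule H O σ P′ d′ i
  StepRule-agree {σ} P P′ d d′ {i} ag eqn de = go
    where
    Q = P (pos i inf)
    Q′ = P′ (pos i inf)
    eq : EqP H Q Q′
    eq = ag i inf ℕₚ.≤-refl
    un : ∀ e → UnusedQ H σ Q e → UnusedQ H σ Q′ e
    un e = UnusedQ-resp σ eq
    un′ : ∀ e → UnusedQ H σ Q′ e → UnusedQ H σ Q e
    un′ e = UnusedQ-resp σ (EqP-sym eq)
    L→ : ∀ {e} → InL H O σ P d Q e → InL H O σ P′ d′ Q′ e
    L→ = InL-agree P P′ d d′ ag un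
    L← : ∀ {e} → InL H O σ P′ d′ Q′ e → InL H O σ P d Q e
    L← = InL-agree P′ P d′ d (Agree-sym P P′ ag) un′
    via : ∀ κ → EqP H (P (pos (suc i) (fin 0))) (op κ σ Q) → EqP H (P′ (pos (suc i) (fin 0))) (op κ σ Q′)
    via κ h = EqP-trans (EqP-sym eqn) (EqP-trans h (op-cong κ σ eq))
    go : StepRule H O σ P d i → StepRule H O σ P′ d′ i
    go (inj₁ (¬γ , h , t)) = inj₁ (¬γ ∘ QCycle-map (EqP-sym eq) un′ , EqP-trans (EqP-sym eqn) (EqP-trans h eq) , trans (sym de) t)
    go (inj₂ (inj₁ (γ , (e , l , w) , h , s))) =
      inj₂ (inj₁ (QCycle-map eq un γ , (e , L→ l , WeaklyRedundant-resp eq w) , EqP-trans (EqP-sym eqn) (EqP-trans h eq) , trans (sym de) s))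
    go (inj₂ (inj₂ (e , l , ¬w , mx , s , h))) =
      inj₂ (inj₂ (e , L→ l , (λ f lf → ¬w f (L← lf) ∘ WeaklyRedundant-resp (EqP-sym eq)) , (λ f → mx f ∘ L←) , trans (sym de) s , new h))
      where
      new : (Antibridge H σ Q e × EqP H (P (pos (suc i) (fin 0))) (op (ant (just e)) σ Q)) ⊎
            (Bridge H σ Q e × EqP H (P (pos (suc i) (fin 0))) (op (cmp (just e)) σ Q)) →
            (Antibridge H σ Q′ e × EqP H (P′ (pos (suc i) (fin 0))) (op (ant (just e)) σ Q′)) ⊎
            (Bridge H σ Q′ e × EqP H (P′ (pos (suc i) (fin 0))) (op (cmp (just e)) σ Q′))
      new (inj₁ (a , h)) = inj₁ (Antibridge-resp eq a , via (ant (just e)) h)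
      new (inj₂ (b , h)) = inj₂ (Bridge-resp eq b , via (cmp (just e)) h)

  -- Decidability

  module _ (σ : Asg H) {Q : Part H} (G : Good Q) where
    open Good G

    crossing? : ∀ s → Dec (Crossing H Q s)
    crossing? s = any? λ u → any? λ v → u ∈? s ×-dec v ∈? s ×-dec ¬? (dec u v)

    unused? : ∀ e → Dec (UnusedQ H σ Q e)
    unused? e with σ e
    ... | nothing = yes (inj₁ refl)
    ... | just s = map′ (λ ¬c → inj₂ (s , refl , ¬c)) (λ { (inj₁ ()) ; (inj₂ (_ , refl , ¬c)) → ¬c }) (¬? (crossing? s))

    abstract
      connectedOn? : ∀ ρ x → Dec (ConnectedOn H ρ (Q x))
      connectedOn? ρ x = all? λ y → all? λ z → dec x y →-dec dec x z →-dec conn? (dec x) y z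

    abstract
      antiConnOn? : ∀ M x → Dec (AntiConn H (allowed M) σ (Q x))
      antiConnOn? M x = antiConn? (allowed? M) (dec x)

    solidOn? : ∀ x → Dec (SolidOn H σ (Q x))
    solidOn? x = connectedOn? σ x ×-dec antiConnOn? nothing x

    two? : ∀ e x → Dec (Two H e (Q x))
    two? e x = any? λ u → any? λ v → ¬? (u ≟ v) ×-dec u ∈? edge H e ×-dec v ∈? edge H e ×-dec dec x u ×-dec dec x v ×-dec
               all? λ w → (w ∈? edge H e) →-dec dec x w →-dec (w ≟ u ⊎-dec w ≟ v)

    abstract
      bridge? : ∀ e → Dec (Bridge H σ Q e)
      bridge? e = any? λ x → solidOn? x ×-dec two? e x ×-dec inside? x ×-dec ¬? (connectedOn? (remove {H} σ e) x)
        where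
        inside? : ∀ x → Dec (∃[ s ] (σ e ≡ just s × (∀ z → z ∈ s → Q x z)))
        inside? x with σ e
        ... | nothing = no λ ()
        ... | just s = map′ (λ h → s , refl , h) (λ { (_ , refl , h) → h }) (all? λ z → (z ∈? s) →-dec dec x z)

    abstract
      antibridge? : ∀ e → Dec (Antibridge H σ Q e)
      antibridge? e = any? λ x → solidOn? x ×-dec two? e x ×-dec (σ e ≟M nothing) ×-dec ¬? (antiConnOn? (just e) x)

    used? : ∀ e → Dec (∃[ s ] σ e ≡ just s)
    used? e with σ e
    ... | nothing = no λ ()
    ... | just s = yes (s , refl)

    abstract
      weaklyRedundant? : ∀ e → Dec (WeaklyRedundant H σ Q e)
      weaklyRedundant? e = (crossing? (edge H e) ×-dec (σ e ≟M nothing) ×-dec ¬? (antibridge? e)) ⊎-dec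
                           (crossing? (edge H e) ×-dec used? e ×-dec ¬? (bridge? e))

    Link : E → V → V → Set
    Link e a b = (∃[ u ] ∃[ v ] (u ∈ edge H e × v ∈ edge H e × Q u a × Q v b)) × UnusedQ H σ Q e

    link? : ∀ e a b → Dec (Link e a b)
    link? e a b = (any? λ u → any? λ v → u ∈? edge H e ×-dec v ∈? edge H e ×-dec dec u a ×-dec dec v b) ×-dec unused? e

    abstract
      qcycle? : Dec (QCycle H σ Q)
      qcycle? = map′
        (λ { (k , es , vs , ei , vi , _ , l) → record
             { k = k ; es = es ; esInj = ei ; vs = vs ; vsDist = vi ; meets = proj₁ ∘ l ; unused = proj₂ ∘ l } })
        (λ γ → QCycle.k γ , QCycle.es γ , QCycle.vs γ , QCycle.esInj γ , QCycle.vsDist γ , zero , λ j → QCycle.meets γ j , QCycle.unused γ j)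
        (cycle? Q dec (λ _ _ _ e a b → Link e a b) (λ _ _ _ e a b _ _ → link? e a b))

    module _ {P : Pos → Part H} {d : ℕ → D (m H)} (exposure : ∀ a b → ¬ Q a b → ∃[ τ ] ExpIs H O σ P d a b τ) where

      private
        Leads : V → V → V → V → Set
        Leads a b a′ b′ = ∃[ τ ] (ExpIs H O σ P d a b τ × (∀ τ′ → ExpIs H O σ P d a′ b′ τ′ → τ ≤T τ′))

        leads? : ∀ a b a′ b′ → ¬ Q a b → ¬ Q a′ b′ → Dec (Leads a b a′ b′)
        leads? a b a′ b′ ¬p ¬q with exposure a b ¬p | exposure a′ b′ ¬q
        ... | τ , ex | τ′ , ex′ = map′
          (λ τ≤τ′ → τ , ex , λ τ″ ex″ → ≤T-trans τ≤τ′ (proj₂ ex′ τ″ (proj₁ ex″)))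
          (λ { (τ₁ , ex₁ , h) → ≤T-trans (proj₂ ex τ₁ (proj₁ ex₁)) (h τ′ ex′) })
          (τ ≤T? τ′)

        Θ : E → E → V → V → E → V → V → Set
        Θ e x y z u v w = Link u v w × x ≡ e × Leads y z v w

      abstract
        inL? : ∀ e → Dec (InL H O σ P d Q e)
        inL? e = map′ (λ { (k , es , vs , ei , vi , i , l) → record
                   { k = k ; es = es ; esInj = ei ; vs = vs ; vsDist = vi ; meets = proj₁ ∘ proj₁ ∘ l ; unused = proj₂ ∘ proj₁ ∘ l } ,
                   i , proj₁ (proj₂ (l i)) , conv k vs vi i λ j → proj₂ (proj₂ (l j)) })
                 (λ { (γ , i , ei , τ , ex , h) → QCycle.k γ , QCycle.es γ , QCycle.vs γ , QCycle.esInj γ , QCycle.vsDist γ , i ,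
                      λ j → (QCycle.meets γ j , QCycle.unused γ j) , ei , τ , ex , h j })
                 (cycle? Q dec (Θ e) λ x y z u v w ¬p ¬q → link? u v w ×-dec x ≟ e ×-dec leads? y z v w ¬p ¬q)
          where
          conv : ∀ k (vs : Fin (suc (suc k)) → V) → (∀ i j → Q (vs i) (vs j) → i ≡ j) → ∀ i →
                 (∀ j → Leads (vs i) (vs (cyc i)) (vs j) (vs (cyc j))) →
                 ∃[ τ ] (ExpIs H O σ P d (vs i) (vs (cyc i)) τ ×
                         (∀ j τ′ → ExpIs H O σ P d (vs j) (vs (cyc j)) τ′ → τ ≤T τ′))
          conv k vs vi i l with exposure (vs i) (vs (cyc i)) (λ p → cyc≢ i (sym (vi i (cyc i) p)))
          ... | τ , ex = τ , ex , λ j τ′ ex′ → let (τ₁ , ex₁ , h) = l j in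
            ≤T-trans (proj₂ ex τ₁ (proj₁ ex₁)) (h τ′ ex′)

      leader : QCycle H σ Q → ∃[ e ] InL H O σ P d Q e
      leader γ = es i , γ , i , refl , proj₁ (ex i) , proj₂ (ex i) ,
                 λ j τ′ ex′ → ≤T-trans (mx j tt) (proj₂ (proj₂ (ex j)) τ′ (proj₁ ex′))
        where
        open QCycle γ
        ex : ∀ i → ∃[ τ ] ExpIs H O σ P d (vs i) (vs (cyc i)) τ
        ex i = exposure (vs i) (vs (cyc i)) λ p → cyc≢ i (sym (vsDist i (cyc i) p))
        best : ∃[ i ] (⊤ × (∀ j → ⊤ → proj₁ (ex i) ≤T proj₁ (ex j)))
        best = maximum (λ j i → proj₁ (ex i) ≤T proj₁ (ex j)) (λ _ → inj₁ refl) (λ p q → ≤T-trans q p)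
                       (λ i j → ≤T-total (proj₁ (ex j)) (proj₁ (ex i))) (λ _ → yes tt) (zero , tt)
        i = proj₁ best
        mx = proj₂ (proj₂ best)

  abstract
    gcycle? : ∀ σ → Dec (GCycle H σ)
    gcycle? σ = map′
      (λ { (k , es , vs , ei , vi , _ , l) → record { k = k ; es = es ; esInj = ei ; vs = vs ; vsInj = vi ; on = l } })
      (λ γ → GCycle.k γ , GCycle.es γ , GCycle.vs γ , GCycle.esInj γ , GCycle.vsInj γ , zero , GCycle.on γ)
      (cycle? _≡_ _≟_ (λ _ _ _ e a b → σ e ≡ just (pair a b)) (λ _ _ _ e a b _ _ → σ e ≟M just (pair a b)))

  QCycle-crosses : ∀ {σ Q} → Good Q → (γ : QCycle H σ Q) → ∀ i → Crossing H Q (edge H (QCycle.es γ i))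
  QCycle-crosses G γ i = let (u , v , u∈ , v∈ , p , q) = meets i in
    u , v , u∈ , v∈ , λ r → cyc≢ i (sym (vsDist i (cyc i) (tra (sy p) (tra r q))))
    where
    open QCycle γ
    open Good G

  abstract
    refines? : ∀ {Q Q′} → Good Q → Good Q′ → RefP H Q Q′ ⊎ ∃[ x ] ∃[ y ] (Q x y × ¬ Q′ x y)
    refines? G G′ with any? (λ x → any? λ y → Good.dec G x y ×-dec ¬? (Good.dec G′ x y))
    ... | yes p = inj₂ p
    ... | no ¬p = inj₁ λ x y q → decidable-stable (Good.dec G′ x y) λ ¬q → ¬p (x , y , q , ¬q)

  ≤E-refl : ∀ e → _≤E_ O e e
  ≤E-refl e = inj₁ refl

  ≤E-trans : ∀ {e f g} → _≤E_ O e f → _≤E_ O f g → _≤E_ O e g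
  ≤E-trans (inj₁ refl) q = q
  ≤E-trans (inj₂ p) (inj₁ refl) = inj₂ p
  ≤E-trans (inj₂ p) (inj₂ q) = inj₂ (IsStrictTotalOrder.trans (isSTO O) p q)

  ≤E-total : ∀ e f → _≤E_ O e f ⊎ _≤E_ O f e
  ≤E-total e f with IsStrictTotalOrder.compare (isSTO O) (edgeD e) (edgeD f)
  ... | tri< p _ _ = inj₁ (inj₂ p)
  ... | tri≈ _ p _ = inj₁ (inj₁ (edgeD-injective p))
  ... | tri> _ _ p = inj₂ (inj₂ p)

  ≤E-antisym : ∀ {e f} → _≤E_ O e f → _≤E_ O f e → e ≡ f
  ≤E-antisym (inj₁ p) _ = p
  ≤E-antisym (inj₂ _) (inj₁ p) = sym p
  ≤E-antisym (inj₂ p) (inj₂ q) = ⊥-elim (IsStrictTotalOrder.asym (isSTO O) p q)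

  abstract
    -- The limit of a row agrees with a finite column, so the first separation happens at a finite
    -- column, the kind of position to which a `Step` leads.
    exposure : ∀ {σ P d N} → Rows σ P d N → ∀ ℓ → ℓ ≤ N → ∀ a b → ¬ P (pos ℓ inf) a b →
               ∃[ s ] ∃[ t ] (s ≤ ℓ × ExpIs H O σ P d a b (pos s (fin t)))
    exposure {σ} {P} {d} R ℓ ℓ≤ a b ¬p with first-failure {A = λ τ → P τ a b} ℓ
      (λ r j r≤ → Good.dec (good R r (fin j) (ℕₚ.≤-trans r≤ ℓ≤)) a b)
      (λ r → let (J , lm) = Rows.limRow R r in J , λ j J≤ → EqP-⊇ (lm j J≤) a b , EqP-⊆ (lm j J≤) a b)
    ... | inj₂ all = ⊥-elim (¬p (all ℓ inf ℕₚ.≤-refl))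
    ... | inj₁ (s , t , s≤ , ¬a , before) = s , t , s≤ , ¬a , mn
      where
      mn : ∀ τ′ → ¬ P τ′ a b → pos s (fin t) ≤T τ′
      mn τ′ ¬q with cmpT (pos s (fin t)) τ′
      ... | inj₁ p = inj₂ p
      ... | inj₂ (inj₁ p) = inj₁ p
      ... | inj₂ (inj₂ p) = ⊥-elim (¬q (before τ′ p))

module Existence (H : Hyp) (O : DOrder (m H)) where
  open Construction H O public

  -- Existence of plane sequences

  module Row (σ : Asg H) {Q : Part H} (G : Good Q) where

    cols : ℕ → Part H
    cols zero = Q
    cols (suc j) = op (colKind j) σ (cols j)

    cols-good : ∀ j → Good (cols j)
    cols-good zero = G
    cols-good (suc j) = op-good (colKind j) σ (cols-good j)

    cols-⊆ : ∀ j → RefP H (cols j) Q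
    cols-⊆ zero x y p = p
    cols-⊆ (suc j) x y p = cols-⊆ j x y (op-⊆ (colKind j) σ _ x y p)

    Stable : ℕ → Set
    Stable J = ∀ j → EqP H (op (colKind j) σ (cols J)) (cols J)

    private
      first-fixed : ∀ J → RefP H (cols J) (cols (suc (suc J))) → EqP H (cols (suc J)) (cols J)
      first-fixed J h x y = op-⊆ (colKind J) σ _ x y , op-⊆ (colKind (suc J)) σ _ x y ∘ h x y

      stable : ∀ J → colKind J ≡ cmp nothing → colKind (suc J) ≡ ant nothing →
               RefP H (cols J) (cols (suc (suc J))) → Stable J
      stable J e o h j with colKind-cases j
      ... | inj₁ eq = subst (λ κ → EqP H (op κ σ (cols J)) (cols J)) (trans e (sym eq)) (first-fixed J h)
      ... | inj₂ eq = subst (λ κ → EqP H (op κ σ (cols J)) (cols J)) (trans o (sym eq))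
        (EqP-trans (op-cong (colKind (suc J)) σ (EqP-sym (first-fixed J h)))
                   (λ x y → op-⊆ (colKind J) σ _ x y ∘ op-⊆ (colKind (suc J)) σ _ x y , h x y))

      -- Two consecutive columns apply both operations. If together they change nothing, neither
      -- does so alone; otherwise the relation has lost a pair.
      search : ∀ J → colKind J ≡ cmp nothing → colKind (suc J) ≡ ant nothing →
               Acc _⊂_ (graph (Good.dec (cols-good J))) → ∃ Stable
      search J e o (acc rs) with refines? (cols-good J) (cols-good (suc (suc J)))
      ... | inj₁ h = J , stable J e o h
      ... | inj₂ (x , y , p , ¬q) = search (suc (suc J)) e o
        (rs (graph-⊂ (Good.dec (cols-good J)) (Good.dec (cols-good (suc (suc J))))
                     (λ x y → op-⊆ (colKind J) σ _ x y ∘ op-⊆ (colKind (suc J)) σ _ x y) p ¬q))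

    abstract
      limit : ∃ Stable
      limit = search 0 refl refl (⊂-wellFounded _)

    line : Col → Part H
    line (fin j) = cols j
    line inf = cols (proj₁ limit)

    line-⊆ : ∀ c → RefP H (line c) Q
    line-⊆ (fin j) = cols-⊆ j
    line-⊆ inf = cols-⊆ (proj₁ limit)

    row-limit : ∀ j → proj₁ limit ≤ j → EqP H (cols j) (line inf)
    row-limit j J≤j = subst (λ j → EqP H (cols j) (line inf)) (ℕₚ.m∸n+n≡m J≤j) (go (j ∸ proj₁ limit))
      where
      go : ∀ k → EqP H (cols (k + proj₁ limit)) (line inf)
      go zero = EqP-refl
      go (suc k) = EqP-trans (op-cong (colKind (k + proj₁ limit)) σ (go k)) (proj₂ limit (k + proj₁ limit))

  -- A sequence that obeys the rules through row `i` and repeats the limit of that row afterwards,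
  -- so that every position is filled. The decisions from `i` on are placeholders.
  record Pre (σ : Asg H) (i : ℕ) : Set₁ where
    field
      𝒫     : Pos → Part H
      δ     : ℕ → D (m H)
      rows  : Rows σ 𝒫 δ i
      const : ∀ r c → i < r → EqP H (𝒫 (pos r c)) (𝒫 (pos i inf))
      ctop  : EqP H (𝒫 top) (𝒫 (pos i inf))

    Q : Part H
    Q = 𝒫 (pos i inf)

    Q-good : Good Q
    Q-good = good rows i inf ℕₚ.≤-refl

  record NextStart (σ : Asg H) {i} (pre : Pre σ i) : Set₁ where
    open Pre pre
    field
      e      : E
      inL    : InL H O σ 𝒫 δ Q e
      strict : ∀ f → InL H O σ 𝒫 δ Q f → ¬ WeaklyRedundant H σ Q f
      largest : ∀ f → InL H O σ 𝒫 δ Q f → _≤E_ O f e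
      kind   : Antibridge H σ Q e ⊎ Bridge H σ Q e

    op-kind : Kind
    op-kind with kind
    ... | inj₁ _ = ant (just e)
    ... | inj₂ _ = cmp (just e)

    start : Part H
    start = op op-kind σ Q

    refined : ∃[ x ] ∃[ y ] (Q x y × ¬ start x y)
    refined with refines? Q-good (op-good op-kind σ Q-good)
    ... | inj₂ p = p
    ... | inj₁ h = ⊥-elim (contra h)
      where
      contra : ¬ RefP H Q start
      contra with kind
      ... | inj₁ a = antibridge-refines Q-good a
      ... | inj₂ b = bridge-refines Q-good b

  module _ {σ : Asg H} {i} (pre : Pre σ i) where
    open Pre pre

    private
      P-at : ∀ r c → i ≤ r → (c ≡ inf ⊎ i < r) → EqP H (𝒫 (pos r c)) Q
      P-at r c i≤r (inj₂ i<r) = const r c i<r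
      P-at r .inf i≤r (inj₁ refl) with ℕₚ.m≤n⇒m<n∨m≡n i≤r
      ... | inj₁ i<r = const r inf i<r
      ... | inj₂ refl = EqP-refl

    -- The partitions stay constant and `x` is repeated for ever: the reason for the terminal
    -- decision at row `i` recurs in every later row, whose limit is the same.
    finish : ∀ x → (∀ δ → δ i ≡ x → StepRule H O σ 𝒫 δ i) → Terminal x → PlaneSeq H O σ
    finish x rule tx = record
      { P = 𝒫 ; d = d′ ; init = R.init ; limRow = R.limRow
      ; odd = λ r k → subst (λ κ → EqP H (𝒫 (pos r (fin (suc (2 * k))))) (op κ σ (𝒫 (pos r (fin (2 * k))))))
                            (colKind-even k) (R.col r (2 * k))
      ; even = λ r k → subst (λ κ → EqP H (𝒫 (pos r (fin (suc (suc (2 * k)))))) (op κ σ (𝒫 (pos r (fin (suc (2 * k)))))))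
                             (colKind-odd k) (R.col r (suc (2 * k)))
      ; steps = steps′
      ; limAll = i , λ r i≤r → EqP-trans (P-at r inf i≤r (inj₁ refl)) (EqP-sym ctop) }
      where
      module R = Rows rows
      d′ : ℕ → D (m H)
      d′ j with j ℕₚ.<? i
      ... | yes _ = δ j
      ... | no _ = x
      d′< : ∀ j → j < i → δ j ≡ d′ j
      d′< j j<i with j ℕₚ.<? i
      ... | yes _ = refl
      ... | no ¬p = ⊥-elim (¬p j<i)
      d′≥ : ∀ j → i ≤ j → d′ j ≡ x
      d′≥ j i≤j with j ℕₚ.<? i
      ... | yes p = ⊥-elim (ℕₚ.<⇒≱ p i≤j)
      ... | no _ = refl
      steps′ : ∀ j → StepRule H O σ 𝒫 d′ j
      steps′ j with ℕₚ.<-≤-connex j i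
      ... | inj₁ j<i = StepRule-agree 𝒫 𝒫 δ d′ (λ _ _ _ → EqP-refl) EqP-refl (d′< j j<i) (R.steps j j<i)
      ... | inj₂ i≤j = later (rule d′ (d′≥ i ℕₚ.≤-refl))
        where
        eq : EqP H Q (𝒫 (pos j inf))
        eq = EqP-sym (P-at j inf i≤j (inj₁ refl))
        eqn : EqP H (𝒫 (pos (suc j) (fin 0))) (𝒫 (pos j inf))
        eqn = EqP-trans (const (suc j) (fin 0) (s≤s i≤j)) eq
        un : ∀ e → UnusedQ H σ Q e → UnusedQ H σ (𝒫 (pos j inf)) e
        un e = UnusedQ-resp σ eq
        later : StepRule H O σ 𝒫 d′ i → StepRule H O σ 𝒫 d′ j
        later (inj₁ (¬γ , _ , t)) = inj₁ (¬γ ∘ QCycle-map (EqP-sym eq) (λ e → UnusedQ-resp σ (EqP-sym eq)) , eqn ,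
                                          trans (d′≥ j i≤j) (trans (sym (d′≥ i ℕₚ.≤-refl)) t))
        later (inj₂ (inj₁ (γ , (e , l , w) , _ , t))) =
          inj₂ (inj₁ (QCycle-map eq un γ , (e , InL-map eq un 𝒫 𝒫 d′ d′ (λ _ p → p) (λ _ p → p) l , WeaklyRedundant-resp eq w) , eqn ,
                      trans (d′≥ j i≤j) (trans (sym (d′≥ i ℕₚ.≤-refl)) t)))
        later (inj₂ (inj₂ (e , _ , _ , _ , t , _))) with d′ i | d′≥ i ℕₚ.≤-refl | t
        ... | _ | refl | refl = ⊥-elim ([ (λ ()) , (λ ()) ]′ tx)

    module _ (next : NextStart σ pre) where
      open NextStart next
      open Row σ (op-good op-kind σ Q-good)

      private
        P′ : Pos → Part H
        P′ top = line inf
        P′ (pos r c) with ℕₚ.<-cmp r (suc i)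
        ... | tri< _ _ _ = 𝒫 (pos r c)
        ... | tri≈ _ _ _ = line c
        ... | tri> _ _ _ = line inf

        P′-old : ∀ r c → r ≤ i → P′ (pos r c) ≡ 𝒫 (pos r c)
        P′-old r c r≤ with ℕₚ.<-cmp r (suc i)
        ... | tri< _ _ _ = refl
        ... | tri≈ ¬p _ _ = ⊥-elim (¬p (s≤s r≤))
        ... | tri> ¬p _ _ = ⊥-elim (¬p (s≤s r≤))

        P′-row : ∀ c → P′ (pos (suc i) c) ≡ line c
        P′-row c with ℕₚ.<-cmp (suc i) (suc i)
        ... | tri< _ ¬p _ = ⊥-elim (¬p refl)
        ... | tri≈ _ _ _ = refl
        ... | tri> _ ¬p _ = ⊥-elim (¬p refl)

        P′-new : ∀ r c → suc i < r → P′ (pos r c) ≡ line inf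
        P′-new r c i<r with ℕₚ.<-cmp r (suc i)
        ... | tri< _ _ ¬p = ⊥-elim (¬p i<r)
        ... | tri≈ _ _ ¬p = ⊥-elim (¬p i<r)
        ... | tri> _ _ _ = refl

        d′ : ℕ → D (m H)
        d′ j with j ℕₚ.<? i
        ... | yes _ = δ j
        ... | no _ = edgeD e

        d′< : ∀ j → j < i → δ j ≡ d′ j
        d′< j j<i with j ℕₚ.<? i
        ... | yes _ = refl
        ... | no ¬p = ⊥-elim (¬p j<i)

        d′i : d′ i ≡ edgeD e
        d′i with i ℕₚ.<? i
        ... | yes p = ⊥-elim (ℕₚ.<-irrefl refl p)
        ... | no _ = refl

        module R = Rows rows

        EqP-reflexive : ∀ {A B : Part H} → A ≡ B → EqP H A B
        EqP-reflexive refl = EqP-refl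

        agree : Agree 𝒫 P′ i
        agree r c r≤ = EqP-reflexive (sym (P′-old r c r≤))

        col′ : ∀ r j → EqP H (P′ (pos r (fin (suc j)))) (op (colKind j) σ (P′ (pos r (fin j))))
        col′ r j with ℕₚ.<-cmp r (suc i)
        ... | tri< _ _ _ = R.col r j
        ... | tri≈ _ _ _ = EqP-refl
        ... | tri> _ _ _ = EqP-sym (proj₂ limit j)

        limRow′ : ∀ r → ∃[ J ] (∀ j → J ≤ j → EqP H (P′ (pos r (fin j))) (P′ (pos r inf)))
        limRow′ r with ℕₚ.<-cmp r (suc i)
        ... | tri< _ _ _ = R.limRow r
        ... | tri≈ _ _ _ = proj₁ limit , row-limit
        ... | tri> _ _ _ = 0 , λ _ _ → EqP-refl

        new-step : StepRule H O σ P′ d′ i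
        new-step = inj₂ (inj₂ (e , L→ inL , (λ f lf → strict f (L← lf) ∘ WeaklyRedundant-resp (EqP-sym eq)) ,
                               (λ f → largest f ∘ L←) , d′i , start-eq))
          where
          eq : EqP H Q (P′ (pos i inf))
          eq = agree i inf ℕₚ.≤-refl
          L→ : ∀ {e} → InL H O σ 𝒫 δ Q e → InL H O σ P′ d′ (P′ (pos i inf)) e
          L→ = InL-agree 𝒫 P′ δ d′ agree (λ e → UnusedQ-resp σ eq)
          L← : ∀ {e} → InL H O σ P′ d′ (P′ (pos i inf)) e → InL H O σ 𝒫 δ Q e
          L← = InL-agree P′ 𝒫 d′ δ (Agree-sym 𝒫 P′ agree) (λ e → UnusedQ-resp σ (EqP-sym eq))
          start≡ : EqP H (P′ (pos (suc i) (fin 0))) (op op-kind σ (P′ (pos i inf)))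
          start≡ = EqP-trans (EqP-reflexive (P′-row (fin 0))) (op-cong op-kind σ eq)
          start-eq : (Antibridge H σ (P′ (pos i inf)) e ×
                      EqP H (P′ (pos (suc i) (fin 0))) (op (ant (just e)) σ (P′ (pos i inf)))) ⊎
                     (Bridge H σ (P′ (pos i inf)) e ×
                      EqP H (P′ (pos (suc i) (fin 0))) (op (cmp (just e)) σ (P′ (pos i inf))))
          start-eq with kind | start≡
          ... | inj₁ a | h = inj₁ (Antibridge-resp eq a , h)
          ... | inj₂ b | h = inj₂ (Bridge-resp eq b , h)

        steps′ : ∀ r → r < suc i → StepRule H O σ P′ d′ r
        steps′ r (s≤s r≤i) with ℕₚ.m≤n⇒m<n∨m≡n r≤i
        ... | inj₂ refl = new-step
        ... | inj₁ r<i = StepRule-agree 𝒫 P′ δ d′ (λ s c s≤ → agree s c (ℕₚ.≤-trans s≤ r≤i)) (agree (suc r) (fin 0) r<i)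
                                        (d′< r r<i) (R.steps r r<i)

      extend-pre : Pre σ (suc i)
      extend-pre = record
        { 𝒫 = P′ ; δ = d′
        ; rows = record { init = EqP-trans (EqP-reflexive (P′-old 0 (fin 0) z≤n)) R.init
                        ; col = col′ ; limRow = limRow′ ; steps = steps′ }
        ; const = λ r c i<r → EqP-reflexive (trans (P′-new r c i<r) (sym (P′-row inf)))
        ; ctop = EqP-reflexive (sym (P′-row inf)) }

      extend-⊂ : graph (Good.dec (Pre.Q-good extend-pre)) ⊂ graph (Good.dec Q-good)
      extend-⊂ = let (x , y , q , ¬s) = refined
                     row⇒ : ∀ x y → P′ (pos (suc i) inf) x y → start x y
                     row⇒ x y p = line-⊆ inf x y (subst (λ R → R x y) (P′-row inf) p) in
        graph-⊂ (Good.dec Q-good) (Good.dec (Pre.Q-good extend-pre))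
                (λ x y → op-⊆ op-kind σ Q x y ∘ row⇒ x y) q (¬s ∘ row⇒ x y)

  decide : ∀ {σ i} (pre : Pre σ i) → PlaneSeq H O σ ⊎ NextStart σ pre
  decide {σ} {i} pre = by-cycle (qcycle? σ Q-good)
    where
    open Pre pre
    ex : ∀ a b → ¬ Q a b → ∃[ τ ] ExpIs H O σ 𝒫 δ a b τ
    ex a b ¬p = let (s , t , _ , e) = exposure rows i ℕₚ.≤-refl a b ¬p in pos s (fin t) , e
    start≡ : EqP H (𝒫 (pos (suc i) (fin 0))) Q
    start≡ = const (suc i) (fin 0) ℕₚ.≤-refl
    L? : ∀ e → Dec (InL H O σ 𝒫 δ Q e)
    L? = inL? σ Q-good {d = δ} ex
    kind : ∀ e → InL H O σ 𝒫 δ Q e → ¬ WeaklyRedundant H σ Q e → Antibridge H σ Q e ⊎ Bridge H σ Q e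
    kind e (γ , j , refl , _) ¬w = by-value (σ e) refl
      where
      crosses : Crossing H Q (edge H e)
      crosses = QCycle-crosses Q-good γ j
      by-value : ∀ w → σ e ≡ w → Antibridge H σ Q e ⊎ Bridge H σ Q e
      by-value nothing eq = inj₁ (decidable-stable (antibridge? σ Q-good e) λ ¬a → ¬w (inj₁ (crosses , eq , ¬a)))
      by-value (just s) eq = inj₂ (decidable-stable (bridge? σ Q-good e) λ ¬b → ¬w (inj₂ (crosses , (s , eq) , ¬b)))
    Stops : Set
    Stops = ∃[ e ] (InL H O σ 𝒫 δ Q e × WeaklyRedundant H σ Q e)
    by-stop : QCycle H σ Q → Dec Stops → PlaneSeq H O σ ⊎ NextStart σ pre
    by-stop γ (yes (e , l , w)) = inj₁ (finish pre STOP (λ d′ t → inj₂ (inj₁ (γ , (e , l , w) , start≡ , t))) (inj₁ refl))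
    by-stop γ (no ¬w) = let (e , l , mx) = maximum (_≤E_ O) ≤E-refl ≤E-trans ≤E-total L? (leader σ Q-good {d = δ} ex γ) in
      inj₂ record { e = e ; inL = l ; strict = λ f lf w → ¬w (f , lf , w) ; largest = mx
                  ; kind = kind e l λ w → ¬w (e , l , w) }
    by-cycle : Dec (QCycle H σ Q) → PlaneSeq H O σ ⊎ NextStart σ pre
    by-cycle (no ¬γ) = inj₁ (finish pre TERMINATE (λ d′ t → inj₁ (¬γ , start≡ , t)) (inj₂ refl))
    by-cycle (yes γ) = by-stop γ (any? λ e → L? e ×-dec weaklyRedundant? σ Q-good e)

  abstract
    -- A new row starts by dropping a bridge or an antibridge, which separates some pair; so a
    -- terminal decision comes after finitely many rows.
    planeSeq : ∀ σ → PlaneSeq H O σ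
    planeSeq σ = go first (⊂-wellFounded _)
      where
      G : Good (λ _ _ → ⊤)
      G = record { isEq = record { refl = tt ; sym = λ _ → tt ; trans = λ _ _ → tt } ; dec = λ _ _ → yes tt }
      open Row σ G
      P₀ : Pos → Part H
      P₀ (pos zero c) = line c
      P₀ (pos (suc _) c) = line inf
      P₀ top = line inf
      first : Pre σ 0
      first = record
        { 𝒫 = P₀ ; δ = λ _ → STOP
        ; rows = record
          { init = EqP-refl
          ; col = λ { zero j → EqP-refl ; (suc r) j → EqP-sym (proj₂ limit j) }
          ; limRow = λ { zero → proj₁ limit , row-limit ; (suc r) → 0 , λ _ _ → EqP-refl }
          ; steps = λ _ () }
        ; const = λ { (suc r) c _ → EqP-refl } ; ctop = EqP-refl }
      go : ∀ {i} (pre : Pre σ i) → Acc _⊂_ (graph (Good.dec (Pre.Q-good pre))) → PlaneSeq H O σ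
      go pre (acc rs) = [ id , (λ next → go (extend-pre pre next) (rs (extend-⊂ pre next))) ]′ (decide pre)

-- Lexicographic comparison of signatures

cmpS : ∀ p q → p <S q ⊎ p ≡ q ⊎ q <S p
cmpS (sP i c) (sP j c′) with ℕₚ.<-cmp i j
... | tri< p _ _ = inj₁ (inj₁ p)
... | tri> _ _ p = inj₂ (inj₂ (inj₁ p))
... | tri≈ _ refl _ with cmpC c c′
... | inj₁ p = inj₁ (inj₂ (refl , p))
... | inj₂ (inj₁ refl) = inj₂ (inj₁ refl)
... | inj₂ (inj₂ p) = inj₂ (inj₂ (inj₂ (refl , p)))
cmpS (sP i c) (sD j) with ℕₚ.≤-<-connex i j
... | inj₁ p = inj₁ p
... | inj₂ p = inj₂ (inj₂ p)
cmpS (sD i) (sP j c) with ℕₚ.≤-<-connex j i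
... | inj₁ p = inj₂ (inj₂ p)
... | inj₂ p = inj₁ p
cmpS (sD i) (sD j) with ℕₚ.<-cmp i j
... | tri< p _ _ = inj₁ p
... | tri≈ _ refl _ = inj₂ (inj₁ refl)
... | tri> _ _ p = inj₂ (inj₂ p)

module Comparison (H : Hyp) (O : DOrder (m H)) where
  open Existence H O public

  module _ {π ρ : Asg H} (S : PlaneSeq H O π) (T : PlaneSeq H O ρ) where

    AllBefore : SPos → Set
    AllBefore p = ∀ q → q <S p → EntryEq S T q

    EntryLt-irrefl : ∀ p → EntryLt S T p → ¬ EntryEq S T p
    EntryLt-irrefl (sP i c) (_ , ¬eq) eq = ¬eq eq
    EntryLt-irrefl (sD i) lt eq = IsStrictTotalOrder.irrefl (isSTO O) eq lt

    EntryEq-sym : ∀ p → EntryEq S T p → EntryEq T S p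
    EntryEq-sym (sP i c) eq = EqP-sym eq
    EntryEq-sym (sD i) eq = sym eq

    EntryLt-asym : ∀ p → EntryLt S T p → ¬ EntryLt T S p
    EntryLt-asym (sP i c) (⊆ , ¬eq) (⊇ , _) = ¬eq λ x y → ⊆ x y , ⊇ x y
    EntryLt-asym (sD i) lt gt = IsStrictTotalOrder.asym (isSTO O) lt gt

  -- A reverse comparison decided at `q` is impossible: the earlier of `p` and `q` would carry
  -- entries both equal and strictly ordered, and if they coincide the two strict inequalities
  -- clash.
  sig-greater : ∀ {π ρ : Asg H} (S : PlaneSeq H O π) (T : PlaneSeq H O ρ) p → InRange {π = π} {ρ = ρ} S p → InRange {π = π} {ρ = ρ} T p →
                AllBefore S T p → EntryLt S T p → SigGt T S
  sig-greater S T p rS rT before lt = inj₂ (p , rS , rT , before , lt) , not-less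
    where
    not-less : ¬ SigLe T S
    not-less (inj₁ (eqs , _)) = EntryLt-irrefl S T p lt (EntryEq-sym T S p (proj₂ (eqs p rT)))
    not-less (inj₂ (q , _ , _ , before′ , lt′)) with cmpS p q
    ... | inj₁ p<q = EntryLt-irrefl S T p lt (EntryEq-sym T S p (before′ p p<q))
    ... | inj₂ (inj₁ refl) = EntryLt-asym S T p lt lt′
    ... | inj₂ (inj₂ q<p) = EntryLt-irrefl T S q lt′ (EntryEq-sym S T q (before q q<p))

  not-terminal-edge : ∀ σ P d r → StepRule H O σ P d r → ¬ Terminal (d r) →
    ∃[ e ] (InL H O σ P d (P (pos r inf)) e × (∀ f → InL H O σ P d (P (pos r inf)) f → ¬ WeaklyRedundant H σ (P (pos r inf)) f) ×
            (∀ f → InL H O σ P d (P (pos r inf)) f → _≤E_ O f e) × d r ≡ edgeD e)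
  not-terminal-edge σ P d r (inj₁ (_ , _ , t)) nt = ⊥-elim (nt (inj₂ t))
  not-terminal-edge σ P d r (inj₂ (inj₁ (_ , _ , _ , t))) nt = ⊥-elim (nt (inj₁ t))
  not-terminal-edge σ P d r (inj₂ (inj₂ (e , l , ¬w , mx , de , _))) nt = e , l , ¬w , mx , de

  -- T is compared with S at the positions before τ* in the rows up to ℓ; the two
  -- quasigraphs differ at F only.
  module Domination {π ρ : Asg H} (S : PlaneSeq H O π) (T : PlaneSeq H O ρ) (ℓ : ℕ)
    (running : ∀ r → r < ℓ → ¬ Terminal (d S r)) (F : E) (off : ∀ e → e ≢ F → ρ e ≡ π e) (τ* : Pos)
    (coarser : ∀ {r c κ s t} → s ≤ ℓ → Step π (P S) (d S) (pos r c) κ (pos s (fin t)) → pos s (fin t) <T τ* →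
               RefP H (op κ π (P S (pos r c))) (op κ ρ (P S (pos r c))))
    (unused : ∀ r → r ≤ ℓ → pos r inf <T τ* → UnusedQ H π (P S (pos r inf)) F × UnusedQ H ρ (P S (pos r inf)) F)
    (avoid : ∀ r → r < ℓ → pos r inf <T τ* → d S r ≢ edgeD F)
    where

    private
      RS : ∀ N → Rows π (P S) (d S) N
      RS = rowsOf S
      RT : ∀ N → Rows ρ (P T) (d T) N
      RT = rowsOf T

    inRange-S : ∀ p → row p ≤ ℓ → InRange {π = π} {ρ = ρ} S p
    inRange-S p p≤ r r< = running r (ℕₚ.<-≤-trans r< p≤)

    row-< : ∀ p {r} → r < row p → sD r <S p
    row-< (sP i c) r< = r<
    row-< (sD i) r< = r<

    inRange-T : ∀ p → row p ≤ ℓ → AllBefore S T p → InRange {π = π} {ρ = ρ} T p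
    inRange-T p p≤ b r r< = subst (¬_ ∘ Terminal) (b (sD r) (row-< p r<)) (running r (ℕₚ.<-≤-trans r< p≤))

    win : ∀ p → row p ≤ ℓ → AllBefore S T p → EntryLt S T p → SigGt T S
    win p p≤ b lt = sig-greater S T p (inRange-S p p≤) (inRange-T p p≤ b) b lt

    agree-before : ∀ {r} → AllBefore S T (sD r) → Agree (P S) (P T) r
    agree-before b s c s≤ = b (sP s c) s≤

    unused→ : ∀ {r} → r ≤ ℓ → pos r inf <T τ* → EqP H (P S (pos r inf)) (P T (pos r inf)) → ∀ e →
              UnusedQ H π (P S (pos r inf)) e → UnusedQ H ρ (P T (pos r inf)) e
    unused→ {r} r≤ r<τ eq e u with e ≟ F
    ... | yes refl = UnusedQ-resp ρ eq (proj₂ (unused r r≤ r<τ))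
    ... | no ne = UnusedQ-resp ρ eq (transfer u)
      where
      transfer : UnusedQ H π (P S (pos r inf)) e → UnusedQ H ρ (P S (pos r inf)) e
      transfer (inj₁ p) = inj₁ (trans (off e ne) p)
      transfer (inj₂ (s , p , ¬c)) = inj₂ (s , trans (off e ne) p , ¬c)

    unused← : ∀ {r} → r ≤ ℓ → pos r inf <T τ* → EqP H (P S (pos r inf)) (P T (pos r inf)) → ∀ e →
              UnusedQ H ρ (P T (pos r inf)) e → UnusedQ H π (P S (pos r inf)) e
    unused← {r} r≤ r<τ eq e u with e ≟ F
    ... | yes refl = proj₁ (unused r r≤ r<τ)
    ... | no ne = transfer (UnusedQ-resp ρ (EqP-sym eq) u)
      where
      transfer : UnusedQ H ρ (P S (pos r inf)) e → UnusedQ H π (P S (pos r inf)) e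
      transfer (inj₁ p) = inj₁ (trans (sym (off e ne)) p)
      transfer (inj₂ (s , p , ¬c)) = inj₂ (s , trans (sym (off e ne)) p , ¬c)

    qcycle← : ∀ {r} → r ≤ ℓ → pos r inf <T τ* → AllBefore S T (sD r) → QCycle H ρ (P T (pos r inf)) → QCycle H π (P S (pos r inf))
    qcycle← {r} r≤ r<τ b = QCycle-map (EqP-sym eq) (unused← r≤ r<τ eq)
      where eq = agree-before b r inf ℕₚ.≤-refl

    decision : ∀ r → r < ℓ → pos r inf <T τ* → AllBefore S T (sD r) → SigGt T S ⊎ d S r ≡ d T r
    decision r r<ℓ r<τ b with not-terminal-edge π (P S) (d S) r (PlaneSeq.steps S r) (running r r<ℓ)
    ... | e , l@(γ , _) , ¬w , mx , de = by-rule (PlaneSeq.steps T r)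
      where
      r≤ = ℕₚ.<⇒≤ r<ℓ
      ag : Agree (P S) (P T) r
      ag = agree-before b
      eq = ag r inf ℕₚ.≤-refl
      L→ : ∀ {f} → InL H O π (P S) (d S) (P S (pos r inf)) f → InL H O ρ (P T) (d T) (P T (pos r inf)) f
      L→ = InL-agree (P S) (P T) (d S) (d T) ag (unused→ r≤ r<τ eq)
      L← : ∀ {f} → InL H O ρ (P T) (d T) (P T (pos r inf)) f → InL H O π (P S) (d S) (P S (pos r inf)) f
      L← = InL-agree (P T) (P S) (d T) (d S) (Agree-sym (P S) (P T) ag) (unused← r≤ r<τ eq)
      by-rule : StepRule H O ρ (P T) (d T) r → SigGt T S ⊎ d S r ≡ d T r
      by-rule (inj₁ (¬γ , _)) = ⊥-elim (¬γ (QCycle-map eq (unused→ r≤ r<τ eq) γ))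
      by-rule (inj₂ (inj₁ (_ , _ , _ , t))) =
        inj₁ (win (sD r) r≤ b (subst₂ (_<D_ O) (sym de) (sym t) (stopTop O e)))
      by-rule (inj₂ (inj₂ (e′ , l′ , _ , mx′ , de′ , _))) =
        inj₂ (trans de (trans (cong edgeD (≤E-antisym (mx′ e (L→ l)) (mx e′ (L← l′)))) (sym de′)))

    -- At a row start the decisions agree and the hyperedge is not `F`. So it has the same value in
    -- both quasigraphs, and cannot be a bridge in one and an antibridge in the other.
    step-T : ∀ {r c κ s t} → s ≤ ℓ → pos r c <T τ* → Step π (P S) (d S) (pos r c) κ (pos s (fin t)) → AllBefore S T (sP s (fin t)) →
             EqP H (P T (pos s (fin t))) (op κ ρ (P S (pos r c)))
    step-T s≤ τ< (col r j) b = EqP-trans (Rows.col (RT 0) r j)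
      (op-cong (colKind j) ρ (EqP-sym (b (sP r (fin j)) (inj₂ (refl , ℕₚ.≤-refl)))))
    step-T s≤ τ< (bridge-step r e de (_ , _ , _ , (s , πe , _) , _)) b with row-start ρ (P T) (d T) r (PlaneSeq.steps T r)
    ... | inj₁ (t , _) = ⊥-elim (running r s≤ (subst Terminal (sym (b (sD r) ℕₚ.≤-refl)) t))
    ... | inj₂ (e′ , de′ , _ , bridge-step _ e″ de″ _ , h)
        with refl ← edgeD-injective (trans (sym de) (trans (b (sD r) ℕₚ.≤-refl) de″)) =
        EqP-trans h (op-cong (cmp (just e″)) ρ (EqP-sym (b (sP r inf) (inj₁ ℕₚ.≤-refl))))
    ... | inj₂ (e′ , de′ , _ , antibridge-step _ e″ de″ (_ , _ , _ , ρe , _) , h)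
        with refl ← edgeD-injective (trans (sym de) (trans (b (sD r) ℕₚ.≤-refl) de″))
        with () ← trans (sym πe) (trans (sym (off e″ λ { refl → avoid r s≤ τ< de })) ρe)
    step-T s≤ τ< (antibridge-step r e de (_ , _ , _ , πe , _)) b with row-start ρ (P T) (d T) r (PlaneSeq.steps T r)
    ... | inj₁ (t , _) = ⊥-elim (running r s≤ (subst Terminal (sym (b (sD r) ℕₚ.≤-refl)) t))
    ... | inj₂ (e′ , de′ , _ , antibridge-step _ e″ de″ _ , h)
        with refl ← edgeD-injective (trans (sym de) (trans (b (sD r) ℕₚ.≤-refl) de″)) =
        EqP-trans h (op-cong (ant (just e″)) ρ (EqP-sym (b (sP r inf) (inj₁ ℕₚ.≤-refl))))
    ... | inj₂ (e′ , de′ , _ , bridge-step _ e″ de″ (_ , _ , _ , (s , ρe , _) , _) , h)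
        with refl ← edgeD-injective (trans (sym de) (trans (b (sD r) ℕₚ.≤-refl) de″))
        with () ← trans (sym πe) (trans (sym (off e″ λ { refl → avoid r s≤ τ< de })) ρe)

    entry : ∀ s t → s ≤ ℓ → pos s (fin t) <T τ* → AllBefore S T (sP s (fin t)) →
            RefP H (P S (pos s (fin t))) (P T (pos s (fin t)))
    entry s t s≤ τ< b with step-into (RS ℓ) s t s≤ (λ r r<s → running r (ℕₚ.<-≤-trans r<s s≤))
    ... | inj₁ refl = λ x y _ → EqP-⊇ (PlaneSeq.init T) x y tt
    ... | inj₂ (r , c , κ , st) = λ x y p →
      EqP-⊇ (step-T s≤ (<T-trans (Step-< st) τ<) st b) x y (coarser s≤ st τ< x y (EqP-⊆ (Step-eq (RS ℓ) s≤ st) x y p))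

    compare-entry : ∀ s t → s ≤ ℓ → pos s (fin t) <T τ* → AllBefore S T (sP s (fin t)) →
                    SigGt T S ⊎ EqP H (P S (pos s (fin t))) (P T (pos s (fin t)))
    compare-entry s t s≤ τ< b with refines? (good (RT s) s (fin t) ℕₚ.≤-refl) (good (RS s) s (fin t) ℕₚ.≤-refl)
    ... | inj₁ ⊇ = inj₂ λ x y → entry s t s≤ τ< b x y , ⊇ x y
    ... | inj₂ (x , y , p , ¬q) = inj₁ (win (sP s (fin t)) s≤ b (entry s t s≤ τ< b , λ eq → ¬q (EqP-⊇ eq x y p)))

    along-row : ∀ s t → s ≤ ℓ → pos s (fin t) ≤T τ* → AllBefore S T (sP s (fin 0)) → SigGt T S ⊎ AllBefore S T (sP s (fin t))
    along-row s zero s≤ τ≤ b = inj₂ b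
    along-row s (suc t) s≤ τ≤ b with along-row s t s≤ (≤T-trans (inj₂ (inj₂ (refl , ℕₚ.≤-refl))) τ≤) b
    ... | inj₁ w = inj₁ w
    ... | inj₂ b′ with compare-entry s t s≤ (<T-≤T-trans (inj₂ (refl , ℕₚ.≤-refl)) τ≤) b′
    ... | inj₁ w = inj₁ w
    ... | inj₂ eq = inj₂ add
      where
      add : AllBefore S T (sP s (fin (suc t)))
      add (sP r c) (inj₁ r<s) = b′ (sP r c) (inj₁ r<s)
      add (sP r (fin j)) (inj₂ (refl , s≤s j≤t)) with ℕₚ.m≤n⇒m<n∨m≡n j≤t
      ... | inj₁ j<t = b′ (sP r (fin j)) (inj₂ (refl , j<t))
      ... | inj₂ refl = eq
      add (sD r) r<s = b′ (sD r) r<s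

    -- Beyond column `J ⊔ J′` both rows have reached their limits, so agreement there extends to the
    -- rest of the row. `AllBefore` is strict, hence the bound one column further.
    whole-row : ∀ s → s ≤ ℓ → pos s inf ≤T τ* → AllBefore S T (sP s (fin 0)) → SigGt T S ⊎ AllBefore S T (sD s)
    whole-row s s≤ τ≤ b = finish-row (along-row s (suc (J ⊔ J′)) s≤ (≤T-trans (inj₂ (inj₂ (refl , tt))) τ≤) b)
      where
      J = proj₁ (PlaneSeq.limRow S s)
      J′ = proj₁ (PlaneSeq.limRow T s)
      finish-row : SigGt T S ⊎ AllBefore S T (sP s (fin (suc (J ⊔ J′)))) → SigGt T S ⊎ AllBefore S T (sD s)
      finish-row (inj₁ w) = inj₁ w
      finish-row (inj₂ b′) = inj₂ all
        where
        limS : ∀ j → J ⊔ J′ ≤ j → EqP H (P S (pos s (fin j))) (P S (pos s inf))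
        limS j h = proj₂ (PlaneSeq.limRow S s) j (ℕₚ.≤-trans (ℕₚ.m≤m⊔n J J′) h)
        limT : ∀ j → J ⊔ J′ ≤ j → EqP H (P T (pos s (fin j))) (P T (pos s inf))
        limT j h = proj₂ (PlaneSeq.limRow T s) j (ℕₚ.≤-trans (ℕₚ.m≤n⊔m J J′) h)
        eq∞ : EqP H (P S (pos s inf)) (P T (pos s inf))
        eq∞ = EqP-trans (EqP-sym (limS _ ℕₚ.≤-refl))
              (EqP-trans (b′ (sP s (fin (J ⊔ J′))) (inj₂ (refl , ℕₚ.≤-refl))) (limT _ ℕₚ.≤-refl))
        at-row : ∀ c → EqP H (P S (pos s c)) (P T (pos s c))
        at-row inf = eq∞
        at-row (fin j) with ℕₚ.≤-<-connex (J ⊔ J′) j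
        ... | inj₁ h = EqP-trans (limS j h) (EqP-trans eq∞ (EqP-sym (limT j h)))
        ... | inj₂ j< = b′ (sP s (fin j)) (inj₂ (refl , ℕₚ.m≤n⇒m≤1+n j<))
        all : AllBefore S T (sD s)
        all (sP r c) r≤s with ℕₚ.m≤n⇒m<n∨m≡n r≤s
        ... | inj₁ r<s = b′ (sP r c) (inj₁ r<s)
        ... | inj₂ refl = at-row c
        all (sD r) r<s = b′ (sD r) r<s

    to-row : ∀ s → s ≤ ℓ → pos s (fin 0) ≤T τ* → SigGt T S ⊎ AllBefore S T (sP s (fin 0))
    to-row zero _ _ = inj₂ none
      where
      none : AllBefore S T (sP 0 (fin 0))
      none (sP _ _) (inj₁ ())
      none (sP _ (fin _)) (inj₂ (_ , ()))
    to-row (suc s) s< τ≤ with to-row s (ℕₚ.<⇒≤ s<) (≤T-trans (inj₂ (inj₁ ℕₚ.≤-refl)) τ≤)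
    ... | inj₁ w = inj₁ w
    ... | inj₂ b with whole-row s (ℕₚ.<⇒≤ s<) (≤T-trans (inj₂ (inj₁ ℕₚ.≤-refl)) τ≤) b
    ... | inj₁ w = inj₁ w
    ... | inj₂ b′ with decision s s< (<T-≤T-trans (inj₁ ℕₚ.≤-refl) τ≤) b′
    ... | inj₁ w = inj₁ w
    ... | inj₂ eq = inj₂ add
      where
      add : AllBefore S T (sP (suc s) (fin 0))
      add (sP r c) (inj₁ (s≤s r≤s)) = b′ (sP r c) r≤s
      add (sP r (fin j)) (inj₂ (_ , ()))
      add (sD r) (s≤s r≤s) with ℕₚ.m≤n⇒m<n∨m≡n r≤s
      ... | inj₁ r<s = b′ (sD r) r<s
      ... | inj₂ refl = eq

    -- If nothing is decided before `τ*`, all earlier entries agree, and `T` reaches `τ*` by the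
    -- same operation on the same partition. The pair `u`, `v` then makes the entry at `τ*` strictly
    -- larger.
    strictly-greater : ∀ {r c κ s t} → s ≤ ℓ → τ* ≡ pos s (fin t) → Step π (P S) (d S) (pos r c) κ (pos s (fin t)) →
                       RefP H (op κ π (P S (pos r c))) (op κ ρ (P S (pos r c))) →
                       ∀ {u v} → op κ ρ (P S (pos r c)) u v → ¬ P S (pos s (fin t)) u v → SigGt T S
    strictly-greater {s = s} {t} s≤ refl st ⊆ {u} {v} p ¬q with to-row s s≤ (zero-≤ t)
      where
      zero-≤ : ∀ t → pos s (fin 0) ≤T pos s (fin t)
      zero-≤ zero = inj₁ refl
      zero-≤ (suc t) = inj₂ (inj₂ (refl , s≤s z≤n))
    ... | inj₁ w = w
    ... | inj₂ b with along-row s t s≤ (inj₁ refl) b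
    ... | inj₁ w = w
    ... | inj₂ b′ = win (sP s (fin t)) s≤ b′
      ((λ x y q → EqP-⊇ eqT x y (⊆ x y (EqP-⊆ (Step-eq (RS ℓ) s≤ st) x y q))) ,
       λ eq → ¬q (EqP-⊇ eq u v (EqP-⊇ eqT u v p)))
      where
      eqT = step-T s≤ (Step-< st) st b′

-- Changing one redundant hyperedge: improvement at STOP

module Switching (H : Hyp) (O : DOrder (m H)) where
  open Comparison H O public

  no-four : ∀ e {a b c d} → a ∈ edge H e → b ∈ edge H e → c ∈ edge H e → d ∈ edge H e →
            a ≢ b → a ≢ c → a ≢ d → b ≢ c → b ≢ d → c ≢ d → ⊥
  no-four e a∈ b∈ c∈ d∈ ab ac ad bc bd cd with ∣s∣≥4 a∈ b∈ c∈ d∈ ab ac ad bc bd cd | size H e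
  ... | 4≤ | inj₁ eq with s≤s (s≤s ()) ← subst (4 ≤_) eq 4≤
  ... | 4≤ | inj₂ eq with s≤s (s≤s (s≤s ())) ← subst (4 ≤_) eq 4≤

  remove-self : ∀ (σ : Asg H) e → remove {H} σ e e ≡ nothing
  remove-self σ e with e ≟ e
  ... | yes _ = refl
  ... | no ne = ⊥-elim (ne refl)

  remove-other : ∀ (σ : Asg H) {e f} → f ≢ e → remove {H} σ e f ≡ σ f
  remove-other σ {e} {f} ne with f ≟ e
  ... | yes eq = ⊥-elim (ne eq)
  ... | no _ = refl

  Joined-resp : ∀ {σ σ′ : Asg H} {e y z} → σ′ e ≡ σ e → Joined σ e y z → Joined σ′ e y z
  Joined-resp h (s , eq , j) = s , trans h eq , j

  Joined-drop⁺ : ∀ M {σ e y z} → allowed M e → Joined σ e y z → Joined (drop M σ) e y z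
  Joined-drop⁺ nothing _ j = j
  Joined-drop⁺ (just f) {σ} ne j = Joined-resp {σ} {remove {H} σ f} (remove-other σ ne) j

  Joined-drop⁻ : ∀ M {σ e y z} → Joined (drop M σ) e y z → allowed M e × Joined σ e y z
  Joined-drop⁻ nothing j = tt , j
  Joined-drop⁻ (just f) {σ} {e} (s , eq , j) with e ≟ f
  ... | no ne = ne , s , eq , j

  -- If the ends stayed connected, every use of `e` could be replaced by a detour and the class of
  -- the bridge would remain connected.
  bridge-separates : ∀ {σ Q e} → Good Q → Bridge H σ Q e →
                     ¬ (∀ y z → Joined σ e y z → Conn H (remove {H} σ e) (Q y) y z)
  bridge-separates {σ} {Q} {e} G (x , (conn , _) , _ , _ , ¬c) h = ¬c λ y z p q → Conn-bind id reroute-edge (conn y z p q)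
    where
    reroute-edge : ∀ f y z → Joined σ f y z → Q x y → Q x z → Conn H (remove {H} σ e) (Q x) y z
    reroute-edge f y z j p q with f ≟ e
    ... | yes refl = Conn-class G p (h y z j)
    ... | no ne = Conn-edge f p q (Joined-drop⁺ (just e) ne j)

  -- `a` and `b` are the only vertices of `e` in the class of the antibridge. A colouring witnessed
  -- by `e` separates them, so the anticonnected set around both would give another witness.
  antibridge-separates : ∀ {σ Q e} → Good Q → Antibridge H σ Q e → ∀ {a b} → a ∈ edge H e → b ∈ edge H e → a ≢ b →
                         ¬ AntiCompPart H (_≢ e) σ Q a b
  antibridge-separates {σ} {Q} {e} G (x , (_ , ac) , (p , q , p≢q , p∈ , q∈ , xp , xq , only) , _ , ¬ac)
                       {a} {b} a∈ b∈ a≢b (S , S⊆ , acS , _ , aS , bS) = ¬ac ac′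
    where
    open Good G
    -- Otherwise `a` and `b` lie in another class than `p` and `q`, and `e` has four vertices.
    xa : Q x a
    xa = decidable-stable (dec x a) λ ¬xa →
      let ¬xb = λ xb → ¬xa (tra xb (sy (S⊆ b bS)))
          apart : ∀ {y z} → Q x y → ¬ Q x z → y ≢ z
          apart = λ { xy ¬xz refl → ¬xz xy } in
      no-four e p∈ q∈ a∈ b∈ p≢q (apart xp ¬xa) (apart xp ¬xb) (apart xq ¬xa) (apart xq ¬xb) a≢b
    xb : Q x b
    xb = tra xa (S⊆ b bS)
    is-a-or-b : ∀ {w} → w ∈ edge H e → Q x w → w ≡ a ⊎ w ≡ b
    is-a-or-b {w} w∈ xw with only w w∈ xw | only a a∈ xa | only b b∈ xb
    ... | inj₁ refl | inj₁ refl | _ = inj₁ refl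
    ... | inj₁ refl | inj₂ refl | inj₁ refl = inj₂ refl
    ... | inj₁ refl | inj₂ refl | inj₂ refl = ⊥-elim (a≢b refl)
    ... | inj₂ refl | inj₂ refl | _ = inj₁ refl
    ... | inj₂ refl | inj₁ refl | inj₂ refl = inj₂ refl
    ... | inj₂ refl | inj₁ refl | inj₁ refl = ⊥-elim (a≢b refl)
    ac′ : AntiConn H (_≢ e) σ (Q x)
    ac′ c nc with ac c nc
    ... | f , _ , sp , oc with f ≟ e
    ... | no ne = f , ne , sp , oc
    ... | yes refl = let (f′ , w) = acS c (a , b , aS , bS , ca≢cb sp) in
      f′ , Witness-⊆ (_≢ e) σ (λ {z} z∈ → tra xa (S⊆ z z∈)) w
      where
      ca≢cb : Split (Q x) c f → c a ≢ c b
      ca≢cb (u , v , u∈ , v∈ , xu , xv , ne) eq with is-a-or-b u∈ xu | is-a-or-b v∈ xv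
      ... | inj₁ refl | inj₁ refl = ne refl
      ... | inj₁ refl | inj₂ refl = ne eq
      ... | inj₂ refl | inj₁ refl = ne (sym eq)
      ... | inj₂ refl | inj₂ refl = ne refl

  removed : Quasigraph H → E → Quasigraph H
  removed q F = record { asg = remove {H} (asg q) F ; valid = valid′ }
    where
    valid′ : ∀ e s → remove {H} (asg q) F e ≡ just s → (∀ v → v ∈ s → v ∈ edge H e) × ∣ s ∣ ≡ 2
    valid′ e s eq with e ≟ F
    ... | no _ = valid q e s eq

  assign : Asg H → E → Subset (n H) → Asg H
  assign σ F s e with e ≟ F
  ... | yes _ = just s
  ... | no _ = σ e

  assign-self : ∀ σ F s → assign σ F s F ≡ just s
  assign-self σ F s with F ≟ F
  ... | yes _ = refl
  ... | no ne = ⊥-elim (ne refl)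

  assign-other : ∀ σ F s {e} → e ≢ F → assign σ F s e ≡ σ e
  assign-other σ F s {e} ne with e ≟ F
  ... | yes eq = ⊥-elim (ne eq)
  ... | no _ = refl

  assigned : (q : Quasigraph H) (F : E) {u v : V} → u ≢ v → u ∈ edge H F → v ∈ edge H F → Quasigraph H
  assigned q F {u} {v} u≢v u∈ v∈ = record { asg = assign (asg q) F (pair u v) ; valid = valid′ }
    where
    valid′ : ∀ e s → assign (asg q) F (pair u v) e ≡ just s → (∀ w → w ∈ s → w ∈ edge H e) × ∣ s ∣ ≡ 2
    valid′ e s eq with e ≟ F
    valid′ e .(pair u v) refl | yes refl = (λ w w∈ → [ (λ { refl → u∈ }) , (λ { refl → v∈ }) ]′ (∈pair⁻ w∈)) , ∣pair∣≡2 u≢v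
    ... | no _ = valid q e s eq

  -- An empty value satisfies `OneClass` trivially, so removal destroys no witness.
  remove-anti : ∀ {σ F Q} M → Good Q → RefP H (op (ant M) σ Q) (op (ant M) (remove {H} σ F) Q)
  remove-anti {σ} {F} {Q} M G x y (S , S⊆ , ac , _ , x∈ , y∈) =
    anti-intro (allowed? M) (remove {H} σ F) G (_∈? S) (λ {z} → S⊆ z) ac′ x∈ y∈
    where
    oneClass : ∀ {X c} f → OneClass H X c (σ f) → OneClass H X c (remove {H} σ F f)
    oneClass f oc with f ≟ F
    ... | yes _ = tt
    ... | no _ = oc
    ac′ : AntiConn H (allowed M) (remove {H} σ F) (_∈ S)
    ac′ c nc = let (f , o , sp , oc) = ac c nc in f , o , sp , oneClass f oc

  remove-joins : ∀ {σ F Q} M → Good Q → allowed M F → ∀ {u v} → u ∈ edge H F → v ∈ edge H F → Q u v →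
                 op (ant M) (remove {H} σ F) Q u v
  remove-joins {σ} {F} {Q} M G okF {u} {v} u∈ v∈ quv =
    anti-intro (allowed? M) (remove {H} σ F) G (_∈? pair u v)
      (λ z∈ → [ (λ { refl → rfl }) , (λ { refl → quv }) ]′ (∈pair⁻ z∈))
      (AntiConn-pair okF u∈ v∈ (remove-self σ F)) (a∈pair u v) (b∈pair u v)
    where open Good G

  module Redundancy (q : Quasigraph H) (S : PlaneSeq H O (asg q)) (ℓ : ℕ)
    (running : ∀ r → r < ℓ → ¬ Terminal (d S r))
    (γ : QCycle H (asg q) (P S (pos ℓ inf))) (i₀ : Fin (suc (suc (QCycle.k γ))))
    (s₀ t₀ : ℕ) (s₀≤ℓ : s₀ ≤ ℓ)
    (exposed : ExpIs H O (asg q) (P S) (d S) (QCycle.vs γ i₀) (QCycle.vs γ (cyc i₀)) (pos s₀ (fin t₀)))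
    (leading : ∀ j τ → ExpIs H O (asg q) (P S) (d S) (QCycle.vs γ j) (QCycle.vs γ (cyc j)) τ → pos s₀ (fin t₀) ≤T τ)
    (redundant : WeaklyRedundant H (asg q) (P S (pos ℓ inf)) (QCycle.es γ i₀)) where

    open QCycle γ

    π : Asg H
    π = asg q
    P₀ : Part H
    P₀ = P S (pos ℓ inf)
    F : E
    F = es i₀
    τ* : Pos
    τ* = pos s₀ (fin t₀)
    R : Rows π (P S) (d S) ℓ
    R = rowsOf S ℓ
    G₀ : Good P₀
    G₀ = good R ℓ inf ℕₚ.≤-refl
    module G₀ = Good G₀

    P₀-⊆ : ∀ r c → r ≤ ℓ → RefP H P₀ (P S (pos r c))
    P₀-⊆ r c r≤ = mono R ℕₚ.≤-refl (row≤⇒≤T r≤)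

    F-crosses : Crossing H P₀ (edge H F)
    F-crosses = QCycle-crosses G₀ γ i₀

    outside : ∀ x → ∃[ z ] (z ∈ edge H F × ¬ P₀ x z)
    outside x = let (a , b , a∈ , b∈ , ¬ab) = F-crosses in pick a b a∈ b∈ ¬ab (G₀.dec x a)
      where
      pick : ∀ a b → a ∈ edge H F → b ∈ edge H F → ¬ P₀ a b → Dec (P₀ x a) → ∃[ z ] (z ∈ edge H F × ¬ P₀ x z)
      pick a b a∈ b∈ ¬ab (yes xa) = b , b∈ , λ xb → ¬ab (G₀.tra (G₀.sy xa) xb)
      pick a b a∈ b∈ ¬ab (no ¬xa) = a , a∈ , ¬xa

    -- `F` crosses `P₀`, so at least one of its at most three vertices lies outside the class.
    only-two : ∀ {x a b} → a ∈ edge H F → b ∈ edge H F → a ≢ b → P₀ x a → P₀ x b →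
               ∀ w → w ∈ edge H F → P₀ x w → w ≡ a ⊎ w ≡ b
    only-two {x} {a} {b} a∈ b∈ a≢b xa xb w w∈ xw with w ≟ a | w ≟ b
    ... | yes p | _ = inj₁ p
    ... | no _ | yes p = inj₂ p
    ... | no w≢a | no w≢b = let (z , z∈ , ¬xz) = outside x
                                apart : ∀ {y} → P₀ x y → y ≢ z
                                apart = λ { xy refl → ¬xz xy } in
      ⊥-elim (no-four F w∈ a∈ b∈ z∈ w≢a w≢b (apart xw) a≢b (apart xa) (apart xb))

    two-in-class : ∀ {x a b} → a ∈ edge H F → b ∈ edge H F → a ≢ b → P₀ x a → P₀ x b → Two H F (P₀ x)
    two-in-class a∈ b∈ a≢b xa xb = _ , _ , a≢b , a∈ , b∈ , xa , xb , only-two a∈ b∈ a≢b xa xb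

    solid₀ : ∀ x → SolidOn H π (P₀ x)
    solid₀ = inf-solid R ℓ ℕₚ.≤-refl

    -- If `F` joins two distinct vertices of the class, its value is that pair and these are its
    -- only vertices there. A weakly redundant used hyperedge is not a bridge, so the class survives
    -- the removal.
    connected-without-F : ∀ x → ConnectedOn H (remove {H} π F) (P₀ x)
    connected-without-F x y z xy xz = Conn-bind id reroute-edge (proj₁ (solid₀ x) y z xy xz)
      where
      reroute-edge : ∀ e y z → Joined π e y z → P₀ x y → P₀ x z → Conn H (remove {H} π F) (P₀ x) y z
      reroute-edge e y z j xy xz with e ≟ F
      ... | no ne = Conn-edge e xy xz (Joined-drop⁺ (just F) ne j)
      ... | yes refl with y ≟ z
      ... | yes refl = here xy
      ... | no y≢z = by-kind j redundant
        where
        by-kind : Joined π F y z → WeaklyRedundant H π P₀ F → Conn H (remove {H} π F) (P₀ x) y z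
        by-kind (s , eq , _) (inj₁ (_ , eq′ , _)) with () ← trans (sym eq) eq′
        by-kind (s , eq , y∈ , z∈) (inj₂ (_ , _ , ¬bridge)) =
          decidable-stable (connectedOn? π G₀ (remove {H} π F) x)
            (λ ¬c → ¬bridge (x , solid₀ x , two-in-class (⊆edge y y∈) (⊆edge z z∈) y≢z xy xz , (s , eq , s⊆) , ¬c))
            y z xy xz
          where
          ⊆edge = proj₁ (valid q F s eq)
          s⊆ : ∀ w → w ∈ s → P₀ x w
          s⊆ w w∈ with ∈-of-two (proj₂ (valid q F s eq)) y∈ z∈ y≢z w∈
          ... | inj₁ refl = xy
          ... | inj₂ refl = xz

    anticonnected-without-F : ∀ x → AntiConn H (_≢ F) π (P₀ x)
    anticonnected-without-F x c nc with proj₂ (solid₀ x) c nc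
    ... | f , _ , sp , oc with f ≟ F
    ... | no ne = f , ne , sp , oc
    ... | yes refl = by-kind redundant sp oc
      where
      by-kind : WeaklyRedundant H π P₀ F → Split (P₀ x) c F → OneClass H (P₀ x) c (π F) →
                ∃[ f ] Witness (_≢ F) π (P₀ x) c f
      by-kind (inj₁ (_ , eq , ¬anti)) (a , b , a∈ , b∈ , xa , xb , ne) _ =
        decidable-stable (antiConnOn? π G₀ (just F) x)
          (λ ¬c → ¬anti (x , solid₀ x , two-in-class a∈ b∈ (ne ∘ cong c) xa xb , eq , ¬c)) c nc
      by-kind (inj₂ (_ , (s , eq) , _)) (a , b , a∈ , b∈ , xa , xb , ne) oc = ⊥-elim clash
        where
        oc′ : OneClass H (P₀ x) c (just s)
        oc′ = subst (OneClass H (P₀ x) c) eq oc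
        end : ∀ w → w ∈ s → P₀ x w → w ≡ a ⊎ w ≡ b
        end w w∈ = only-two a∈ b∈ (ne ∘ cong c) xa xb w (proj₁ (valid q F s eq) w w∈)
        clash : ⊥
        clash with two-elements s (proj₂ (valid q F s eq))
        ... | p , r , p∈ , r∈ , p≢r with oc′ p r p∈ r∈
        ... | xp , xr , cp≡cr with end p p∈ xp | end r r∈ xr
        ... | inj₁ refl | inj₁ refl = p≢r refl
        ... | inj₁ refl | inj₂ refl = ne cp≡cr
        ... | inj₂ refl | inj₁ refl = ne (sym cp≡cr)
        ... | inj₂ refl | inj₂ refl = p≢r refl

    -- Neighbours on `γ` separated here would be exposed before `τ*`, against the choice of the
    -- leader.
    together : ∀ r c → r ≤ ℓ → pos r c <T τ* → ∀ i j → P S (pos r c) (vs i) (vs j)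
    together r c r≤ τ< = all-related (Good.isEq G) vs λ j → decidable-stable (Good.dec G _ _) (late j)
      where
      G : Good (P S (pos r c))
      G = good R r c r≤
      late : ∀ j → ¬ ¬ P S (pos r c) (vs j) (vs (cyc j))
      late j ¬p with exposure R ℓ ℕₚ.≤-refl (vs j) (vs (cyc j)) (λ p → cyc≢ j (sym (vsDist j (cyc j) p)))
      ... | s , t , _ , ex = <T-irrefl (≤T-<T-trans (leading j (pos s (fin t)) ex) (≤T-<T-trans (proj₂ ex _ ¬p) τ<))

    u v : V
    u = proj₁ (meets i₀)
    v = proj₁ (proj₂ (meets i₀))
    u∈F : u ∈ edge H F
    u∈F = proj₁ (proj₂ (proj₂ (meets i₀)))
    v∈F : v ∈ edge H F
    v∈F = proj₁ (proj₂ (proj₂ (proj₂ (meets i₀))))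
    u~ : P₀ u (vs i₀)
    u~ = proj₁ (proj₂ (proj₂ (proj₂ (proj₂ (meets i₀)))))
    v~ : P₀ v (vs (cyc i₀))
    v~ = proj₂ (proj₂ (proj₂ (proj₂ (proj₂ (meets i₀)))))

    u≢v : u ≢ v
    u≢v eq = cyc≢ i₀ (sym (vsDist i₀ (cyc i₀) (G₀.tra (G₀.sy u~) (subst (λ w → P₀ w (vs (cyc i₀))) (sym eq) v~))))

    related : ∀ {Q} → Good Q → RefP H P₀ Q → Q (vs i₀) (vs (cyc i₀)) → Q u v
    related G ⊆ p = tra (⊆ u (vs i₀) u~) (tra p (sy (⊆ v (vs (cyc i₀)) v~)))
      where open Good G

    separated : ¬ P S τ* u v
    separated p = proj₁ exposed (tra (sy (⊆ u (vs i₀) u~)) (tra p (⊆ v (vs (cyc i₀)) v~)))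
      where
      open Good (good R s₀ (fin t₀) s₀≤ℓ)
      ⊆ = P₀-⊆ s₀ (fin t₀) s₀≤ℓ

    F-within : ∀ {y z} → Joined π F y z → P₀ y z
    F-within {y} {z} (s , eq , y∈ , z∈) with unused i₀
    ... | inj₁ eq′ with () ← trans (sym eq) eq′
    F-within {y} {z} (s , eq , y∈ , z∈) | inj₂ (s′ , eq′ , ¬c) with refl ← trans (sym eq) eq′ =
      decidable-stable (G₀.dec y z) λ ¬p → ¬c (y , z , y∈ , z∈ , ¬p)

    -- Each use of `F` is replaced by a path inside a class of `P₀`. The condition on `M` ensures
    -- that this path also avoids the hyperedge that the step leaves out.
    reroute : ∀ M {Q} → Good Q → RefP H P₀ Q →
              (∀ g a b → Joined π g a b → P₀ a b → allowed M g ⊎ a ≡ b) →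
              RefP H (op (cmp M) π Q) (op (cmp M) (remove {H} π F) Q)
    reroute M {Q} G ⊆ inner x y = Conn-bind id edge′
      where
      open Good G
      within : ∀ {y z} → P₀ y z → Conn H (drop M (remove {H} π F)) (Q y) y z
      within {y} {z} p = Conn-bind (⊆ y _) inside (connected-without-F y y z G₀.rfl p)
        where
        inside : ∀ g a b → Joined (remove {H} π F) g a b → P₀ y a → P₀ y b → Conn H (drop M (remove {H} π F)) (Q y) a b
        inside g a b j ya yb with inner g a b (proj₂ (Joined-drop⁻ (just F) {π} j)) (G₀.tra (G₀.sy ya) yb)
        ... | inj₂ refl = here (⊆ y a ya)
        ... | inj₁ ok = Conn-edge g (⊆ y a ya) (⊆ y b yb) (Joined-drop⁺ M ok j)
      edge′ : ∀ e a b → Joined (drop M π) e a b → Q x a → Q x b → Conn H (drop M (remove {H} π F)) (Q x) a b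
      edge′ e a b j xa xb with Joined-drop⁻ M {π} j
      ... | ok , j′ with e ≟ F
      ... | no ne = Conn-edge e xa xb (Joined-drop⁺ M ok (Joined-drop⁺ (just F) ne j′))
      ... | yes refl = Conn-class G xa (within (F-within j′))

    -- A dropped bridge separates its ends in the partition that it creates, and `P₀` refines that
    -- partition; so its ends never share a class of `P₀`.
    inner-edges : ∀ M {r c s t} → s ≤ ℓ → Step π (P S) (d S) (pos r c) (cmp M) (pos s (fin t)) →
                  ∀ g a b → Joined π g a b → P₀ a b → allowed M g ⊎ a ≡ b
    inner-edges nothing _ _ g a b _ _ = inj₁ tt
    inner-edges (just e) {r} {c} {s} {t} s≤ st g a b j@(w , eq , a∈ , b∈) p with g ≟ e | a ≟ b
    ... | no ne | _ = inj₁ ne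
    ... | yes _ | yes a≡b = inj₂ a≡b
    ... | yes refl | no a≢b = let (_ , r<s , _ , br) = stepInfo st in ⊥-elim (bridge-separates G br joins)
      where
      r≤ : r ≤ ℓ
      r≤ = ℕₚ.≤-trans (ℕₚ.<⇒≤ (proj₁ (proj₂ (stepInfo st)))) s≤
      G : Good (P S (pos r c))
      G = good R r c r≤
      module G′ = Good (op-good (cmp (just e)) π G)
      ab : op (cmp (just e)) π (P S (pos r c)) a b
      ab = EqP-⊆ (Step-eq R s≤ st) a b (P₀-⊆ s (fin t) s≤ a b p)
      joins : ∀ y z → Joined π e y z → op (cmp (just e)) π (P S (pos r c)) y z
      joins y z (w′ , eq′ , y∈ , z∈) with refl ← trans (sym eq) eq′
        with ∈-of-two (proj₂ (valid q e w eq)) a∈ b∈ a≢b y∈ | ∈-of-two (proj₂ (valid q e w eq)) a∈ b∈ a≢b z∈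
      ... | inj₁ refl | inj₁ refl = G′.rfl
      ... | inj₁ refl | inj₂ refl = ab
      ... | inj₂ refl | inj₁ refl = G′.sy ab
      ... | inj₂ refl | inj₂ refl = G′.rfl

    -- Every nonconstant colouring of a union of classes of P₀ containing γ keeps a witness when π(F)
    -- changes: if F is the only candidate and separates u from v, then γ crosses the colour classes again.
    other-witness : ∀ {ok : E → Set} {X : Part H} → Good X → RefP H P₀ X → (∀ i j → X (vs i) (vs j)) → ∀ x →
      (∀ f {a b} → f ≢ F → a ∈ edge H f → b ∈ edge H f → X x a → X x b → a ≢ b → ok f) →
      AntiConn H ok π (X x) → ∀ c → NonConstant (X x) c →
      (∃[ f ] (f ≢ F × Witness ok π (X x) c f)) ⊎ (Witness ok π (X x) c F × X x u × X x v × c u ≡ c v)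
    other-witness {ok} {X} G ⊆ tog x okay ac c nc = by-class
      (any? λ y → any? λ z → G.dec x y ×-dec G.dec x z ×-dec G₀.dec y z ×-dec ¬? (c y ℕₚ.≟ c z))
      where
      module G = Good G
      Goal : Set
      Goal = (∃[ f ] (f ≢ F × Witness ok π (X x) c f)) ⊎ (Witness ok π (X x) c F × X x u × X x v × c u ≡ c v)
      Varies : Set
      Varies = ∃[ y ] ∃[ z ] (X x y × X x z × P₀ y z × c y ≢ c z)
      by-class : Dec Varies → Goal
      -- The colouring varies inside a class of `P₀`, which is anticonnected without `F`. In the
      -- other case these classes are monochromatic.
      by-class (yes (y , z , xy , xz , yz , ne)) with anticonnected-without-F y c (y , z , G₀.rfl , yz , ne)
      ... | f , f≢F , sp , oc with Witness-⊆ (_≢ F) π (λ {w} p → G.tra xy (⊆ y w p)) (f≢F , sp , oc)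
      ... | _ , sp′@(a , b , a∈ , b∈ , xa , xb , ne′) , oc′ = inj₁ (f , f≢F , okay f f≢F a∈ b∈ xa xb (ne′ ∘ cong c) , sp′ , oc′)
      by-class (no ¬varies) = by-witness (ac c nc)
        where
        const : ∀ {y z} → X x y → P₀ y z → c y ≡ c z
        const {y} {z} xy yz = decidable-stable (c y ℕₚ.≟ c z) λ ne → ¬varies (y , z , xy , G.tra xy (⊆ y z yz) , yz , ne)
        uv : X u v
        uv = related G ⊆ (tog i₀ (cyc i₀))
        around-γ : X x u → c u ≢ c v → Goal
        around-γ xu cu≢cv = by-edge (any? λ j → ¬? (j ≟ i₀) ×-dec ¬? (c (vs j) ℕₚ.≟ c (vs (cyc j))))
          where
          xvs : ∀ j → X x (vs j)
          xvs j = G.tra xu (G.tra (⊆ u (vs i₀) u~) (tog i₀ j))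
          by-edge : Dec (∃[ j ] (j ≢ i₀ × c (vs j) ≢ c (vs (cyc j)))) → Goal
          -- If no other edge of `γ` changed colour, going round `γ` would give `u` and `v` the same
          -- colour.
          by-edge (no ¬j) = ⊥-elim (cu≢cv (trans (const xu u~) (trans
            (around isEquivalence (c ∘ vs) i₀ λ j ne → decidable-stable (c (vs j) ℕₚ.≟ c (vs (cyc j))) λ ne′ → ¬j (j , ne , ne′))
            (sym (const (G.tra xu uv) v~)))))
          by-edge (yes (j , j≢ , ne)) with meets j
          ... | a , b , a∈ , b∈ , a~ , b~ =
            inj₁ (g , g≢F , okay g g≢F a∈ b∈ xa xb (ca≢cb ∘ cong c) , (a , b , a∈ , b∈ , xa , xb , ca≢cb) , one (unused j))
            where
            g : E
            g = es j
            g≢F : g ≢ F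
            g≢F eq = j≢ (esInj j i₀ eq)
            xa : X x a
            xa = G.tra (xvs j) (⊆ (vs j) a (G₀.sy a~))
            xb : X x b
            xb = G.tra (xvs (cyc j)) (⊆ (vs (cyc j)) b (G₀.sy b~))
            ca≢cb : c a ≢ c b
            ca≢cb eq = ne (trans (sym (const xa a~)) (trans eq (const xb b~)))
            one : UnusedQ H π P₀ g → OneClass H (X x) c (π g)
            one (inj₁ eq) = subst (OneClass H (X x) c) (sym eq) tt
            one (inj₂ (s , eq , ¬cr)) = subst (OneClass H (X x) c) (sym eq) λ p r p∈ r∈ →
              xs p p∈ , xs r r∈ , const (xs p p∈) (same p∈ r∈)
              where
              same : ∀ {p r} → p ∈ s → r ∈ s → P₀ p r
              same {p} {r} p∈ r∈ = decidable-stable (G₀.dec p r) λ ¬p → ¬cr (p , r , p∈ , r∈ , ¬p)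
              -- `π g` has two of the at most three vertices of `g`, hence contains `a` or `b`; as
              -- it does not cross `P₀`, all of it then lies in `X x`.
              hit : ∃[ p ] (p ∈ s × X x p)
              hit with two-elements s (proj₂ (valid q g s eq))
              ... | p , r , p∈ , r∈ , p≢r with p ≟ a | p ≟ b | r ≟ a | r ≟ b
              ... | yes refl | _ | _ | _ = p , p∈ , xa
              ... | no _ | yes refl | _ | _ = p , p∈ , xb
              ... | no _ | no _ | yes refl | _ = r , r∈ , xa
              ... | no _ | no _ | no _ | yes refl = r , r∈ , xb
              ... | no pa | no pb | no ra | no rb = ⊥-elim (no-four g (⊆g p p∈) (⊆g r r∈) a∈ b∈ p≢r pa pb ra rb (ca≢cb ∘ cong c))
                where ⊆g = proj₁ (valid q g s eq)
              xs : ∀ p → p ∈ s → X x p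
              xs p p∈ = let (r , r∈ , xr) = hit in G.tra xr (⊆ r p (same r∈ p∈))
        by-witness : ∃ (Witness ok π (X x) c) → Goal
        by-witness (f , w) with f ≟ F
        ... | no ne = inj₁ (f , ne , w)
        ... | yes refl = by-colour (c u ℕₚ.≟ c v)
          where
          -- The split uses two of the at most three vertices of `F`, hence `u` or `v`.
          xu : X x u
          xu with proj₁ (proj₂ w)
          ... | a , b , a∈ , b∈ , xa , xb , ne with a ≟ u | a ≟ v | b ≟ u | b ≟ v
          ... | yes refl | _ | _ | _ = xa
          ... | no _ | yes eq | _ | _ = G.tra (subst (X x) eq xa) (G.sy uv)
          ... | no _ | no _ | yes refl | _ = xb
          ... | no _ | no _ | no _ | yes eq = G.tra (subst (X x) eq xb) (G.sy uv)
          ... | no au | no av | no bu | no bv = ⊥-elim (no-four F a∈ b∈ u∈F v∈F (ne ∘ cong c) au av bu bv u≢v)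
          by-colour : Dec (c u ≡ c v) → Goal
          by-colour (yes eq) = inj₂ (w , xu , G.tra xu uv , eq)
          by-colour (no ne) = around-γ xu ne

    -- As a bridge `F` would separate its ends, which are connected without it inside a class of
    -- `P₀`. As an antibridge it would be indispensable for some colouring, but `γ` supplies a
    -- substitute.
    avoid : ∀ r → r < ℓ → pos r inf <T τ* → d S r ≢ edgeD F
    avoid r r<ℓ τ< de with row-start π (P S) (d S) r (PlaneSeq.steps S r)
    ... | inj₁ (t , _) = running r r<ℓ t
    ... | inj₂ (_ , _ , _ , bridge-step _ e de′ b , _) with refl ← edgeD-injective (trans (sym de) de′) =
      bridge-separates (good R r inf (ℕₚ.<⇒≤ r<ℓ)) b λ y z j →
        Conn-bind (⊆ y _) (λ g a b j′ p p′ → Conn-edge g (⊆ y a p) (⊆ y b p′) j′)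
                  (connected-without-F y y z G₀.rfl (F-within j))
      where ⊆ = P₀-⊆ r inf (ℕₚ.<⇒≤ r<ℓ)
    ... | inj₂ (_ , _ , _ , antibridge-step _ e de′ (x , (_ , ac) , (p , p′ , _ , _ , _ , _ , _ , only) , _ , ¬ac) , _)
        with refl ← edgeD-injective (trans (sym de) de′) = ¬ac without
      where
      r≤ = ℕₚ.<⇒≤ r<ℓ
      G = good R r inf r≤
      without : AntiConn H (_≢ F) π (P S (pos r inf) x)
      without c nc with other-witness G (P₀-⊆ r inf r≤) (together r inf r≤ τ<) x (λ _ _ _ _ _ _ _ → tt) ac c nc
      ... | inj₁ (f , ne , _ , sp , oc) = f , ne , sp , oc
      -- `F` has exactly the vertices `p` and `p′` in this class, so `u`, `v` are `a`, `b` in some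
      -- order, against the equal colours of `u` and `v`.
      ... | inj₂ ((_ , (a , b , a∈ , b∈ , xa , xb , ne) , _) , xu , xv , eq)
          with only a a∈ xa | only b b∈ xb | only u u∈F xu | only v v∈F xv
      ... | inj₁ refl | inj₁ refl | _ | _ = ⊥-elim (ne refl)
      ... | inj₂ refl | inj₂ refl | _ | _ = ⊥-elim (ne refl)
      ... | _ | _ | inj₁ p₁ | inj₁ p₂ = ⊥-elim (u≢v (trans p₁ (sym p₂)))
      ... | _ | _ | inj₂ p₁ | inj₂ p₂ = ⊥-elim (u≢v (trans p₁ (sym p₂)))
      ... | inj₁ refl | inj₂ refl | inj₁ p₁ | inj₂ p₂ = ⊥-elim (ne (trans (sym (cong c p₁)) (trans eq (cong c p₂))))
      ... | inj₁ refl | inj₂ refl | inj₂ p₁ | inj₁ p₂ = ⊥-elim (ne (trans (sym (cong c p₂)) (trans (sym eq) (cong c p₁))))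
      ... | inj₂ refl | inj₁ refl | inj₁ p₁ | inj₂ p₂ = ⊥-elim (ne (trans (sym (cong c p₂)) (trans (sym eq) (cong c p₁))))
      ... | inj₂ refl | inj₁ refl | inj₂ p₁ | inj₁ p₂ = ⊥-elim (ne (trans (sym (cong c p₁)) (trans eq (cong c p₂))))

    F-allowed : ∀ κ {r c s} → s ≤ ℓ → pos r c <T τ* → StepInfo π (P S) (d S) r c s κ →
                ∀ M → κ ≡ cmp M ⊎ κ ≡ ant M → allowed M F
    F-allowed _ _ _ _ nothing _ = tt
    F-allowed _ s≤ τ< (refl , r<s , de , _) (just e) (inj₁ refl) refl = avoid _ (ℕₚ.<-≤-trans r<s s≤) τ< de
    F-allowed _ s≤ τ< (refl , r<s , de , _) (just e) (inj₂ refl) refl = avoid _ (ℕₚ.<-≤-trans r<s s≤) τ< de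

    unused-π : ∀ r → r ≤ ℓ → UnusedQ H π (P S (pos r inf)) F
    unused-π r r≤ = UnusedQ-⊆ π (P₀-⊆ r inf r≤) (unused i₀)

    Improved : Set₁
    Improved = Σ (Quasigraph H) λ ρ → Σ (PlaneSeq H O (asg ρ)) λ T → SigGt T S

    by-removal : ∀ {r c} M → Step π (P S) (d S) (pos r c) (ant M) τ* → Improved
    by-removal {r} {c} M st = removed q F , planeSeq _ ,
      strictly-greater s₀≤ℓ refl st (remove-anti M G)
        (remove-joins M G (F-allowed (ant M) s₀≤ℓ τ< (stepInfo st) M (inj₂ refl)) u∈F v∈F
          (related G (P₀-⊆ r c r≤) (together r c r≤ τ< i₀ (cyc i₀))))
        separated
      where
      τ< = Step-< st
      r≤ = source-row s₀≤ℓ st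
      G = good R r c r≤
      coarser : ∀ {r c κ s t} → s ≤ ℓ → Step π (P S) (d S) (pos r c) κ (pos s (fin t)) → pos s (fin t) <T τ* →
                RefP H (op κ π (P S (pos r c))) (op κ (remove {H} π F) (P S (pos r c)))
      coarser {r} {c} {cmp M} s≤ st _ = reroute M (good R r c (source-row s≤ st)) (P₀-⊆ r c (source-row s≤ st)) (inner-edges M s≤ st)
      coarser {r} {c} {ant M} s≤ st _ = remove-anti M (good R r c (source-row s≤ st))
      open Domination S (planeSeq (remove {H} π F)) ℓ running F (λ e ne → remove-other π {F} {e} ne) τ* coarser
        (λ r r≤ _ → unused-π r r≤ , inj₁ (remove-self π F)) avoid

    ρ : Asg H
    ρ = assign π F (pair u v)

    -- `F` may already be used, and its old pair is lost. Rerouting first removes every use of it,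
    -- and what remains of `π` is contained in `ρ`.
    switch-conn : ∀ M {r c s t} → s ≤ ℓ → Step π (P S) (d S) (pos r c) (cmp M) (pos s (fin t)) →
                  RefP H (op (cmp M) π (P S (pos r c))) (op (cmp M) ρ (P S (pos r c)))
    switch-conn M {r} {c} s≤ st x y p = Conn-bind id lift
      (reroute M (good R r c (source-row s≤ st)) (P₀-⊆ r c (source-row s≤ st)) (inner-edges M s≤ st) x y p)
      where
      lift : ∀ e a b → Joined (drop M (remove {H} π F)) e a b → P S (pos r c) x a → P S (pos r c) x b →
             Conn H (drop M ρ) (P S (pos r c) x) a b
      lift e a b j xa xb = let (ok , j′) = Joined-drop⁻ M {remove {H} π F} j
                               (ne , j″) = Joined-drop⁻ (just F) {π} {e} j′ in
        Conn-edge e xa xb (Joined-drop⁺ M ok (Joined-resp {π} {ρ} (assign-other π F (pair u v) ne) j″))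

    -- The new value can spoil `F` as a witness only if `u` and `v` differ in colour, and then
    -- `other-witness` finds a substitute. It is applied to the class after the step, which still
    -- contains all or none of `γ` as the step precedes `τ*`.
    switch-anti : ∀ M {r c s t} → s ≤ ℓ → pos s (fin t) <T τ* → Step π (P S) (d S) (pos r c) (ant M) (pos s (fin t)) →
                  RefP H (op (ant M) π (P S (pos r c))) (op (ant M) ρ (P S (pos r c)))
    switch-anti M {r} {c} {s} {t} s≤ τ< st x y p =
      anti-intro (allowed? M) ρ G (X.dec x) (λ {z} z∈ → op-⊆ (ant M) π (P S (pos r c)) x z (X⊆ z∈)) anti X.rfl (X⊇ p)
      where
      G = good R r c (source-row s≤ st)
      X : Part H
      X = P S (pos s (fin t))
      X-good : Good X
      X-good = good R s (fin t) s≤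
      module X = Good X-good
      X⊆ : ∀ {a b} → X a b → op (ant M) π (P S (pos r c)) a b
      X⊆ = EqP-⊆ (Step-eq R s≤ st) _ _
      X⊇ : ∀ {a b} → op (ant M) π (P S (pos r c)) a b → X a b
      X⊇ = EqP-⊇ (Step-eq R s≤ st) _ _
      -- The dropped antibridge has no two vertices in one class of `X`: they would share an
      -- anticomponent without it.
      okay : ∀ M → StepInfo π (P S) (d S) r c s (ant M) → (∀ {a b} → X a b → op (ant M) π (P S (pos r c)) a b) →
             ∀ f {a b} → f ≢ F → a ∈ edge H f → b ∈ edge H f → X x a → X x b → a ≢ b → allowed M f
      okay nothing _ _ f _ _ _ _ _ _ = tt
      okay (just e) (_ , _ , _ , an) X⊆ f _ a∈ b∈ xa xb a≢b refl =
        antibridge-separates G an a∈ b∈ a≢b (X⊆ (X.tra (X.sy xa) xb))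
      anti : AntiConn H (allowed M) ρ (X x)
      anti c′ nc with other-witness X-good (P₀-⊆ s (fin t) s≤) (together s (fin t) s≤ τ<) x (okay M (stepInfo st) X⊆)
                        (AntiConn-resp X⊇ X⊆ (anti-class (allowed? M) π G x)) c′ nc
      ... | inj₁ (f , ne , ok , sp , oc) = f , ok , sp , subst (OneClass H (X x) c′) (sym (assign-other π F (pair u v) ne)) oc
      ... | inj₂ ((ok , sp , _) , xu , xv , eq) = F , ok , sp ,
        subst (OneClass H (X x) c′) (sym (assign-self π F (pair u v))) λ a b a∈ b∈ →
          at a∈ , at b∈ , trans (colour a∈) (sym (colour b∈))
        where
        at : ∀ {a} → a ∈ pair u v → X x a
        at a∈ with ∈pair⁻ a∈
        ... | inj₁ refl = xu
        ... | inj₂ refl = xv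
        colour : ∀ {a} → a ∈ pair u v → c′ a ≡ c′ u
        colour a∈ with ∈pair⁻ a∈
        ... | inj₁ refl = refl
        ... | inj₂ refl = sym eq

    by-switch : ∀ {r c} M → Step π (P S) (d S) (pos r c) (cmp M) τ* → Improved
    by-switch {r} {c} M st = assigned q F u≢v u∈F v∈F , planeSeq _ ,
      strictly-greater s₀≤ℓ refl st (switch-conn M s₀≤ℓ st)
        (Conn-edge F G.rfl uv (Joined-drop⁺ M (F-allowed (cmp M) s₀≤ℓ τ< (stepInfo st) M (inj₁ refl))
          (pair u v , assign-self π F (pair u v) , a∈pair u v , b∈pair u v)))
        separated
      where
      τ< = Step-< st
      r≤ = source-row s₀≤ℓ st
      module G = Good (good R r c r≤)
      uv : P S (pos r c) u v
      uv = related (good R r c r≤) (P₀-⊆ r c r≤) (together r c r≤ τ< i₀ (cyc i₀))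
      coarser : ∀ {r c κ s t} → s ≤ ℓ → Step π (P S) (d S) (pos r c) κ (pos s (fin t)) → pos s (fin t) <T τ* →
                RefP H (op κ π (P S (pos r c))) (op κ ρ (P S (pos r c)))
      coarser {κ = cmp M} s≤ st _ = switch-conn M s≤ st
      coarser {κ = ant M} s≤ st τ< = switch-anti M s≤ τ< st
      unused-ρ : ∀ r → r ≤ ℓ → pos r inf <T τ* → UnusedQ H ρ (P S (pos r inf)) F
      unused-ρ r r≤ τ< = inj₂ (pair u v , assign-self π F (pair u v) , λ (a , b , a∈ , b∈ , ¬p) → ¬p (A.tra (A.sy (at a∈)) (at b∈)))
        where
        module A = Good (good R r inf r≤)
        at : ∀ {a} → a ∈ pair u v → P S (pos r inf) u a
        at a∈ with ∈pair⁻ a∈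
        ... | inj₁ refl = A.rfl
        ... | inj₂ refl = related (good R r inf r≤) (P₀-⊆ r inf r≤) (together r inf r≤ τ< i₀ (cyc i₀))
      open Domination S (planeSeq ρ) ℓ running F (λ e ne → assign-other π F (pair u v) {e} ne) τ* coarser
        (λ r r≤ τ< → unused-π r r≤ , unused-ρ r r≤ τ<) avoid

    improve : Improved
    improve with step-into R s₀ t₀ s₀≤ℓ (λ r r< → running r (ℕₚ.<-≤-trans r< s₀≤ℓ))
    ... | inj₁ eq = ⊥-elim (proj₁ exposed (subst (λ τ → P S τ (vs i₀) (vs (cyc i₀))) (sym eq) (EqP-⊇ (PlaneSeq.init S) _ _ tt)))
    ... | inj₂ (_ , _ , cmp M , st) = by-switch M st
    ... | inj₂ (_ , _ , ant M , st) = by-removal M st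

  improve-at-stop : (q : Quasigraph H) (S : PlaneSeq H O (asg q)) (ℓ : ℕ) → (∀ r → r < ℓ → ¬ Terminal (d S r)) →
    (∃[ e ] (InL H O (asg q) (P S) (d S) (P S (pos ℓ inf)) e × WeaklyRedundant H (asg q) (P S (pos ℓ inf)) e)) →
    Σ (Quasigraph H) λ ρ → Σ (PlaneSeq H O (asg ρ)) λ T → SigGt T S
  improve-at-stop q S ℓ running (e , (γ , i , refl , τ , ex , mn) , w)
    with exposure (rowsOf S ℓ) ℓ ℕₚ.≤-refl (QCycle.vs γ i) (QCycle.vs γ (cyc i))
           (λ p → cyc≢ i (sym (QCycle.vsDist γ i (cyc i) p)))
  ... | s , t , s≤ , ex′ = Redundancy.improve q S ℓ running γ i s t s≤ ex′
    (λ j τ′ ex″ → ≤T-trans (proj₂ ex′ τ (proj₁ ex)) (mn j τ′ ex″)) w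

-- Counting used hyperedges

sum-map-≤ : ∀ {A : Set} {f g : A → ℕ} → (∀ a → f a ≤ g a) → ∀ xs → sum (map f xs) ≤ sum (map g xs)
sum-map-≤ h [] = z≤n
sum-map-≤ h (x List.∷ xs) = ℕₚ.+-mono-≤ (h x) (sum-map-≤ h xs)

sum-map-< : ∀ {A : Set} {f g : A → ℕ} → (∀ a → f a ≤ g a) → ∀ {a} → f a < g a → ∀ {xs} → a ∈L xs →
            sum (map f xs) < sum (map g xs)
sum-map-< h lt {x List.∷ xs} (Any.here refl) = ℕₚ.+-mono-<-≤ lt (sum-map-≤ h xs)
sum-map-< h lt {x List.∷ xs} (Any.there a∈) = ℕₚ.+-mono-≤-< (h x) (sum-map-< h lt a∈)

weight : ∀ {A : Set} → Maybe A → ℕ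
weight (just _) = 1
weight nothing = 0

module _ {H : Hyp} where

  private
    -- The summand of usedCount is local to Defs; unification recovers it.
    summand : (q : Quasigraph H) → Σ (Fin (m H) → ℕ) λ f → usedCount q ≡ sum (map f (allFin (m H)))
    summand q = _ , refl

    summand≡weight : ∀ q e → proj₁ (summand q) e ≡ weight (asg q e)
    summand≡weight q e with asg q e
    ... | just _ = refl
    ... | nothing = refl

  usedCount≡ : ∀ q → usedCount q ≡ sum (map (weight ∘ asg q) (allFin (m H)))
  usedCount≡ q = cong sum (map-cong (summand≡weight q) (allFin (m H)))

-- Removing a hyperedge of a cycle: improvement at TERMINATE

module Termination (H : Hyp) (O : DOrder (m H)) where
  open Switching H O public

  usedCount-removed : ∀ q F {s} → asg q F ≡ just s → usedCount (removed q F) < usedCount q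
  usedCount-removed q F {s} eq = subst₂ _<_ (sym (usedCount≡ (removed q F))) (sym (usedCount≡ q))
    (sum-map-< pointwise at-F (∈-allFin F))
    where
    pointwise : ∀ e → weight (remove {H} (asg q) F e) ≤ weight (asg q e)
    pointwise e with e ≟ F
    ... | yes _ = z≤n
    ... | no _ = ℕₚ.≤-refl
    at-F : weight (remove {H} (asg q) F F) < weight (asg q F)
    at-F rewrite remove-self (asg q) F | eq = s≤s z≤n

  module Cycle (q : Quasigraph H) (S : PlaneSeq H O (asg q)) (ℓ : ℕ)
    (running : ∀ r → r < ℓ → ¬ Terminal (d S r)) (C : GCycle H (asg q)) where

    open GCycle C

    π : Asg H
    π = asg q
    R : Rows π (P S) (d S) ℓ
    R = rowsOf S ℓ

    Whole : Part H → Set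
    Whole Q = ∀ i → Q (vs i) (vs (cyc i))

    end₁ : ∀ i → vs i ∈ edge H (es i)
    end₁ i = proj₁ (valid q _ _ (on i)) _ (a∈pair (vs i) (vs (cyc i)))

    end₂ : ∀ i → vs (cyc i) ∈ edge H (es i)
    end₂ i = proj₁ (valid q _ _ (on i)) _ (b∈pair (vs i) (vs (cyc i)))

    joined : ∀ i → Joined π (es i) (vs i) (vs (cyc i))
    joined i = _ , on i , a∈pair (vs i) (vs (cyc i)) , b∈pair (vs i) (vs (cyc i))

    -- The rest of the cycle is the detour. It stays in the class by `whole` and uses no hyperedge
    -- left out by the step, by `ok`.
    path : ∀ {Q} → Good Q → Whole Q → ∀ M → (∀ j → allowed M (es j)) → ∀ i →
           Conn H (drop M (remove {H} π (es i))) (Q (vs i)) (vs i) (vs (cyc i))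
    path {Q} G whole M ok i = around {_~_ = _~_} (record { refl = λ {a} → here (all a) ; sym = Conn-sym ; trans = Conn-trans }) id i
      λ j j≢i → Conn-edge (es j) (all j) (all (cyc j))
        (Joined-drop⁺ M (ok j) (Joined-drop⁺ (just (es i)) {π} (j≢i ∘ esInj j i) (joined j)))
      where
      all : ∀ j → Q (vs i) (vs j)
      all = all-related (Good.isEq G) vs whole i
      _~_ : Fin (suc (suc k)) → Fin (suc (suc k)) → Set
      a ~ b = Conn H (drop M (remove {H} π (es i))) (Q (vs i)) (vs a) (vs b)

    bypass : ∀ {Q} → Good Q → Whole Q → ∀ M → (∀ j → allowed M (es j)) → ∀ i {y z} → Joined π (es i) y z →
             Conn H (drop M (remove {H} π (es i))) (Q y) y z
    bypass {Q} G whole M ok i {y} {z} (s , eq , y∈ , z∈) with refl ← trans (sym (on i)) eq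
      with ∈pair⁻ y∈ | ∈pair⁻ z∈
    ... | inj₁ refl | inj₁ refl = here (Good.rfl G)
    ... | inj₂ refl | inj₂ refl = here (Good.rfl G)
    ... | inj₁ refl | inj₂ refl = path G whole M ok i
    ... | inj₂ refl | inj₁ refl = Conn-class G (Good.sy G (whole i)) (Conn-sym (path G whole M ok i))

    not-bridge : ∀ {Q} → Good Q → Whole Q → ∀ i → ¬ Bridge H π Q (es i)
    not-bridge G whole i b = bridge-separates G b λ y z → bypass G whole nothing (λ _ → tt) i

    not-antibridge : ∀ {Q} i → ¬ Antibridge H π Q (es i)
    not-antibridge i (_ , _ , _ , eq , _) with () ← trans (sym eq) (on i)

    reroute : ∀ {Q} → Good Q → Whole Q → ∀ M → (∀ j → allowed M (es j)) → ∀ i →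
              RefP H (op (cmp M) π Q) (op (cmp M) (remove {H} π (es i)) Q)
    reroute {Q} G whole M ok i x y = Conn-bind id edge′
      where
      edge′ : ∀ e a b → Joined (drop M π) e a b → Q x a → Q x b → Conn H (drop M (remove {H} π (es i))) (Q x) a b
      edge′ e a b j xa xb with Joined-drop⁻ M {π} j
      ... | okₑ , j′ with e ≟ es i
      ... | no ne = Conn-edge e xa xb (Joined-drop⁺ M okₑ (Joined-drop⁺ (just (es i)) {π} ne j′))
      ... | yes refl = Conn-class G xa (bypass G whole M ok i j′)

    -- The hyperedge left out is a bridge, and an edge of a cycle inside one class is not.
    allowed-cmp : ∀ {r c s t} M → s ≤ ℓ → Step π (P S) (d S) (pos r c) (cmp M) (pos s (fin t)) →
                  Whole (P S (pos r c)) → ∀ j → allowed M (es j)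
    allowed-cmp nothing _ _ _ _ = tt
    allowed-cmp {r} {c} (just e) s≤ st whole j refl =
      not-bridge (good R r c (source-row s≤ st)) whole j (proj₂ (proj₂ (proj₂ (stepInfo st))))

    allowed-ant : ∀ {r c s t} M → Step π (P S) (d S) (pos r c) (ant M) (pos s (fin t)) → ∀ j → allowed M (es j)
    allowed-ant nothing _ _ = tt
    allowed-ant (just e) st j refl = not-antibridge j (proj₂ (proj₂ (proj₂ (stepInfo st))))

    module Removal (i : Fin (suc (suc k))) (τ* : Pos)
      (whole : ∀ r c → r ≤ ℓ → pos r c <T τ* → Whole (P S (pos r c))) where

      F : E
      F = es i

      coarser : ∀ {r c κ s t} → s ≤ ℓ → Step π (P S) (d S) (pos r c) κ (pos s (fin t)) → pos s (fin t) <T τ* →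
                RefP H (op κ π (P S (pos r c))) (op κ (remove {H} π F) (P S (pos r c)))
      coarser {r} {c} {ant M} s≤ st _ = remove-anti M (good R r c (source-row s≤ st))
      coarser {r} {c} {cmp M} s≤ st τ< = reroute (good R r c r≤) w M (allowed-cmp M s≤ st w) i
        where
        r≤ = source-row s≤ st
        w = whole r c r≤ (<T-trans (Step-< st) τ<)

      unused : ∀ r → r ≤ ℓ → pos r inf <T τ* →
               UnusedQ H π (P S (pos r inf)) F × UnusedQ H (remove {H} π F) (P S (pos r inf)) F
      unused r r≤ τ< = inj₂ (_ , on i , λ (a , b , a∈ , b∈ , ¬p) → ¬p (tra (sy (at a∈)) (at b∈))) , inj₁ (remove-self π F)
        where
        open Good (good R r inf r≤)
        at : ∀ {a} → a ∈ pair (vs i) (vs (cyc i)) → P S (pos r inf) (vs i) a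
        at a∈ with ∈pair⁻ a∈
        ... | inj₁ refl = rfl
        ... | inj₂ refl = whole r inf r≤ τ< i

      avoid : ∀ r → r < ℓ → pos r inf <T τ* → d S r ≢ edgeD F
      avoid r r<ℓ τ< de with row-start π (P S) (d S) r (PlaneSeq.steps S r)
      ... | inj₁ (t , _) = running r r<ℓ t
      ... | inj₂ (_ , _ , _ , bridge-step _ e de′ b , _) with refl ← edgeD-injective (trans (sym de) de′) =
        not-bridge (good R r inf (ℕₚ.<⇒≤ r<ℓ)) (whole r inf (ℕₚ.<⇒≤ r<ℓ) τ<) i b
      ... | inj₂ (_ , _ , _ , antibridge-step _ e de′ a , _) with refl ← edgeD-injective (trans (sym de) de′) =
        not-antibridge i a

      T : PlaneSeq H O (remove {H} π F)
      T = planeSeq (remove {H} π F)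

      open Domination S T ℓ running F (λ e ne → remove-other π {F} {e} ne) τ* coarser unused avoid public

    Better : Set₁
    Better = Σ (Quasigraph H) λ ρ → Σ (PlaneSeq H O (asg ρ)) λ T → SigGt T S ⊎ (SigEquiv T S × usedCount ρ < usedCount q)

    when-split : FirstFailure {A = Whole ∘ P S} ℓ → Better
    when-split (s , t , s≤ , ¬whole , before) = by-step (step-into R s t s≤ (λ r r< → running r (ℕₚ.<-≤-trans r< s≤)))
      where
      Gₛ : Good (P S (pos s (fin t)))
      Gₛ = good R s (fin t) s≤
      by-step : pos s (fin t) ≡ pos 0 (fin 0) ⊎ (∃[ r ] ∃[ c ] ∃[ κ ] Step π (P S) (d S) (pos r c) κ (pos s (fin t))) → Better
      by-step (inj₁ eq) = ⊥-elim (¬whole λ i → subst (λ τ → P S τ (vs i) (vs (cyc i))) (sym eq) (EqP-⊇ (PlaneSeq.init S) _ _ tt))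
      -- A component step leaves out no edge of the cycle, so each edge still joins its own ends.
      by-step (inj₂ (r , c , cmp M , st)) = ⊥-elim (¬whole λ i → EqP-⊇ (Step-eq R s≤ st) _ _
        (Conn-edge (es i) rfl (w i) (Joined-drop⁺ M {π} (allowed-cmp M s≤ st w i) (joined i))))
        where
        open Good (good R r c (source-row s≤ st))
        w : Whole (P S (pos r c))
        w = before (pos r c) (Step-< st)
      by-step (inj₂ (r , c , ant M , st)) = by-edge (¬∀⟶∃¬ _ _ (λ i → Good.dec Gₛ (vs i) (vs (cyc i))) ¬whole)
        where
        G = good R r c (source-row s≤ st)
        by-edge : (∃[ i ] ¬ P S (pos s (fin t)) (vs i) (vs (cyc i))) → Better
        by-edge (i , ¬p) = removed q (es i) , T , inj₁
          (strictly-greater s≤ refl st (remove-anti M G)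
            (remove-joins M G (allowed-ant M st i) (end₁ i) (end₂ i) (before (pos r c) (Step-< st) i)) ¬p)
          where open Removal i (pos s (fin t)) (λ r c _ → before (pos r c))

    when-whole : ¬ QCycle H π (P S (pos ℓ inf)) → d S ℓ ≡ TERMINATE → (∀ r c → r ≤ ℓ → Whole (P S (pos r c))) → Better
    when-whole ¬γ dℓ whole = removed q F , T , conclude (to-row ℓ ℕₚ.≤-refl (inj₂ (inj₁ ℕₚ.≤-refl)))
      where
      -- The position just past row `ℓ` brings the whole signature into the comparison.
      open Removal zero (pos (suc ℓ) (fin 0)) (λ r c r≤ _ → whole r c r≤)
      Goal : Set
      Goal = SigGt T S ⊎ (SigEquiv T S × usedCount (removed q F) < usedCount q)
      module _ (b : AllBefore S T (sD ℓ)) where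
        dT : d T ℓ ≡ TERMINATE
        dT = by-rule (PlaneSeq.steps T ℓ)
          where
          ¬γT : ¬ QCycle H (remove {H} π F) (P T (pos ℓ inf))
          ¬γT γ = ¬γ (qcycle← ℕₚ.≤-refl (inj₁ ℕₚ.≤-refl) b γ)
          by-rule : StepRule H O (remove {H} π F) (P T) (d T) ℓ → d T ℓ ≡ TERMINATE
          by-rule (inj₁ (_ , _ , t)) = t
          by-rule (inj₂ (inj₁ (γ , _))) = ⊥-elim (¬γT γ)
          by-rule (inj₂ (inj₂ (_ , (γ , _) , _))) = ⊥-elim (¬γT γ)
        ds : ∀ r → r ≤ ℓ → d S r ≡ d T r
        ds r r≤ with ℕₚ.m≤n⇒m<n∨m≡n r≤
        ... | inj₁ r<ℓ = b (sD r) r<ℓ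
        ... | inj₂ refl = trans dℓ (sym dT)
        entryEq : ∀ p → row p ≤ ℓ → EntryEq S T p
        entryEq (sP r c) r≤ = b (sP r c) r≤
        entryEq (sD r) r≤ = ds r r≤
        in-rows : ∀ (δ : ℕ → D (m H)) → Terminal (δ ℓ) → ∀ p → (∀ r → r < row p → ¬ Terminal (δ r)) → row p ≤ ℓ
        in-rows δ t p nt = ℕₚ.≮⇒≥ λ ℓ< → nt ℓ ℓ< t
        S→T : ∀ p → InRange {π = π} {ρ = remove {H} π F} S p → row p ≤ ℓ × InRange {π = π} {ρ = remove {H} π F} T p
        S→T p inS = p≤ , λ r r< → subst (¬_ ∘ Terminal) (ds r (ℕₚ.≤-trans (ℕₚ.<⇒≤ r<) p≤)) (inS r r<)
          where p≤ = in-rows (d S) (inj₂ dℓ) p inS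
        T→S : ∀ p → InRange {π = π} {ρ = remove {H} π F} T p → row p ≤ ℓ × InRange {π = π} {ρ = remove {H} π F} S p
        T→S p inT = p≤ , λ r r< → subst (¬_ ∘ Terminal) (sym (ds r (ℕₚ.≤-trans (ℕₚ.<⇒≤ r<) p≤))) (inT r r<)
          where p≤ = in-rows (d T) (inj₂ dT) p inT
        equiv : SigEquiv T S
        equiv = inj₁ ((λ p inS → proj₂ (S→T p inS) , entryEq p (proj₁ (S→T p inS))) , (λ p inT → proj₂ (T→S p inT))) ,
                inj₁ ((λ p inT → proj₂ (T→S p inT) , EntryEq-sym S T p (entryEq p (proj₁ (T→S p inT)))) , (λ p inS → proj₂ (S→T p inS)))
      conclude : SigGt T S ⊎ AllBefore S T (sP ℓ (fin 0)) → Goal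
      conclude (inj₁ w) = inj₁ w
      conclude (inj₂ b) with whole-row ℓ ℕₚ.≤-refl (inj₂ (inj₁ ℕₚ.≤-refl)) b
      ... | inj₁ w = inj₁ w
      ... | inj₂ b′ = inj₂ (equiv b′ , usedCount-removed q F (on zero))

    better : ¬ QCycle H π (P S (pos ℓ inf)) → d S ℓ ≡ TERMINATE → Better
    better ¬γ dℓ = [ when-split , when-whole ¬γ dℓ ]′ (first-failure ℓ
      (λ r j r≤ → all? λ i → Good.dec (good R r (fin j) r≤) (vs i) (vs (cyc i)))
      (λ r → let (J , lm) = PlaneSeq.limRow S r in J , λ j J≤ →
        (λ w i → EqP-⊇ (lm j J≤) _ _ (w i)) , (λ w i → EqP-⊆ (lm j J≤) _ _ (w i))))

  terminal? : ∀ (x : D (m H)) → Dec (Terminal x)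
  terminal? (edgeD e) = no λ { (inj₁ ()) ; (inj₂ ()) }
  terminal? STOP = yes (inj₁ refl)
  terminal? TERMINATE = yes (inj₂ refl)

  module _ {σ : Asg H} (S : PlaneSeq H O σ) where

    -- When the limits of the rows no longer change, the next row cannot start by a bridge or
    -- antibridge step, as that would refine the partition.
    eventually-terminal : ∃[ I ] Terminal (d S I)
    eventually-terminal with PlaneSeq.limAll S
    ... | I , lim with row-start σ (P S) (d S) I (PlaneSeq.steps S I)
    ... | inj₁ (t , _) = I , t
    ... | inj₂ (e , _ , κ , st , eq) = ⊥-elim (strict st refines)
      where
      R = rowsOf S (suc I)
      G : Good (P S (pos I inf))
      G = good R I inf (ℕₚ.n≤1+n I)
      refines : RefP H (P S (pos I inf)) (op κ σ (P S (pos I inf)))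
      refines x y p = EqP-⊆ eq x y (to-start R (suc I) inf x y
        (EqP-⊇ (lim (suc I) (ℕₚ.n≤1+n I)) x y (EqP-⊆ (lim I ℕₚ.≤-refl) x y p)))
      strict : ∀ {κ} → Step σ (P S) (d S) (pos I inf) κ (pos (suc I) (fin 0)) → ¬ RefP H (P S (pos I inf)) (op κ σ (P S (pos I inf)))
      strict (bridge-step _ _ _ b) = bridge-refines G b
      strict (antibridge-step _ _ _ a) = antibridge-refines G a

    first-terminal : ∃[ ℓ ] (Terminal (d S ℓ) × (∀ r → r < ℓ → ¬ Terminal (d S r)))
    first-terminal with eventually-terminal
    ... | I , t = [ id , (λ none → ⊥-elim (none I ℕₚ.≤-refl t)) ]′ (search (suc I))
      where
      First : Set
      First = ∃[ ℓ ] (Terminal (d S ℓ) × (∀ r → r < ℓ → ¬ Terminal (d S r)))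
      search : ∀ k → First ⊎ (∀ r → r < k → ¬ Terminal (d S r))
      search zero = inj₂ λ _ ()
      search (suc k) with search k
      ... | inj₁ f = inj₁ f
      ... | inj₂ none with terminal? (d S k)
      ... | yes t = inj₁ (k , t , none)
      ... | no ¬t = inj₂ λ r r<sk → [ none r , (λ { refl → ¬t }) ]′ (ℕₚ.m≤n⇒m<n∨m≡n (ℕₚ.≤-pred r<sk))

    module _ {ℓ} (¬γ : ¬ QCycle H σ (P S (pos ℓ inf))) where

      -- Without a quasicycle the next row starts from the previous limit, and both operations fix a
      -- limit.
      const-from : ∀ k → EqP H (P S (pos (k + ℓ) inf)) (P S (pos ℓ inf))
      const-from zero = EqP-refl
      const-from (suc k) = EqP-trans (EqP-sym (proj₂ (PlaneSeq.limRow S (suc r)) _ ℕₚ.≤-refl))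
                                     (EqP-trans (cols (proj₁ (PlaneSeq.limRow S (suc r)))) eq)
        where
        r = k + ℓ
        R = rowsOf S (suc r)
        eq = const-from k
        ¬γᵣ : ¬ QCycle H σ (P S (pos r inf))
        ¬γᵣ γ = ¬γ (QCycle-map eq (λ e → UnusedQ-resp σ eq) γ)
        start : EqP H (P S (pos (suc r) (fin 0))) (P S (pos r inf))
        start with PlaneSeq.steps S r
        ... | inj₁ (_ , h , _) = h
        ... | inj₂ (inj₁ (γ , _)) = ⊥-elim (¬γᵣ γ)
        ... | inj₂ (inj₂ (_ , (γ , _) , _)) = ⊥-elim (¬γᵣ γ)
        fixed : ∀ j → EqP H (op (colKind j) σ (P S (pos r inf))) (P S (pos r inf))
        fixed j with colKind j | colKind-cases j
        ... | _ | inj₁ refl = EqP-sym (inf-fixed-cmp R r)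
        ... | _ | inj₂ refl = EqP-sym (inf-fixed-ant R r)
        cols : ∀ j → EqP H (P S (pos (suc r) (fin j))) (P S (pos r inf))
        cols zero = start
        cols (suc j) = EqP-trans (Rows.col R (suc r) j) (EqP-trans (op-cong (colKind j) σ (cols j)) (fixed j))

      top≡ : EqP H (P S top) (P S (pos ℓ inf))
      top≡ = let (I , lim) = PlaneSeq.limAll S in
        EqP-trans (EqP-sym (lim (I + ℓ) (ℕₚ.m≤m+n I ℓ))) (const-from I)

      top-skeletal : Skeletal H σ (P S top)
      top-skeletal = solid , λ γ → ¬γ (QCycle-map top≡ (λ e → UnusedQ-resp σ top≡) γ)
        where
        solid : ∀ x → SolidOn H σ (P S top x)
        solid x = let (c , a) = inf-solid (rowsOf S ℓ) ℓ ℕₚ.≤-refl x in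
          ConnectedOn-resp (EqP-⊇ top≡ x _) (EqP-⊆ top≡ x _) c , AntiConn-resp (EqP-⊇ top≡ x _) (EqP-⊆ top≡ x _) a

-- Improvement at the first terminal decision

theorem6 : (H : Hyp) (O : DOrder (m H)) (π : Quasigraph H)
    (S : PlaneSeq H O (asg π)) →
    (¬ Skeletal H (asg π) (P S top) ⊎ ¬ Acyclic H (asg π)) →
    Σ (Quasigraph H) λ ρ → Σ (PlaneSeq H O (asg ρ)) λ T →
    SigGt T S ⊎ (SigEquiv T S × usedCount ρ < usedCount π)
theorem6 H O π S defect = at-end (first-terminal S)
  where
  open Termination H O
  Better : Set₁
  Better = Σ (Quasigraph H) λ ρ → Σ (PlaneSeq H O (asg ρ)) λ T → SigGt T S ⊎ (SigEquiv T S × usedCount ρ < usedCount π)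
  cycle : ∀ {ℓ} → ¬ QCycle H (asg π) (P S (pos ℓ inf)) → GCycle H (asg π)
  -- After TERMINATE the final partition is skeletal, so the defect is `¬ Acyclic`. This is only a
  -- double negation; decidability turns it into a cycle.
  cycle ¬γ = decidable-stable (gcycle? (asg π)) λ acyclic → [ (λ ¬sk → ¬sk (top-skeletal S ¬γ)) , (λ ¬ac → ¬ac acyclic) ]′ defect
  at-end : ∃[ ℓ ] (Terminal (d S ℓ) × (∀ r → r < ℓ → ¬ Terminal (d S r))) → Better
  at-end (ℓ , t , running) = by-rule (PlaneSeq.steps S ℓ)
    where
    by-rule : StepRule H O (asg π) (P S) (d S) ℓ → Better
    by-rule (inj₁ (¬γ , _ , dℓ)) = Cycle.better π S ℓ running (cycle ¬γ) ¬γ dℓ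
    by-rule (inj₂ (inj₁ (_ , stop , _))) = let (ρ , T , gt) = improve-at-stop π S ℓ running stop in ρ , T , inj₁ gt
    by-rule (inj₂ (inj₂ (e , _ , _ , _ , de , _))) = ⊥-elim ([ (λ p → absurd₁ (trans (sym de) p)) , (λ p → absurd₂ (trans (sym de) p)) ]′ t)
      where
      absurd₁ : edgeD e ≢ STOP
      absurd₁ ()
      absurd₂ : edgeD e ≢ TERMINATE
      absurd₂ ()
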